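{- Let $x$ be an indeterminate. For all positive integers $n$, $$D_2(n;x):=\det_{0\le i,j\le n-1}\left(2^i\binom {x+i+2j+1}{2j+1}+\binom {x-i+2j+1}{2j+1}\right)$$ satisfies $$D_2(n;x)=2^{\binom n2+1}\prod _{i=0} ^{n-1}\frac {i!} {(2i+1)!}\prod _{i=0} ^{\lfloor n/2\rfloor}(x+4i+1)_{n-2i}\prod _{i=0} ^{\lfloor (n-1)/2\rfloor}(x-2i+3n)_{n-2i-1}$$ and $$D_2(n;x)=2\prod_{i=1}^n \frac{2^{2 i-2} \, \Gamma(i) \, \Gamma(2i+x) \,\Gamma(4i+x-1) \, \Gamma\bigl(\frac{3 i+x-2}{2}\bigr)}{\Gamma(2i) \, \Gamma(3i+x) \, \Gamma(3i+x-2) \,\Gamma\bigl(\frac{i+x}{2}\bigr)}.$$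
   Context: The binomial coefficient is $\binom{\alpha}{p}=\frac{\alpha(\alpha-1)\cdots(\alpha-p+1)}{p!}$ if $p\ge 0$ is an integer, and $0$ if $p<0$. The Pochhammer symbol is $(\alpha)_p=\alpha(\alpha+1)\cdots(\alpha+p-1)$ for $p\ge1$ and $(\alpha)_0=1$. The quotients of Gamma functions are understood as the rational functions of $x$ obtained by simplifying using $\Gamma(z+1)=z\Gamma(z)$. -}

module Defs where

open import Algebra.Bundles using (CommutativeRing; Semiring)
open import Data.Empty using (⊥-elim)
open import Data.Fin.Base using (Fin; zero; suc; toℕ; punchIn)
open import Data.Integer.Base as ℤ using (ℤ; +_; -[1+_])
import Data.Integer.DivMod as ℤ
import Data.Integer.Properties as ℤ
open import Data.List.Base using (List; []; _∷_; map)
open import Data.Nat.Base as ℕ using (ℕ; zero; suc; _!; ⌊_/2⌋; _∸_)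
open import Data.Nat.Combinatorics using (_C_)
open import Data.Nat.Properties using (_!≢0)
open import Data.Product.Base using (_,_)
open import Data.Rational.Base as ℚ using (ℚ; 0ℚ; 1ℚ; ½)
import Data.Rational.Properties as ℚ
open import Data.Sum.Base using (_⊎_; inj₁; inj₂; [_,_]′)
open import Level using (0ℓ; _⊔_)
open import Function.Base using (_∘_)
open import Relation.Binary.Bundles using (Setoid)
open import Relation.Binary.Definitions using (Decidable)
open import Relation.Binary.Structures using (IsEquivalence)
open import Relation.Binary.PropositionalEquality as ≡ using (_≡_; _≢_)
open import Relation.Nullary using (¬_; Dec; yes; no; contradiction)
import Relation.Binary.Reasoning.Setoid as SetoidReasoning
import Algebra.Properties.Group as GroupProperties
import Data.Nat.Coprimality as Coprimality
import Algebra.Properties.Ring as RingProperties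
import Algebra.Solver.Ring.NaturalCoefficients.Default as Solver

module RingNotions {c ℓ} (R : CommutativeRing c ℓ) where
  open CommutativeRing R hiding (zero)
  open import Algebra.Definitions.RawSemiring (Semiring.rawSemiring semiring) public
    using (_×_; _^_; sum; product)

  ι : ℕ → Carrier
  ι n = n × 1#

  -- Laplace expansion along the first row.
  det : ∀ {n} → (Fin n → Fin n → Carrier) → Carrier
  det {zero}  M = 1#
  det {suc n} M = sum λ j →
    (- 1#) ^ toℕ j * M zero j * det (λ i k → M (suc i) (punchIn j k))

  ∏< : ℕ → (ℕ → Carrier) → Carrier
  ∏< n f = product {n} (f ∘ toℕ)

  syntax ∏< n (λ i → e) = ∏[ i < n ] e

  pochhammer : Carrier → ℕ → Carrier
  pochhammer z p = ∏[ k < p ] (z + ι k)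

-- Coefficient lists, constant term first; trailing zeros are allowed.
Poly : Set
Poly = List ℚ

coeff : Poly → ℕ → ℚ
coeff []      k       = 0ℚ
coeff (a ∷ p) zero    = a
coeff (a ∷ p) (suc k) = coeff p k

module Polynomial where

  infix  4 _≈_ _≟_
  infixl 6 _+_
  infixl 7 _*_
  infixr 7 _·_
  infix  8 -_

  record _≈_ (p q : Poly) : Set where
    constructor mk≈
    field coeff-≡ : ∀ k → coeff p k ≡ coeff q k
  open _≈_ public

  _+_ : Poly → Poly → Poly
  []      + q       = q
  (a ∷ p) + []      = a ∷ p
  (a ∷ p) + (b ∷ q) = (a ℚ.+ b) ∷ (p + q)

  _·_ : ℚ → Poly → Poly
  a · p = map (a ℚ.*_) p

  -_ : Poly → Poly
  - p = map ℚ.-_ p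

  _*_ : Poly → Poly → Poly
  []      * q = []
  (a ∷ p) * q = a · q + (0ℚ ∷ p * q)

  refl : ∀ {p} → p ≈ p
  refl = mk≈ λ k → ≡.refl

  sym : ∀ {p q} → p ≈ q → q ≈ p
  sym e = mk≈ λ k → ≡.sym (coeff-≡ e k)

  trans : ∀ {p q r} → p ≈ q → q ≈ r → p ≈ r
  trans e f = mk≈ λ k → ≡.trans (coeff-≡ e k) (coeff-≡ f k)

  isEquivalence : IsEquivalence _≈_
  isEquivalence = record { refl = refl ; sym = sym ; trans = trans }

  setoid : Setoid 0ℓ 0ℓ
  setoid = record { isEquivalence = isEquivalence }

  coeff-+ : ∀ p q k → coeff (p + q) k ≡ coeff p k ℚ.+ coeff q k
  coeff-+ []      q       k       = ≡.sym (ℚ.+-identityˡ _)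
  coeff-+ (a ∷ p) []      k       = ≡.sym (ℚ.+-identityʳ _)
  coeff-+ (a ∷ p) (b ∷ q) zero    = ≡.refl
  coeff-+ (a ∷ p) (b ∷ q) (suc k) = coeff-+ p q k

  coeff-· : ∀ a p k → coeff (a · p) k ≡ a ℚ.* coeff p k
  coeff-· a []      k       = ≡.sym (ℚ.*-zeroʳ a)
  coeff-· a (b ∷ p) zero    = ≡.refl
  coeff-· a (b ∷ p) (suc k) = coeff-· a p k

  coeff-neg : ∀ p k → coeff (- p) k ≡ ℚ.- coeff p k
  coeff-neg []      k       = ≡.refl
  coeff-neg (b ∷ p) zero    = ≡.refl
  coeff-neg (b ∷ p) (suc k) = coeff-neg p k

  ∷-cong : ∀ {a b p q} → a ≡ b → p ≈ q → a ∷ p ≈ b ∷ q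
  ∷-cong a≡b p≈q = mk≈ λ { zero → a≡b ; (suc k) → coeff-≡ p≈q k }

  head-≡ : ∀ {a b p q} → a ∷ p ≈ b ∷ q → a ≡ b
  head-≡ e = coeff-≡ e 0

  tail-≈ : ∀ {a b p q} → a ∷ p ≈ b ∷ q → p ≈ q
  tail-≈ e = mk≈ λ k → coeff-≡ e (suc k)

  head-0 : ∀ {a p} → a ∷ p ≈ [] → a ≡ 0ℚ
  head-0 e = coeff-≡ e 0

  tail-0 : ∀ {a p} → a ∷ p ≈ [] → p ≈ []
  tail-0 e = mk≈ λ k → coeff-≡ e (suc k)

  ∷-0 : ∀ {a p} → a ≡ 0ℚ → p ≈ [] → a ∷ p ≈ []
  ∷-0 a≡0 p≈0 = mk≈ λ { zero → a≡0 ; (suc k) → coeff-≡ p≈0 k }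

  _≟0 : ∀ p → Dec (p ≈ [])
  []      ≟0 = yes refl
  (a ∷ p) ≟0 with a ℚ.≟ 0ℚ | p ≟0
  ... | yes a≡0 | yes p≈0 = yes (∷-0 a≡0 p≈0)
  ... | no  a≢0 | _       = no (a≢0 ∘ head-0)
  ... | yes _   | no  p≉0 = no (p≉0 ∘ tail-0)

  _≟_ : Decidable _≈_
  []      ≟ []      = yes refl
  []      ≟ (b ∷ q) with (b ∷ q) ≟0
  ... | yes e = yes (sym e)
  ... | no ¬e = no (¬e ∘ sym)
  (a ∷ p) ≟ []      = (a ∷ p) ≟0
  (a ∷ p) ≟ (b ∷ q) with a ℚ.≟ b | p ≟ q
  ... | yes a≡b | yes p≈q = yes (∷-cong a≡b p≈q)
  ... | no  a≢b | _       = no (a≢b ∘ head-≡)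
  ... | yes _   | no  p≉q = no (p≉q ∘ tail-≈)

  +-cong : ∀ {p p′ q q′} → p ≈ p′ → q ≈ q′ → p + q ≈ p′ + q′
  +-cong {p} {p′} {q} {q′} e f = mk≈ λ k →
    ≡.trans (coeff-+ p q k)
      (≡.trans (≡.cong₂ ℚ._+_ (coeff-≡ e k) (coeff-≡ f k))
        (≡.sym (coeff-+ p′ q′ k)))

  +-congˡ : ∀ p {q q′} → q ≈ q′ → p + q ≈ p + q′
  +-congˡ p = +-cong (refl {p})

  +-congʳ : ∀ q {p p′} → p ≈ p′ → p + q ≈ p′ + q
  +-congʳ q e = +-cong e (refl {q})

  +-assoc : ∀ p q r → (p + q) + r ≈ p + (q + r)
  +-assoc p q r = mk≈ λ k → begin
    coeff ((p + q) + r) k                    ≡⟨ coeff-+ (p + q) r k ⟩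
    coeff (p + q) k ℚ.+ coeff r k            ≡⟨ ≡.cong (ℚ._+ coeff r k) (coeff-+ p q k) ⟩
    coeff p k ℚ.+ coeff q k ℚ.+ coeff r k    ≡⟨ ℚ.+-assoc (coeff p k) (coeff q k) (coeff r k) ⟩
    coeff p k ℚ.+ (coeff q k ℚ.+ coeff r k)  ≡⟨ ≡.cong (coeff p k ℚ.+_) (coeff-+ q r k) ⟨
    coeff p k ℚ.+ coeff (q + r) k            ≡⟨ coeff-+ p (q + r) k ⟨
    coeff (p + (q + r)) k                    ∎
    where open ≡.≡-Reasoning

  +-comm : ∀ p q → p + q ≈ q + p
  +-comm p q = mk≈ λ k →
    ≡.trans (coeff-+ p q k)
      (≡.trans (ℚ.+-comm (coeff p k) (coeff q k)) (≡.sym (coeff-+ q p k)))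

  +-identityʳ : ∀ p → p + [] ≈ p
  +-identityʳ []      = refl
  +-identityʳ (a ∷ p) = refl

  -‿cong : ∀ {p q} → p ≈ q → - p ≈ - q
  -‿cong {p} {q} e = mk≈ λ k →
    ≡.trans (coeff-neg p k) (≡.trans (≡.cong ℚ.-_ (coeff-≡ e k)) (≡.sym (coeff-neg q k)))

  -‿inverseʳ : ∀ p → p + (- p) ≈ []
  -‿inverseʳ p = mk≈ λ k →
    ≡.trans (coeff-+ p (- p) k)
      (≡.trans (≡.cong (coeff p k ℚ.+_) (coeff-neg p k)) (ℚ.+-inverseʳ (coeff p k)))

  ·-cong : ∀ {a b p q} → a ≡ b → p ≈ q → a · p ≈ b · q
  ·-cong {a} {b} {p} {q} e f = mk≈ λ k →
    ≡.trans (coeff-· a p k)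
      (≡.trans (≡.cong₂ ℚ._*_ e (coeff-≡ f k)) (≡.sym (coeff-· b q k)))

  ·-congˡ : ∀ a {p q} → p ≈ q → a · p ≈ a · q
  ·-congˡ a = ·-cong {a} ≡.refl

  ·-congʳ : ∀ p {a b} → a ≡ b → a · p ≈ b · p
  ·-congʳ p e = ·-cong e (refl {p})

  ·-distribˡ : ∀ a p q → a · (p + q) ≈ a · p + a · q
  ·-distribˡ a p q = mk≈ λ k → begin
    coeff (a · (p + q)) k                      ≡⟨ coeff-· a (p + q) k ⟩
    a ℚ.* coeff (p + q) k                      ≡⟨ ≡.cong (a ℚ.*_) (coeff-+ p q k) ⟩
    a ℚ.* (coeff p k ℚ.+ coeff q k)            ≡⟨ ℚ.*-distribˡ-+ a (coeff p k) (coeff q k) ⟩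
    a ℚ.* coeff p k ℚ.+ a ℚ.* coeff q k        ≡⟨ ≡.cong₂ ℚ._+_ (coeff-· a p k) (coeff-· a q k) ⟨
    coeff (a · p) k ℚ.+ coeff (a · q) k        ≡⟨ coeff-+ (a · p) (a · q) k ⟨
    coeff (a · p + a · q) k                    ∎
    where open ≡.≡-Reasoning

  ·-distribʳ : ∀ a b p → (a ℚ.+ b) · p ≈ a · p + b · p
  ·-distribʳ a b p = mk≈ λ k → begin
    coeff ((a ℚ.+ b) · p) k                    ≡⟨ coeff-· (a ℚ.+ b) p k ⟩
    (a ℚ.+ b) ℚ.* coeff p k                    ≡⟨ ℚ.*-distribʳ-+ (coeff p k) a b ⟩
    a ℚ.* coeff p k ℚ.+ b ℚ.* coeff p k        ≡⟨ ≡.cong₂ ℚ._+_ (coeff-· a p k) (coeff-· b p k) ⟨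
    coeff (a · p) k ℚ.+ coeff (b · p) k        ≡⟨ coeff-+ (a · p) (b · p) k ⟨
    coeff (a · p + b · p) k                    ∎
    where open ≡.≡-Reasoning

  ·-assoc : ∀ a b p → (a ℚ.* b) · p ≈ a · b · p
  ·-assoc a b p = mk≈ λ k → begin
    coeff ((a ℚ.* b) · p) k    ≡⟨ coeff-· (a ℚ.* b) p k ⟩
    a ℚ.* b ℚ.* coeff p k      ≡⟨ ℚ.*-assoc a b (coeff p k) ⟩
    a ℚ.* (b ℚ.* coeff p k)    ≡⟨ ≡.cong (a ℚ.*_) (coeff-· b p k) ⟨
    a ℚ.* coeff (b · p) k      ≡⟨ coeff-· a (b · p) k ⟨
    coeff (a · b · p) k        ∎
    where open ≡.≡-Reasoning

  ·-identity : ∀ p → 1ℚ · p ≈ p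
  ·-identity p = mk≈ λ k → ≡.trans (coeff-· 1ℚ p k) (ℚ.*-identityˡ (coeff p k))

  ·-zero : ∀ p → 0ℚ · p ≈ []
  ·-zero p = mk≈ λ k → ≡.trans (coeff-· 0ℚ p k) (ℚ.*-zeroˡ (coeff p k))

  *-zeroʳ : ∀ p → p * [] ≈ []
  *-zeroʳ []      = refl
  *-zeroʳ (a ∷ p) = ∷-0 ≡.refl (*-zeroʳ p)

  *-congˡ : ∀ p {q q′} → q ≈ q′ → p * q ≈ p * q′
  *-congˡ []      e = refl
  *-congˡ (a ∷ p) e = +-cong (·-congˡ a e) (∷-cong ≡.refl (*-congˡ p e))

  ≈[]⇒*≈[] : ∀ p q → p ≈ [] → p * q ≈ []
  ≈[]⇒*≈[] []      q e = refl
  ≈[]⇒*≈[] (a ∷ p) q e = +-cong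
    (trans (·-congʳ q (head-0 e)) (·-zero q))
    (∷-0 ≡.refl (≈[]⇒*≈[] p q (tail-0 e)))

  *-congʳ : ∀ {p p′} q → p ≈ p′ → p * q ≈ p′ * q
  *-congʳ {[]}    {p′}     q e = sym (≈[]⇒*≈[] p′ q (sym e))
  *-congʳ {a ∷ p} {[]}     q e = ≈[]⇒*≈[] (a ∷ p) q e
  *-congʳ {a ∷ p} {b ∷ p′} q e =
    +-cong (·-congʳ q (head-≡ e)) (∷-cong ≡.refl (*-congʳ q (tail-≈ e)))

  *-cong : ∀ {p p′ q q′} → p ≈ p′ → q ≈ q′ → p * q ≈ p′ * q′
  *-cong {p} {p′} {q} {q′} e f = trans (*-congʳ q e) (*-congˡ p′ f)

  private
    +-interchange : ∀ p q r s → (p + q) + (r + s) ≈ (p + r) + (q + s)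
    +-interchange p q r s = begin
      (p + q) + (r + s)   ≈⟨ +-assoc p q (r + s) ⟩
      p + (q + (r + s))   ≈⟨ +-congˡ p (+-assoc q r s) ⟨
      p + ((q + r) + s)   ≈⟨ +-congˡ p (+-congʳ s (+-comm q r)) ⟩
      p + ((r + q) + s)   ≈⟨ +-congˡ p (+-assoc r q s) ⟩
      p + (r + (q + s))   ≈⟨ +-assoc p r (q + s) ⟨
      (p + r) + (q + s)   ∎
      where open SetoidReasoning setoid

  *-distribʳ : ∀ r p q → (p + q) * r ≈ p * r + q * r
  *-distribʳ r []      q       = refl
  *-distribʳ r (a ∷ p) []      = sym (+-identityʳ ((a ∷ p) * r))
  *-distribʳ r (a ∷ p) (b ∷ q) =
    trans (+-cong (·-distribʳ a b r)
                  (∷-cong (≡.sym (ℚ.+-identityʳ 0ℚ)) (*-distribʳ r p q)))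
          (+-interchange (a · r) (b · r) (0ℚ ∷ p * r) (0ℚ ∷ q * r))

  *-∷ : ∀ p b q → p * (b ∷ q) ≈ b · p + (0ℚ ∷ p * q)
  *-∷ []      b q = sym (∷-0 ≡.refl refl)
  *-∷ (a ∷ p) b q = ∷-cong (≡.cong (ℚ._+ 0ℚ) (ℚ.*-comm a b)) (begin
    a · q + p * (b ∷ q)             ≈⟨ +-congˡ (a · q) (*-∷ p b q) ⟩
    a · q + (b · p + (0ℚ ∷ p * q))  ≈⟨ +-assoc (a · q) (b · p) (0ℚ ∷ p * q) ⟨
    (a · q + b · p) + (0ℚ ∷ p * q)  ≈⟨ +-congʳ (0ℚ ∷ p * q) (+-comm (a · q) (b · p)) ⟩
    (b · p + a · q) + (0ℚ ∷ p * q)  ≈⟨ +-assoc (b · p) (a · q) (0ℚ ∷ p * q) ⟩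
    b · p + (a · q + (0ℚ ∷ p * q))  ∎)
    where open SetoidReasoning setoid

  *-comm : ∀ p q → p * q ≈ q * p
  *-comm []      q = sym (*-zeroʳ q)
  *-comm (a ∷ p) q =
    trans (+-congˡ (a · q) (∷-cong ≡.refl (*-comm p q))) (sym (*-∷ q a p))

  ·-* : ∀ a p q → (a · p) * q ≈ a · (p * q)
  ·-* a []      q = refl
  ·-* a (b ∷ p) q =
    trans (+-cong (·-assoc a b q)
                  (∷-cong (≡.sym (ℚ.*-zeroʳ a)) (·-* a p q)))
          (sym (·-distribˡ a (b · q) (0ℚ ∷ p * q)))

  shift-* : ∀ p q → (0ℚ ∷ p) * q ≈ 0ℚ ∷ p * q
  shift-* p q = +-congʳ (0ℚ ∷ p * q) (·-zero q)

  *-assoc : ∀ p q r → (p * q) * r ≈ p * (q * r)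
  *-assoc []      q r = refl
  *-assoc (a ∷ p) q r =
    trans (*-distribʳ r (a · q) (0ℚ ∷ p * q))
      (+-cong (·-* a q r)
              (trans (shift-* (p * q) r) (∷-cong ≡.refl (*-assoc p q r))))

  *-identityˡ : ∀ p → (1ℚ ∷ []) * p ≈ p
  *-identityˡ p =
    trans (+-cong (·-identity p) (∷-0 ≡.refl refl)) (+-identityʳ p)

  private
    ab≡0⇒b≡0 : ∀ a b → a ≢ 0ℚ → a ℚ.* b ≡ 0ℚ → b ≡ 0ℚ
    ab≡0⇒b≡0 a b a≢0 ab≡0 = begin
      b                      ≡⟨ ℚ.*-identityˡ b ⟨
      1ℚ ℚ.* b               ≡⟨ ≡.cong (ℚ._* b) (ℚ.*-inverseˡ a) ⟨
      (ℚ.1/ a) ℚ.* a ℚ.* b   ≡⟨ ℚ.*-assoc (ℚ.1/ a) a b ⟩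
      (ℚ.1/ a) ℚ.* (a ℚ.* b) ≡⟨ ≡.cong ((ℚ.1/ a) ℚ.*_) ab≡0 ⟩
      (ℚ.1/ a) ℚ.* 0ℚ        ≡⟨ ℚ.*-zeroʳ (ℚ.1/ a) ⟩
      0ℚ                     ∎
      where
        open ≡.≡-Reasoning
        instance _ = ℚ.≢-nonZero a≢0

    cancel-∷ : ∀ a p q → a ≢ 0ℚ → (a ∷ p) * q ≈ [] → q ≈ []
    cancel-∷ a p []      a≢0 e = refl
    cancel-∷ a p (b ∷ q) a≢0 e = ∷-0 b≡0 (cancel-∷ a p q a≢0 (tail-0 (begin
      0ℚ ∷ (a ∷ p) * q                ≈⟨ +-congʳ (0ℚ ∷ (a ∷ p) * q) (·-zero (a ∷ p)) ⟨
      0ℚ · (a ∷ p) + (0ℚ ∷ (a ∷ p) * q)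
        ≈⟨ +-congʳ (0ℚ ∷ (a ∷ p) * q) (·-congʳ (a ∷ p) b≡0) ⟨
      b · (a ∷ p) + (0ℚ ∷ (a ∷ p) * q) ≈⟨ *-∷ (a ∷ p) b q ⟨
      (a ∷ p) * (b ∷ q)               ≈⟨ e ⟩
      []                              ∎)))
      where
        open SetoidReasoning setoid
        b≡0 : b ≡ 0ℚ
        b≡0 = ab≡0⇒b≡0 a b a≢0 (≡.trans (≡.sym (ℚ.+-identityʳ (a ℚ.* b))) (head-0 e))

  *-≈0 : ∀ p q → p * q ≈ [] → p ≈ [] ⊎ q ≈ []
  *-≈0 []      q e = inj₁ refl
  *-≈0 (a ∷ p) q e with a ℚ.≟ 0ℚ
  ... | no  a≢0 = inj₂ (cancel-∷ a p q a≢0 e)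
  ... | yes a≡0 = [ inj₁ ∘ ∷-0 a≡0 , inj₂ ]′ (*-≈0 p q (tail-0 (begin
    0ℚ ∷ p * q     ≈⟨ shift-* p q ⟨
    (0ℚ ∷ p) * q   ≈⟨ *-congʳ q (∷-cong a≡0 (refl {p})) ⟨
    (a ∷ p) * q    ≈⟨ e ⟩
    []             ∎)))
    where open SetoidReasoning setoid

  commutativeRing : CommutativeRing 0ℓ 0ℓ
  commutativeRing = record
    { Carrier = Poly
    ; _≈_ = _≈_
    ; _+_ = _+_
    ; _*_ = _*_
    ; -_  = -_
    ; 0#  = []
    ; 1#  = 1ℚ ∷ []
    ; isCommutativeRing = record
      { isRing = record
        { +-isAbelianGroup = record
          { isGroup = record
            { isMonoid = record
              { isSemigroup = record
                { isMagma = record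
                  { isEquivalence = isEquivalence
                  ; ∙-cong = +-cong
                  }
                ; assoc = +-assoc
                }
              ; identity = (λ p → refl) , +-identityʳ
              }
            ; inverse = (λ p → trans (+-comm (- p) p) (-‿inverseʳ p)) , -‿inverseʳ
            ; ⁻¹-cong = -‿cong
            }
          ; comm = +-comm
          }
        ; *-cong = *-cong
        ; *-assoc = *-assoc
        ; *-identity = *-identityˡ
                     , λ p → trans (*-comm p (1ℚ ∷ [])) (*-identityˡ p)
        ; distrib = (λ p q r → trans (*-comm p (q + r))
                       (trans (*-distribʳ p q r) (+-cong (*-comm q p) (*-comm r p))))
                  , *-distribʳ
        }
      ; *-comm = *-comm
      }
    }

ℚ[x] : CommutativeRing 0ℓ 0ℓ
ℚ[x] = Polynomial.commutativeRing

const : ℚ → Poly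
const a = a ∷ []

X : Poly
X = 0ℚ ∷ 1ℚ ∷ []

record DiscreteDomain {c ℓ} (R : CommutativeRing c ℓ) : Set (c ⊔ ℓ) where
  open CommutativeRing R
  field
    _≟_  : Decidable _≈_
    1≉0  : ¬ 1# ≈ 0#
    *-≈0 : ∀ a b → a * b ≈ 0# → a ≈ 0# ⊎ b ≈ 0#

module FractionField {c ℓ} (R : CommutativeRing c ℓ) (D : DiscreteDomain R) where

  open CommutativeRing R hiding (zero)
  open DiscreteDomain D
  open RingProperties ring using (x∙y⁻¹≈ε⇒x≈y; x≈y⇒x∙y⁻¹≈ε; -‿distribˡ-*)
  open SetoidReasoning setoid
  open Solver commutativeSemiring using (solve; _:=_; _:+_; _:*_)

  record Fraction : Set (c ⊔ ℓ) where
    constructor mk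
    field
      num   : Carrier
      den   : Carrier
      den≉0 : ¬ den ≈ 0#
  open Fraction public

  *-≉0 : ∀ {a b} → ¬ a ≈ 0# → ¬ b ≈ 0# → ¬ a * b ≈ 0#
  *-≉0 a≉0 b≉0 = [ a≉0 , b≉0 ]′ ∘ *-≈0 _ _

  cancelʳ : ∀ a b k → ¬ k ≈ 0# → a * k ≈ b * k → a ≈ b
  cancelʳ a b k k≉0 e =
    [ x∙y⁻¹≈ε⇒x≈y a b , ⊥-elim ∘ k≉0 ]′ (*-≈0 (a - b) k (begin
      (a - b) * k          ≈⟨ distribʳ k a (- b) ⟩
      a * k + (- b) * k    ≈⟨ +-congˡ (-‿distribˡ-* b k) ⟨
      a * k - b * k        ≈⟨ x≈y⇒x∙y⁻¹≈ε e ⟩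
      0#                   ∎))

  infix 4 _≈ᶠ_
  record _≈ᶠ_ (f g : Fraction) : Set ℓ where
    constructor mk≈
    field cross : num f * den g ≈ num g * den f
  open _≈ᶠ_ public

  embed : Carrier → Fraction
  embed a = mk a 1# 1≉0

  0ᶠ 1ᶠ : Fraction
  0ᶠ = embed 0#
  1ᶠ = embed 1#

  infixl 6 _+ᶠ_
  infixl 7 _*ᶠ_ _/ᶠ_
  infix  8 -ᶠ_ _⁻¹

  _+ᶠ_ : Fraction → Fraction → Fraction
  mk a b b≉0 +ᶠ mk c d d≉0 = mk (a * d + c * b) (b * d) (*-≉0 b≉0 d≉0)

  _*ᶠ_ : Fraction → Fraction → Fraction
  mk a b b≉0 *ᶠ mk c d d≉0 = mk (a * c) (b * d) (*-≉0 b≉0 d≉0)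

  -ᶠ_ : Fraction → Fraction
  -ᶠ mk a b b≉0 = mk (- a) b b≉0

  -- Total inverse, with 0 ⁻¹ = 0; inverseʳ is the defining law otherwise.
  _⁻¹ : Fraction → Fraction
  mk a b b≉0 ⁻¹ with a ≟ 0#
  ... | yes _  = 0ᶠ
  ... | no a≉0 = mk b a a≉0

  _/ᶠ_ : Fraction → Fraction → Fraction
  f /ᶠ g = f *ᶠ g ⁻¹

  reflᶠ : ∀ {f} → f ≈ᶠ f
  reflᶠ = mk≈ refl

  symᶠ : ∀ {f g} → f ≈ᶠ g → g ≈ᶠ f
  symᶠ (mk≈ e) = mk≈ (sym e)

  transᶠ : ∀ {f g h} → f ≈ᶠ g → g ≈ᶠ h → f ≈ᶠ h
  transᶠ {mk a b _} {mk c d d≉0} {mk s t _} (mk≈ e) (mk≈ e′) =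
    mk≈ (cancelʳ (a * t) (s * b) d d≉0 (begin
      (a * t) * d   ≈⟨ swap a t d ⟩
      (a * d) * t   ≈⟨ *-congʳ e ⟩
      (c * b) * t   ≈⟨ swap c b t ⟩
      (c * t) * b   ≈⟨ *-congʳ e′ ⟩
      (s * d) * b   ≈⟨ swap s d b ⟩
      (s * b) * d   ∎))
    where
      swap : ∀ p q r → (p * q) * r ≈ (p * r) * q
      swap = solve 3 (λ p q r → ((p :* q) :* r) := ((p :* r) :* q)) refl

  +ᶠ-cong : ∀ {f f′ g g′} → f ≈ᶠ f′ → g ≈ᶠ g′ → f +ᶠ g ≈ᶠ f′ +ᶠ g′
  +ᶠ-cong {mk a b _} {mk a′ b′ _} {mk c d _} {mk c′ d′ _} (mk≈ e) (mk≈ e′) = mk≈ (begin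
    (a * d + c * b) * (b′ * d′)                  ≈⟨ expand a b c d b′ d′ ⟩
    (a * b′) * (d * d′) + (c * d′) * (b * b′)    ≈⟨ +-cong (*-congʳ e) (*-congʳ e′) ⟩
    (a′ * b) * (d * d′) + (c′ * d) * (b * b′)    ≈⟨ collect a′ b c′ d b′ d′ ⟩
    (a′ * d′ + c′ * b′) * (b * d)                ∎)
    where
      expand : ∀ a b c d b′ d′ → (a * d + c * b) * (b′ * d′)
             ≈ (a * b′) * (d * d′) + (c * d′) * (b * b′)
      expand = solve 6 (λ a b c d b′ d′ → ((a :* d :+ c :* b) :* (b′ :* d′))
             := ((a :* b′) :* (d :* d′) :+ (c :* d′) :* (b :* b′))) refl
      collect : ∀ a b c d b′ d′ → (a * b) * (d * d′) + (c * d) * (b * b′)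
              ≈ (a * d′ + c * b′) * (b * d)
      collect = solve 6 (λ a b c d b′ d′ → ((a :* b) :* (d :* d′) :+ (c :* d) :* (b :* b′))
              := ((a :* d′ :+ c :* b′) :* (b :* d))) refl

  *ᶠ-cong : ∀ {f f′ g g′} → f ≈ᶠ f′ → g ≈ᶠ g′ → f *ᶠ g ≈ᶠ f′ *ᶠ g′
  *ᶠ-cong {mk a b _} {mk a′ b′ _} {mk c d _} {mk c′ d′ _} (mk≈ e) (mk≈ e′) = mk≈ (begin
    (a * c) * (b′ * d′)   ≈⟨ medial a c b′ d′ ⟩
    (a * b′) * (c * d′)   ≈⟨ *-cong e e′ ⟩
    (a′ * b) * (c′ * d)   ≈⟨ medial a′ b c′ d ⟩
    (a′ * c′) * (b * d)   ∎)
    where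
      medial : ∀ p q r s → (p * q) * (r * s) ≈ (p * r) * (q * s)
      medial = solve 4 (λ p q r s → ((p :* q) :* (r :* s)) := ((p :* r) :* (q :* s))) refl

  -ᶠ-cong : ∀ {f g} → f ≈ᶠ g → -ᶠ f ≈ᶠ -ᶠ g
  -ᶠ-cong {mk a b _} {mk c d _} (mk≈ e) = mk≈ (begin
    (- a) * d   ≈⟨ -‿distribˡ-* a d ⟨
    - (a * d)   ≈⟨ -‿cong e ⟩
    - (c * b)   ≈⟨ -‿distribˡ-* c b ⟩
    (- c) * b   ∎)

  inverseʳ : ∀ f → ¬ f ≈ᶠ 0ᶠ → f *ᶠ f ⁻¹ ≈ᶠ 1ᶠ
  inverseʳ (mk a b b≉0) f≉0 with a ≟ 0#
  ... | yes a≈0 = ⊥-elim (f≉0 (mk≈ (trans (*-identityʳ a) (trans a≈0 (sym (zeroˡ b))))))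
  ... | no  _   = mk≈ (trans (*-identityʳ _) (trans (*-comm a b) (sym (*-identityˡ _))))

  commutativeRing : CommutativeRing (c ⊔ ℓ) ℓ
  commutativeRing = record
    { Carrier = Fraction
    ; _≈_ = _≈ᶠ_
    ; _+_ = _+ᶠ_
    ; _*_ = _*ᶠ_
    ; -_  = -ᶠ_
    ; 0#  = 0ᶠ
    ; 1#  = 1ᶠ
    ; isCommutativeRing = record
      { isRing = record
        { +-isAbelianGroup = record
          { isGroup = record
            { isMonoid = record
              { isSemigroup = record
                { isMagma = record
                  { isEquivalence = record { refl = reflᶠ ; sym = symᶠ ; trans = transᶠ }
                  ; ∙-cong = +ᶠ-cong
                  }
                ; assoc = λ { (mk a b _) (mk c d _) (mk s t _) → mk≈ (+-assoc-eq a b c d s t) }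
                }
              ; identity = (λ { (mk a b _) → mk≈ (+-idˡ-eq a b) })
                         , (λ { (mk a b _) → mk≈ (+-idʳ-eq a b) })
              }
            ; inverse = (λ { (mk a b _) → mk≈ (neg-eqˡ a b) })
                      , (λ { (mk a b _) → mk≈ (neg-eqʳ a b) })
            ; ⁻¹-cong = -ᶠ-cong
            }
          ; comm = λ { (mk a b _) (mk c d _) → mk≈ (+-comm-eq a b c d) }
          }
        ; *-cong = *ᶠ-cong
        ; *-assoc = λ { (mk a b _) (mk c d _) (mk s t _) → mk≈ (*-assoc-eq a b c d s t) }
        ; *-identity = (λ { (mk a b _) → mk≈ (*-idˡ-eq a b) })
                     , (λ { (mk a b _) → mk≈ (*-idʳ-eq a b) })
        ; distrib = (λ { (mk a b _) (mk c d _) (mk s t _) → mk≈ (distribˡ-eq a b c d s t) })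
                  , (λ { (mk a b _) (mk c d _) (mk s t _) → mk≈ (distribʳ-eq a b c d s t) })
        }
      ; *-comm = λ { (mk a b _) (mk c d _) → mk≈ (*-comm-eq a b c d) }
      }
    }
    where
      +-assoc-eq : ∀ a b c d s t →
        ((a * d + c * b) * t + s * (b * d)) * (b * (d * t))
        ≈ (a * (d * t) + (c * t + s * d) * b) * ((b * d) * t)
      +-assoc-eq = solve 6 (λ a b c d s t →
        (((a :* d :+ c :* b) :* t :+ s :* (b :* d)) :* (b :* (d :* t)))
        := ((a :* (d :* t) :+ (c :* t :+ s :* d) :* b) :* ((b :* d) :* t))) refl

      +-idˡ-eq : ∀ a b → (0# * b + a * 1#) * b ≈ a * (1# * b)
      +-idˡ-eq a b = *-cong (trans (+-cong (zeroˡ b) (*-identityʳ a)) (+-identityˡ a))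
                            (sym (*-identityˡ b))

      +-idʳ-eq : ∀ a b → (a * 1# + 0# * b) * b ≈ a * (b * 1#)
      +-idʳ-eq a b = *-cong (trans (+-cong (*-identityʳ a) (zeroˡ b)) (+-identityʳ a))
                            (sym (*-identityʳ b))

      neg-eqˡ : ∀ a b → ((- a) * b + a * b) * 1# ≈ 0# * (b * b)
      neg-eqˡ a b = trans (*-identityʳ _)
        (trans (trans (sym (distribʳ b (- a) a)) (trans (*-congʳ (-‿inverseˡ a)) (zeroˡ b)))
               (sym (zeroˡ _)))

      neg-eqʳ : ∀ a b → (a * b + (- a) * b) * 1# ≈ 0# * (b * b)
      neg-eqʳ a b = trans (*-congʳ (+-comm (a * b) ((- a) * b))) (neg-eqˡ a b)

      +-comm-eq : ∀ a b c d → (a * d + c * b) * (d * b) ≈ (c * b + a * d) * (b * d)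
      +-comm-eq a b c d = *-cong (+-comm (a * d) (c * b)) (*-comm d b)

      *-assoc-eq : ∀ a b c d s t →
        ((a * c) * s) * (b * (d * t)) ≈ (a * (c * s)) * ((b * d) * t)
      *-assoc-eq a b c d s t = *-cong (*-assoc a c s) (sym (*-assoc b d t))

      *-idˡ-eq : ∀ a b → (1# * a) * b ≈ a * (1# * b)
      *-idˡ-eq a b = *-cong (*-identityˡ a) (sym (*-identityˡ b))

      *-idʳ-eq : ∀ a b → (a * 1#) * b ≈ a * (b * 1#)
      *-idʳ-eq a b = *-cong (*-identityʳ a) (sym (*-identityʳ b))

      distribˡ-eq : ∀ a b c d s t →
        (a * (c * t + s * d)) * ((b * d) * (b * t))
        ≈ ((a * c) * (b * t) + (a * s) * (b * d)) * (b * (d * t))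
      distribˡ-eq = solve 6 (λ a b c d s t →
        ((a :* (c :* t :+ s :* d)) :* ((b :* d) :* (b :* t)))
        := (((a :* c) :* (b :* t) :+ (a :* s) :* (b :* d)) :* (b :* (d :* t)))) refl

      distribʳ-eq : ∀ a b c d s t →
        ((c * t + s * d) * a) * ((d * b) * (t * b))
        ≈ ((c * a) * (t * b) + (s * a) * (d * b)) * ((d * t) * b)
      distribʳ-eq = solve 6 (λ a b c d s t →
        (((c :* t :+ s :* d) :* a) :* ((d :* b) :* (t :* b)))
        := (((c :* a) :* (t :* b) :+ (s :* a) :* (d :* b)) :* ((d :* t) :* b))) refl

      *-comm-eq : ∀ a b c d → (a * c) * (d * b) ≈ (c * a) * (b * d)
      *-comm-eq a b c d = *-cong (*-comm a c) (*-comm d b)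

ℚ[x]-discreteDomain : DiscreteDomain ℚ[x]
ℚ[x]-discreteDomain = record
  { _≟_  = Polynomial._≟_
  ; 1≉0  = λ e → contradiction (Polynomial.coeff-≡ e 0) λ ()
  ; *-≈0 = Polynomial.*-≈0
  }

module RationalFunction = FractionField ℚ[x] ℚ[x]-discreteDomain

ℚ⟮x⟯ : CommutativeRing 0ℓ 0ℓ
ℚ⟮x⟯ = RationalFunction.commutativeRing

open RationalFunction public
  using (Fraction; embed; _≈ᶠ_; _*ᶠ_; _/ᶠ_; 0ᶠ)
open RingNotions ℚ⟮x⟯ public
  using () renaming (ι to ιᶠ; _^_ to _^ᶠ_)

open CommutativeRing ℚ[x] public
  using (_≈_; _+_; _*_; _-_; 0#; 1#)
open RingNotions ℚ[x] public
  using (ι; _^_; det; ∏<; pochhammer)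

∏ᶠ< : ℕ → (ℕ → Fraction) → Fraction
∏ᶠ< = RingNotions.∏< ℚ⟮x⟯

syntax ∏ᶠ< n (λ i → e) = ∏ᶠ[ i < n ] e

-- A quotient of Gamma functions at arguments in ℚ[x], simplified by means
-- of the functional equation alone, is a quotient of values of an arbitrary
-- solution.  The equation at z = 0 has to be left out (Γ has a pole there);
-- the values at the non-positive integers are irrelevant.
record GammaFunction : Set where
  field
    Γ            : Poly → Fraction
    Γ-cong       : ∀ {z w} → z ≈ w → Γ z ≈ᶠ Γ w
    Γ-nonzero    : ∀ z → ¬ Γ z ≈ᶠ 0ᶠ
    Γ-functional : ∀ z → ¬ z ≈ 0# → Γ (z + 1#) ≈ᶠ embed z *ᶠ Γ z

-- Such a solution exists: write z = r + m with m the floor of the constant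
-- term of z, and take ∏ (r + k) over 0 ≤ k < m, or 1 / ∏ (r + k) over
-- m ≤ k < 0 if m is negative, omitting a factor r + k that is 0.
module GammaExistence where
  open CommutativeRing ℚ[x]
    hiding
    ( _≈_; _+_; _*_; _-_; 0#; 1#; zero
    ; +-congˡ; +-congʳ; *-congˡ; *-congʳ )
  open Polynomial using (+-congˡ; +-congʳ; *-congˡ; *-congʳ)
  open RationalFunction using (mk; mk≈; cross; *-≉0; *ᶠ-cong; reflᶠ; transᶠ)
  open Solver commutativeSemiring using (solve; con; _:=_; _:*_)
  open DiscreteDomain ℚ[x]-discreteDomain using (1≉0)
  open GroupProperties +-group using (⁻¹-anti-homo-∙)

  private
    fromℤ : ℤ → ℚ
    fromℤ i = ℚ.mkℚ i 0 (Coprimality.sym (Coprimality.1-coprimeTo ℤ.∣ i ∣))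

    fromℤ-suc : ∀ i → fromℤ (ℤ.suc i) ≡ fromℤ i ℚ.+ 1ℚ
    fromℤ-suc i = begin
      fromℤ (ℤ.suc i)            ≡⟨ ≡.cong fromℤ (ℤ.+-comm (+ 1) i) ⟩
      fromℤ (i ℤ.+ + 1)          ≡⟨ ≡.cong (λ j → fromℤ (j ℤ.+ + 1)) (ℤ.*-identityʳ i) ⟨
      fromℤ (i ℤ.* + 1 ℤ.+ + 1)  ≡⟨ ℚ.↥p/↧p≡p (fromℤ (i ℤ.* + 1 ℤ.+ + 1)) ⟨
      fromℤ i ℚ.+ 1ℚ             ∎
      where open ≡.≡-Reasoning

    floor-≤ : ∀ b → fromℤ (ℚ.floor b) ℚ.≤ b
    floor-≤ b@(ℚ.mkℚ n d-1 _) = ℚ.*≤* (≡.subst (ℚ.floor b ℤ.* + suc d-1 ℤ.≤_)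
      (≡.sym (ℤ.*-identityʳ n)) (ℤ.[n/d]*d≤n n (+ suc d-1)))

    floor-< : ∀ b → b ℚ.< fromℤ (ℤ.suc (ℚ.floor b))
    floor-< b@(ℚ.mkℚ n d-1 _) = ℚ.*<* (≡.subst₂ ℤ._<_ (≡.sym (ℤ.*-identityʳ n))
      (≡.cong (λ q → ℤ.suc q ℤ.* + suc d-1) (≡.sym (ℤ.div-pos-is-/ℕ n (suc d-1))))
      (ℤ.n<s[n/ℕd]*d n (suc d-1)))

    fromℤ-cancel : ∀ {b} i j → fromℤ i ℚ.≤ b → b ℚ.< fromℤ (ℤ.suc j) → i ℤ.≤ j
    fromℤ-cancel i j p q = ≡.subst (i ℤ.≤_) (ℤ.pred-suc j)
      (ℤ.i<j⇒i≤pred[j] (≡.subst₂ ℤ._<_ (ℤ.*-identityʳ i) (ℤ.*-identityʳ (ℤ.suc j))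
        (ℚ.drop-*<* (ℚ.≤-<-trans p q))))

    floor-suc : ∀ b → ℚ.floor (b ℚ.+ 1ℚ) ≡ ℤ.suc (ℚ.floor b)
    floor-suc b = ℤ.≤-antisym
      (fromℤ-cancel (ℚ.floor (b ℚ.+ 1ℚ)) (ℤ.suc (ℚ.floor b)) (floor-≤ (b ℚ.+ 1ℚ))
        (≡.subst (b ℚ.+ 1ℚ ℚ.<_) (≡.sym (fromℤ-suc (ℤ.suc (ℚ.floor b))))
          (ℚ.+-monoˡ-< 1ℚ (floor-< b))))
      (fromℤ-cancel (ℤ.suc (ℚ.floor b)) (ℚ.floor (b ℚ.+ 1ℚ))
        (≡.subst (ℚ._≤ b ℚ.+ 1ℚ) (≡.sym (fromℤ-suc (ℚ.floor b)))
          (ℚ.+-monoˡ-≤ 1ℚ (floor-≤ b)))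
        (floor-< (b ℚ.+ 1ℚ)))

    floor₀ : Poly → ℤ
    floor₀ z = ℚ.floor (coeff z 0)

    floor₀-cong : ∀ {z w} → z ≈ w → floor₀ z ≡ floor₀ w
    floor₀-cong e = ≡.cong ℚ.floor (Polynomial.coeff-≡ e 0)

    floor₀-suc : ∀ z → floor₀ (z + 1#) ≡ ℤ.suc (floor₀ z)
    floor₀-suc z = ≡.trans (≡.cong ℚ.floor (Polynomial.coeff-+ z 1# 0))
                           (floor-suc (coeff z 0))

    ιℤ : ℤ → Poly
    ιℤ (+ n)    = ι n
    ιℤ -[1+ n ] = - ι (suc n)

    ιℤ-suc : ∀ i → ιℤ (ℤ.suc i) ≈ 1# + ιℤ i
    ιℤ-suc (+ n)          = refl
    ιℤ-suc -[1+ zero ]    = Polynomial.mk≈ λ { zero → ≡.refl ; (suc k) → ≡.refl }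
    ιℤ-suc -[1+ suc n ]   = begin
      - ι (suc n)                ≈⟨ +-identityˡ (- ι (suc n)) ⟨
      0# + - ι (suc n)           ≈⟨ +-congʳ (- ι (suc n)) (-‿inverseʳ 1#) ⟨
      (1# - 1#) - ι (suc n)      ≈⟨ +-assoc 1# (- 1#) (- ι (suc n)) ⟩
      1# + (- 1# - ι (suc n))    ≈⟨ +-congˡ 1# (+-comm (- 1#) (- ι (suc n))) ⟩
      1# + (- ι (suc n) - 1#)    ≈⟨ +-congˡ 1# (⁻¹-anti-homo-∙ 1# (ι (suc n))) ⟨
      1# - ι (suc (suc n))       ∎
      where open SetoidReasoning setoid

    nz : Poly → Poly
    nz z with z Polynomial.≟ 0#
    ... | yes _ = 1#
    ... | no  _ = z

    nz≉0 : ∀ z → ¬ nz z ≈ 0#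
    nz≉0 z with z Polynomial.≟ 0#
    ... | yes _  = 1≉0
    ... | no z≉0 = z≉0

    nz-≉0 : ∀ z → ¬ z ≈ 0# → nz z ≈ z
    nz-≉0 z z≉0 with z Polynomial.≟ 0#
    ... | yes z≈0 = contradiction z≈0 z≉0
    ... | no  _   = refl

    nz-cong : ∀ {z w} → z ≈ w → nz z ≈ nz w
    nz-cong {z} {w} e with z Polynomial.≟ 0# | w Polynomial.≟ 0#
    ... | yes _   | yes _   = refl
    ... | no  _   | no  _   = e
    ... | yes z≈0 | no  w≉0 = contradiction (trans (sym e) z≈0) w≉0
    ... | no  z≉0 | yes w≈0 = contradiction (trans e w≈0) z≉0

    up down : Poly → ℕ → Poly
    up r zero      = 1#
    up r (suc k)   = nz (r + ι k) * up r k
    down r zero    = 1#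
    down r (suc k) = nz (r - ι (suc k)) * down r k

    up≉0 : ∀ r k → ¬ up r k ≈ 0#
    up≉0 r zero    = 1≉0
    up≉0 r (suc k) = *-≉0 (nz≉0 (r + ι k)) (up≉0 r k)

    down≉0 : ∀ r k → ¬ down r k ≈ 0#
    down≉0 r zero    = 1≉0
    down≉0 r (suc k) = *-≉0 (nz≉0 (r - ι (suc k))) (down≉0 r k)

    up-cong : ∀ {r s} k → r ≈ s → up r k ≈ up s k
    up-cong zero    e = refl
    up-cong (suc k) e = *-cong (nz-cong (+-congʳ (ι k) e)) (up-cong k e)

    down-cong : ∀ {r s} k → r ≈ s → down r k ≈ down s k
    down-cong zero    e = refl
    down-cong (suc k) e = *-cong (nz-cong (+-congʳ (- ι (suc k)) e)) (down-cong k e)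

    G : Poly → ℤ → Fraction
    G r (+ k)    = embed (up r k)
    G r -[1+ k ] = mk 1# (down r (suc k)) (down≉0 r (suc k))

    G-cong : ∀ {r s} i → r ≈ s → G r i ≈ᶠ G s i
    G-cong (+ k)    e = mk≈ (*-congʳ 1# (up-cong k e))
    G-cong -[1+ k ] e = mk≈ (*-congˡ 1# (sym (down-cong (suc k) e)))

    G≉0 : ∀ r i → ¬ G r i ≈ᶠ 0ᶠ
    G≉0 r (+ k)    (mk≈ e) = up≉0 r k (trans (sym (*-identityʳ (up r k))) e)
    G≉0 r -[1+ k ] (mk≈ e) = 1≉0 e

    G-suc : ∀ r i → G r (ℤ.suc i) ≈ᶠ embed (nz (r + ιℤ i)) *ᶠ G r i
    G-suc r (+ k)        = mk≈ (*-congˡ (up r (suc k)) (*-identityʳ 1#))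
    G-suc r -[1+ zero ]  = mk≈ (step₀ (nz (r - ι 1)))
      where
        step₀ : ∀ a → 1# * (1# * (a * 1#)) ≈ (a * 1#) * 1#
        step₀ = solve 1 (λ a → con 1 :* (con 1 :* (a :* con 1)) := (a :* con 1) :* con 1) refl
    G-suc r -[1+ suc k ] = mk≈ (step (nz (r - ι (suc (suc k)))) (down r (suc k)))
      where
        step : ∀ a b → 1# * (1# * (a * b)) ≈ (a * 1#) * b
        step = solve 2 (λ a b → con 1 :* (con 1 :* (a :* b)) := (a :* con 1) :* b) refl

    frac : Poly → Poly
    frac z = z - ιℤ (floor₀ z)

    frac-cong : ∀ {z w} → z ≈ w → frac z ≈ frac w
    frac-cong {z} {w} e rewrite floor₀-cong e = +-congʳ (- ιℤ (floor₀ w)) e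

    frac-suc : ∀ z → frac (z + 1#) ≈ frac z
    frac-suc z = begin
      (z + 1#) - ιℤ (floor₀ (z + 1#))        ≡⟨ ≡.cong (λ i → (z + 1#) - ιℤ i) (floor₀-suc z) ⟩
      (z + 1#) - ιℤ (ℤ.suc m)                ≈⟨ +-congˡ (z + 1#) (-‿cong (ιℤ-suc m)) ⟩
      (z + 1#) - (1# + ιℤ m)                 ≈⟨ +-congˡ (z + 1#) (⁻¹-anti-homo-∙ 1# (ιℤ m)) ⟩
      (z + 1#) + (- ιℤ m - 1#)               ≈⟨ +-congˡ (z + 1#) (+-comm (- ιℤ m) (- 1#)) ⟩
      (z + 1#) + (- 1# - ιℤ m)               ≈⟨ +-assoc (z + 1#) (- 1#) (- ιℤ m) ⟨
      ((z + 1#) - 1#) - ιℤ m                 ≈⟨ +-congʳ (- ιℤ m) (+-assoc z 1# (- 1#)) ⟩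
      (z + (1# - 1#)) - ιℤ m                 ≈⟨ +-congʳ (- ιℤ m) (+-congˡ z (-‿inverseʳ 1#)) ⟩
      (z + 0#) - ιℤ m                        ≈⟨ +-congʳ (- ιℤ m) (+-identityʳ z) ⟩
      z - ιℤ m                               ∎
      where
        open SetoidReasoning setoid
        m = floor₀ z

    frac+floor₀ : ∀ z → frac z + ιℤ (floor₀ z) ≈ z
    frac+floor₀ z = begin
      (z - m) + m      ≈⟨ +-assoc z (- m) m ⟩
      z + (- m + m)    ≈⟨ +-congˡ z (-‿inverseˡ m) ⟩
      z + 0#           ≈⟨ +-identityʳ z ⟩
      z                ∎
      where
        open SetoidReasoning setoid
        m = ιℤ (floor₀ z)

    embed-cong : ∀ {z w} → z ≈ w → embed z ≈ᶠ embed w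
    embed-cong e = mk≈ (*-congʳ 1# e)

    Γ₀ : Poly → Fraction
    Γ₀ z = G (frac z) (floor₀ z)

    Γ₀-cong : ∀ {z w} → z ≈ w → Γ₀ z ≈ᶠ Γ₀ w
    Γ₀-cong {z} {w} e = transᶠ (G-cong (floor₀ z) (frac-cong e))
      (≡.subst (λ i → G (frac w) (floor₀ z) ≈ᶠ G (frac w) i) (floor₀-cong e) reflᶠ)

    Γ₀-functional : ∀ z → ¬ z ≈ 0# → Γ₀ (z + 1#) ≈ᶠ embed z *ᶠ Γ₀ z
    Γ₀-functional z z≉0 = begin
      G (frac (z + 1#)) (floor₀ (z + 1#))
        ≡⟨ ≡.cong (G (frac (z + 1#))) (floor₀-suc z) ⟩
      G (frac (z + 1#)) (ℤ.suc (floor₀ z))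
        ≈⟨ G-cong (ℤ.suc (floor₀ z)) (frac-suc z) ⟩
      G (frac z) (ℤ.suc (floor₀ z))
        ≈⟨ G-suc (frac z) (floor₀ z) ⟩
      embed (nz (frac z + ιℤ (floor₀ z))) *ᶠ Γ₀ z
        ≈⟨ *ᶠ-cong {embed (nz (frac z + ιℤ (floor₀ z)))} {embed z} {Γ₀ z} {Γ₀ z}
             (embed-cong (trans (nz-cong (frac+floor₀ z)) (nz-≉0 z z≉0))) reflᶠ ⟩
      embed z *ᶠ Γ₀ z ∎
      where open SetoidReasoning (CommutativeRing.setoid ℚ⟮x⟯)

  gammaFunction : GammaFunction
  gammaFunction = record
    { Γ            = Γ₀
    ; Γ-cong       = Γ₀-cong
    ; Γ-nonzero    = λ z → G≉0 (frac z) (floor₀ z)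
    ; Γ-functional = Γ₀-functional
    }

1/! : ℕ → ℚ
1/! p = ℚ._/_ (+ 1) (p !) {{p !≢0}}

binomial : Poly → ℕ → Poly
binomial α p = const (1/! p) * ∏[ k < p ] (α - ι k)

entry : ℕ → ℕ → Poly
entry i j =
    ι 2 ^ i * binomial (X + ι i + ι (2 ℕ.* j) + 1#) (2 ℕ.* j ℕ.+ 1)
  + binomial (X - ι i + ι (2 ℕ.* j) + 1#) (2 ℕ.* j ℕ.+ 1)

D₂ : ℕ → Poly
D₂ n = det {n} λ i j → entry (toℕ i) (toℕ j)

-- The syntax ∏[ i < n ] e binds more tightly than _*_.  For n ≥ 1 none of the
-- subtractions on ℕ truncates.
productFormula : ℕ → Poly
productFormula n =
    ι 2 ^ (n C 2 ℕ.+ 1)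
  * ∏[ i < n ] (ι (i !) * const (1/! (2 ℕ.* i ℕ.+ 1)))
  * ∏[ i < suc ⌊ n /2⌋ ] pochhammer (X + ι (4 ℕ.* i) + 1#) (n ∸ 2 ℕ.* i)
  * ∏[ i < suc ⌊ n ∸ 1 /2⌋ ] pochhammer (X - ι (2 ℕ.* i) + ι (3 ℕ.* n)) (n ∸ 2 ℕ.* i ∸ 1)

gammaFactor : GammaFunction → ℕ → Fraction
gammaFactor gammaFn i =
    (ιᶠ 2 ^ᶠ (2 ℕ.* i ∸ 2) *ᶠ Γ (ι i) *ᶠ Γ (ι (2 ℕ.* i) + X)
      *ᶠ Γ (ι (4 ℕ.* i) + X - 1#) *ᶠ Γ (const ½ * (ι (3 ℕ.* i) + X - ι 2)))
  /ᶠ (Γ (ι (2 ℕ.* i)) *ᶠ Γ (ι (3 ℕ.* i) + X)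
      *ᶠ Γ (ι (3 ℕ.* i) + X - ι 2) *ᶠ Γ (const ½ * (ι i + X)))
  where open GammaFunction gammaFn

gammaFormula : GammaFunction → ℕ → Fraction
gammaFormula gammaFn n = ιᶠ 2 *ᶠ ∏ᶠ[ k < n ] gammaFactor gammaFn (suc k)

{-# OPTIONS --safe #-}
module Submission where

-- Put u = 1 - z, σ = z (1 + z) / (1 - z) and b = x + 1.  Row i of D₂ consists of
-- the odd coefficients of u^(-b) ((2 / u)^i + u^i), and (2 / u)^i + u^i is a
-- polynomial of degree i in 2 / u + u = 3 + σ; hence
-- D₂ n = 2 det [z^(2j+1)] u^(-b) σ^i.  As u (1 + σ) = 1 + z², the series
-- u^(-b) (1 + σ)^(-b-4l) σ^(2l) = (1 + z²)^(-b-4l) (z - z³)^(2l) is even and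
-- starts with z^(2l).  Modulo z^(2n), the transition from the powers of z to the
-- basis u^(-b) σ^k is unitriangular.  Writing the 2n series consisting of these
-- even ones (l < n) and of the u^(-b) σ^i (i < n) in either basis therefore turns
-- the determinant of odd coefficients, up to sign, into the determinant of the
-- coefficients of σ^(n+t) in (1 + σ)^(-b-4l) σ^(2l).  These are binomial
-- coefficients, and a determinant of Krattenthaler factors completely.

open import Algebra.Bundles using (CommutativeRing; CommutativeMonoid)
open import Data.Empty using (⊥-elim)
open import Data.Fin.Base using (Fin; zero; suc; toℕ; punchIn)
import Data.Fin.Properties as Fin
open import Data.Integer.Base as ℤ using (ℤ; +_; -[1+_]; +0; +[1+_]; _⊖_)
import Data.Integer.Properties as ℤ
open import Data.Maybe.Base using (Maybe; just; nothing)
open import Data.Nat.Base as ℕ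
  using (ℕ; zero; suc; _<_; _≤_; z≤n; s≤s; z<s; s<s; _∸_; _!; ⌊_/2⌋; NonZero)
import Data.Nat.Properties as ℕ
open import Data.Product.Base using (_×_; _,_; proj₁; proj₂; ∃)
open import Data.Rational.Base as ℚ using (ℚ; 0ℚ; 1ℚ)
import Data.Rational.Properties as ℚ
import Data.Rational.Unnormalised.Base as ℚᵘ
import Data.Rational.Unnormalised.Properties as ℚᵘ
open import Data.Sum.Base using (_⊎_; inj₁; inj₂)
open import Data.Unit.Polymorphic.Base using (⊤; tt)
open import Data.Vec.Functional using (_∷_)
open import Function.Base using (_∘_)
open import Level using (_⊔_)
open import Relation.Binary.PropositionalEquality as ≡ using (_≡_; _≢_)
open import Relation.Nullary using (¬_; yes; no; contradiction)
import Relation.Binary.Reasoning.Setoid as SetoidReasoning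
open import Defs using (module RingNotions; DiscreteDomain; module FractionField)

-- The exponent -b - 4l is forced by evenness: since σ = (z - z³) / u², the series u^(-b) (1 +
-- σ)^(-γ) σ^(2l) is u^(γ - b - 4l) (1 + z²)^(-γ) (z - z³)^(2l), and the power of u disappears for γ
-- = b + 4l. As b is not an integer, a power such as u^(-β) is given by its list of coefficients
-- `H β`, and (1 + σ)^(-γ) by finite sums. That these are even up to their order is seen from the
-- derivative of (1 + z²)^(-γ), not by substitution.
--
-- The binomial coefficient in row l changes its shape where 2l passes n. The factors `α l` and
-- `β l`, at least one of which is 1, absorb this, so that Krattenthaler's determinant fits all rows
-- at once. The `α l` end up on the side of the determinant and are cancelled as non-zero-divisors.
--
-- The Gamma formula is not deduced from the product formula. Both start from the evaluation that
-- still carries the `α l`. In terms of Γ the quotient `β l` / `α l` is Γ(b + n + 2l) / Γ(b + 4l),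
-- however large l is, and the resulting products telescope from n to n + 1.

-- Ring identities with integer coefficients

module IntegerSolver {c ℓ} (R : CommutativeRing c ℓ) where
  open CommutativeRing R hiding (zero)
  open import Algebra.Properties.Ring ring
    using (-‿distribˡ-*; -‿distribʳ-*; -‿involutive; -0#≈0#; -‿+-comm)
  open import Algebra.Properties.Semiring.Mult semiring
    using (×-homo-+; ×1-homo-*)
    renaming (_×_ to _·_)
  open import Algebra.Solver.Ring.AlmostCommutativeRing
  open SetoidReasoning setoid

  private
    ⟦_⟧ℤ : ℤ → Carrier
    ⟦ + n ⟧ℤ      = n · 1#
    ⟦ -[1+ n ] ⟧ℤ = - (suc n · 1#)

    +-cancel-middle : ∀ a b c → (a + b) - (a + c) ≈ b - c
    +-cancel-middle a b c = begin
      (a + b) - (a + c)        ≈⟨ +-cong (+-comm a b) (sym (-‿+-comm a c)) ⟩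
      (b + a) + (- a - c)      ≈⟨ +-assoc b a (- a - c) ⟩
      b + (a + (- a - c))      ≈⟨ +-congˡ (+-assoc a (- a) (- c)) ⟨
      b + ((a - a) - c)        ≈⟨ +-congˡ (+-congʳ (-‿inverseʳ a)) ⟩
      b + (0# - c)             ≈⟨ +-congˡ (+-identityˡ (- c)) ⟩
      b - c                    ∎

    ⊖-homo : ∀ m n → ⟦ m ⊖ n ⟧ℤ ≈ m · 1# - n · 1#
    ⊖-homo zero    zero    = sym (-‿inverseʳ 0#)
    ⊖-homo zero    (suc n) = sym (+-identityˡ _)
    ⊖-homo (suc m) zero    = sym (trans (+-congˡ -0#≈0#) (+-identityʳ _))
    ⊖-homo (suc m) (suc n) = begin
      ⟦ suc m ⊖ suc n ⟧ℤ             ≡⟨ ≡.cong ⟦_⟧ℤ (ℤ.[1+m]⊖[1+n]≡m⊖n m n) ⟩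
      ⟦ m ⊖ n ⟧ℤ                     ≈⟨ ⊖-homo m n ⟩
      m · 1# - n · 1#                ≈⟨ +-cancel-middle 1# (m · 1#) (n · 1#) ⟨
      suc m · 1# - suc n · 1#        ∎

    +-homo : ∀ i j → ⟦ i ℤ.+ j ⟧ℤ ≈ ⟦ i ⟧ℤ + ⟦ j ⟧ℤ
    +-homo (+ m)    (+ n)    = ×-homo-+ 1# m n
    +-homo (+ m)    -[1+ n ] = ⊖-homo m (suc n)
    +-homo -[1+ m ] (+ n)    = trans (⊖-homo n (suc m)) (+-comm _ _)
    +-homo -[1+ m ] -[1+ n ] = begin
      - (suc (suc (m ℕ.+ n)) · 1#)        ≡⟨ ≡.cong (λ k → - (suc k · 1#)) (ℕ.+-suc m n) ⟨
      - ((suc m ℕ.+ suc n) · 1#)          ≈⟨ -‿cong (×-homo-+ 1# (suc m) (suc n)) ⟩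
      - (suc m · 1# + suc n · 1#)         ≈⟨ -‿+-comm (suc m · 1#) (suc n · 1#) ⟨
      - (suc m · 1#) - suc n · 1#         ∎

    -‿homo : ∀ i → ⟦ ℤ.- i ⟧ℤ ≈ - ⟦ i ⟧ℤ
    -‿homo +0       = sym -0#≈0#
    -‿homo +[1+ n ] = refl
    -‿homo -[1+ n ] = sym (-‿involutive _)

    +*+-homo : ∀ m n → ⟦ + m ℤ.* + n ⟧ℤ ≈ (m · 1#) * (n · 1#)
    +*+-homo m n = begin
      ⟦ + m ℤ.* + n ⟧ℤ       ≡⟨ ≡.cong ⟦_⟧ℤ (ℤ.pos-* m n) ⟨
      (m ℕ.* n) · 1#         ≈⟨ ×1-homo-* m n ⟩
      (m · 1#) * (n · 1#)    ∎

    *-homo : ∀ i j → ⟦ i ℤ.* j ⟧ℤ ≈ ⟦ i ⟧ℤ * ⟦ j ⟧ℤ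
    *-homo (+ m)    (+ n)    = +*+-homo m n
    *-homo (+ m)    -[1+ n ] = begin
      ⟦ + m ℤ.* -[1+ n ] ⟧ℤ            ≡⟨ ≡.cong ⟦_⟧ℤ (ℤ.neg-distribʳ-* (+ m) +[1+ n ]) ⟨
      ⟦ ℤ.- (+ m ℤ.* +[1+ n ]) ⟧ℤ      ≈⟨ -‿homo (+ m ℤ.* +[1+ n ]) ⟩
      - ⟦ + m ℤ.* +[1+ n ] ⟧ℤ          ≈⟨ -‿cong (+*+-homo m (suc n)) ⟩
      - ((m · 1#) * (suc n · 1#))      ≈⟨ -‿distribʳ-* _ _ ⟩
      (m · 1#) * - (suc n · 1#)        ∎
    *-homo -[1+ m ] j = begin
      ⟦ -[1+ m ] ℤ.* j ⟧ℤ              ≡⟨ ≡.cong ⟦_⟧ℤ (ℤ.neg-distribˡ-* +[1+ m ] j) ⟨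
      ⟦ ℤ.- (+[1+ m ] ℤ.* j) ⟧ℤ        ≈⟨ -‿homo (+[1+ m ] ℤ.* j) ⟩
      - ⟦ +[1+ m ] ℤ.* j ⟧ℤ            ≈⟨ -‿cong (pos j) ⟩
      - ((suc m · 1#) * ⟦ j ⟧ℤ)        ≈⟨ -‿distribˡ-* _ _ ⟩
      - (suc m · 1#) * ⟦ j ⟧ℤ          ∎
      where
      pos : ∀ j → ⟦ +[1+ m ] ℤ.* j ⟧ℤ ≈ (suc m · 1#) * ⟦ j ⟧ℤ
      pos (+ n)    = +*+-homo (suc m) n
      pos -[1+ n ] = begin
        ⟦ +[1+ m ] ℤ.* -[1+ n ] ⟧ℤ           ≡⟨ ≡.cong ⟦_⟧ℤ (ℤ.neg-distribʳ-* +[1+ m ] +[1+ n ]) ⟨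
        ⟦ ℤ.- (+[1+ m ] ℤ.* +[1+ n ]) ⟧ℤ     ≈⟨ -‿homo (+[1+ m ] ℤ.* +[1+ n ]) ⟩
        - ⟦ +[1+ m ] ℤ.* +[1+ n ] ⟧ℤ         ≈⟨ -‿cong (+*+-homo (suc m) (suc n)) ⟩
        - ((suc m · 1#) * (suc n · 1#))      ≈⟨ -‿distribʳ-* _ _ ⟩
        (suc m · 1#) * - (suc n · 1#)        ∎

    -- 1 and -1 are sent to 1# and - 1# on the nose, so that con (+ 1) matches 1#.
    value : ℤ → Carrier
    value (+ 1)    = 1#
    value (+ n)    = ⟦ + n ⟧ℤ
    value -[1+ 0 ] = - 1#
    value -[1+ n ] = ⟦ -[1+ n ] ⟧ℤ

    value≈ : ∀ i → value i ≈ ⟦ i ⟧ℤ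
    value≈ (+ 0)           = refl
    value≈ (+ 1)           = sym (+-identityʳ 1#)
    value≈ (+ suc (suc n)) = refl
    value≈ -[1+ 0 ]        = -‿cong (sym (+-identityʳ 1#))
    value≈ -[1+ suc n ]    = refl

    morphism : ℤ.+-*-rawRing -Raw-AlmostCommutative⟶ fromCommutativeRing R
    morphism = record
      { ⟦_⟧    = value
      ; +-homo = λ i j → trans (value≈ (i ℤ.+ j))
                   (trans (+-homo i j) (sym (+-cong (value≈ i) (value≈ j))))
      ; *-homo = λ i j → trans (value≈ (i ℤ.* j))
                   (trans (*-homo i j) (sym (*-cong (value≈ i) (value≈ j))))
      ; -‿homo = λ i → trans (value≈ (ℤ.- i))
                   (trans (-‿homo i) (-‿cong (sym (value≈ i))))
      ; 0-homo = refl
      ; 1-homo = refl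
      }

    ≟-weak : ∀ i j → Maybe (value i ≈ value j)
    ≟-weak i j with i ℤ.≟ j
    ... | yes ≡.refl = just refl
    ... | no  _      = nothing

  open import Algebra.Solver.Ring ℤ.+-*-rawRing (fromCommutativeRing R) morphism ≟-weak public
    using (solve; con; _:=_; _:+_; _:*_; _:-_; :-_)

-- The index map of punchIn, on ℕ.
skip : ℕ → ℕ → ℕ
skip zero    k       = suc k
skip (suc j) zero    = zero
skip (suc j) (suc k) = suc (skip j k)

toℕ-punchIn : ∀ {n} (j : Fin (suc n)) k → toℕ (punchIn j k) ≡ skip (toℕ j) (toℕ k)
toℕ-punchIn zero    k       = ≡.refl
toℕ-punchIn (suc j) zero    = ≡.refl
toℕ-punchIn (suc j) (suc k) = ≡.cong suc (toℕ-punchIn j k)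

skip-< : ∀ {j k} → k < j → skip j k ≡ k
skip-< {suc j} {zero}  _         = ≡.refl
skip-< {suc j} {suc k} (s<s k<j) = ≡.cong suc (skip-< k<j)

skip-+ : ∀ m j k → skip (m ℕ.+ j) (m ℕ.+ k) ≡ m ℕ.+ skip j k
skip-+ zero    j k = ≡.refl
skip-+ (suc m) j k = ≡.cong suc (skip-+ m j k)

skip-≢ : ∀ j k → skip j k ≢ j
skip-≢ (suc j) (suc k) e = skip-≢ j k (ℕ.suc-injective e)

skip-bound : ∀ {n} j {k} → k < n → skip j k < suc n
skip-bound zero    k<n               = s<s k<n
skip-bound (suc j) {zero}  k<n       = z<s
skip-bound (suc j) {suc k} (s<s k<n) = s<s (skip-bound j k<n)

-- Finite sums and products over initial segments of ℕ

module Fold {c ℓ} (M : CommutativeMonoid c ℓ) where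
  open CommutativeMonoid M
  open import Algebra.Properties.CommutativeMonoid.Sum M using (sum; sum-cong-≋; ∑-distrib-+)
  open import Algebra.Properties.CommutativeSemigroup commutativeSemigroup using (x∙yz≈y∙xz)
  open SetoidReasoning setoid

  fold< : ℕ → (ℕ → Carrier) → Carrier
  fold< n f = sum {n} (f ∘ toℕ)

  fold<-cong : ∀ n {f g} → (∀ i → i < n → f i ≈ g i) → fold< n f ≈ fold< n g
  fold<-cong n e = sum-cong-≋ {n} (λ i → e (toℕ i) (Fin.toℕ<n i))

  fold<-cong′ : ∀ n {f g} → (∀ i → f i ≈ g i) → fold< n f ≈ fold< n g
  fold<-cong′ n e = fold<-cong n (λ i _ → e i)

  fold<-∙ : ∀ n f g → fold< n (λ i → f i ∙ g i) ≈ fold< n f ∙ fold< n g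
  fold<-∙ n f g = ∑-distrib-+ {n} (f ∘ toℕ) (g ∘ toℕ)

  fold<-ε : ∀ n {f} → (∀ i → i < n → f i ≈ ε) → fold< n f ≈ ε
  fold<-ε zero    e = refl
  fold<-ε (suc n) e =
    trans (∙-cong (e 0 z<s) (fold<-ε n λ i i<n → e (suc i) (s<s i<n))) (identityˡ ε)

  fold<-snoc : ∀ n f → fold< (suc n) f ≈ fold< n f ∙ f n
  fold<-snoc zero    f = comm (f 0) ε
  fold<-snoc (suc n) f = trans (∙-congˡ (fold<-snoc n (f ∘ suc))) (sym (assoc _ _ _))

  fold<-+ : ∀ m n f → fold< (m ℕ.+ n) f ≈ fold< m f ∙ fold< n (λ i → f (m ℕ.+ i))
  fold<-+ zero    n f = sym (identityˡ _)
  fold<-+ (suc m) n f = trans (∙-congˡ (fold<-+ m n (f ∘ suc))) (sym (assoc _ _ _))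

  fold<-skip : ∀ n f j → j < suc n → fold< (suc n) f ≈ f j ∙ fold< n (f ∘ skip j)
  fold<-skip n       f zero    j<n       = refl
  fold<-skip (suc n) f (suc j) (s<s j<n) = begin
    f 0 ∙ fold< (suc n) (f ∘ suc)                     ≈⟨ ∙-congˡ (fold<-skip n (f ∘ suc) j j<n) ⟩
    f 0 ∙ (f (suc j) ∙ fold< n (f ∘ suc ∘ skip j))    ≈⟨ x∙yz≈y∙xz _ _ _ ⟩
    f (suc j) ∙ (f 0 ∙ fold< n (f ∘ suc ∘ skip j))    ∎

  fold<-reverse : ∀ n f → fold< n (λ i → f (n ∸ suc i)) ≈ fold< n f
  fold<-reverse zero    f = refl
  fold<-reverse (suc n) f = begin
    f n ∙ fold< n (λ i → f (n ∸ suc i))    ≈⟨ ∙-congˡ (fold<-reverse n f) ⟩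
    f n ∙ fold< n f                        ≈⟨ comm _ _ ⟩
    fold< n f ∙ f n                        ≈⟨ fold<-snoc n f ⟨
    fold< (suc n) f                        ∎

-- Alternating forms and the product of determinants

module Determinant {c ℓ} (R : CommutativeRing c ℓ) where
  open CommutativeRing R hiding (zero)
  open RingNotions R using (det; _^_; sum)
  open import Algebra.Properties.Ring ring using (x+x≈x⇒x≈0)
  open import Algebra.Properties.Semiring.Sum semiring
    using (sum-cong-≋; *-distribˡ-sum; *-distribʳ-sum; ∑-distrib-+; sum-remove; sum-replicate-zero)
  open IntegerSolver R
  open SetoidReasoning setoid

  -- Rows and columns are counted separately because fixing the first row of a form leaves one row
  -- fewer, but rows of the same length.
  Rows : ℕ → ℕ → Set c
  Rows n m = Fin n → Fin m → Carrier

  Form : ℕ → ℕ → Set c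
  Form n m = Rows n m → Carrier

  sgn : ∀ {n} → Fin n → Carrier
  sgn j = (- 1#) ^ toℕ j

  Congruent : ∀ {n m} → Form n m → Set (c ⊔ ℓ)
  Congruent Φ = ∀ {A B} → (∀ i k → A i k ≈ B i k) → Φ A ≈ Φ B

  VanishesOnRepeat : ∀ n {m} → Form (suc n) m → Set (c ⊔ ℓ)
  VanishesOnRepeat zero    Φ = ⊤
  VanishesOnRepeat (suc n) Φ = ∀ u w → Φ (u ∷ u ∷ w) ≈ 0#

  -- Alternating multilinear in the sense of one row at a time: linear in the
  -- first row, zero if the first two rows agree, and alternating in the
  -- remaining rows once the first one is fixed.
  Alternating : ∀ n {m} → Form n m → Set (c ⊔ ℓ)
  Alternating zero    Φ = ⊤
  Alternating (suc n) Φ =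
    (∀ a u v w → Φ ((λ k → a * u k + v k) ∷ w) ≈ a * Φ (u ∷ w) + Φ (v ∷ w))
    × VanishesOnRepeat n Φ
    × (∀ v → Alternating n (λ w → Φ (v ∷ w)))

  ∷-cong : ∀ {n m} {u v : Fin m → Carrier} {A B : Rows n m} →
    (∀ k → u k ≈ v k) → (∀ i k → A i k ≈ B i k) → ∀ i k → (u ∷ A) i k ≈ (v ∷ B) i k
  ∷-cong e f zero    = e
  ∷-cong e f (suc i) = f i

  alternating-resp : ∀ n {m} {Φ Ψ : Form n m} → (∀ w → Φ w ≈ Ψ w) →
    Alternating n Φ → Alternating n Ψ
  alternating-resp zero    e _           = tt
  alternating-resp (suc n) e (lin , rep , alt) =
      (λ a u v w → trans (sym (e _)) (trans (lin a u v w) (+-cong (*-congˡ (e _)) (e _))))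
    , repeat n e rep
    , λ v → alternating-resp n (λ w → e (v ∷ w)) (alt v)
    where
    repeat : ∀ n {m} {Φ Ψ : Form (suc n) m} → (∀ w → Φ w ≈ Ψ w) →
      VanishesOnRepeat n Φ → VanishesOnRepeat n Ψ
    repeat zero    e _   = tt
    repeat (suc n) e rep u w = trans (sym (e _)) (rep u w)

  alternating-sum : ∀ n {m p} (c : Fin p → Carrier) (Φ : Fin p → Form n m) →
    (∀ j → Alternating n (Φ j)) → Alternating n (λ w → sum λ j → c j * Φ j w)
  alternating-sum zero    c Φ alt = tt
  alternating-sum (suc n) c Φ alt = linear , repeat n c Φ alt , λ v →
    alternating-sum n c (λ j w → Φ j (v ∷ w)) (λ j → proj₂ (proj₂ (alt j)) v)
    where
    linear : ∀ a u v w → sum (λ j → c j * Φ j ((λ k → a * u k + v k) ∷ w))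
           ≈ a * sum (λ j → c j * Φ j (u ∷ w)) + sum (λ j → c j * Φ j (v ∷ w))
    linear a u v w = begin
      sum (λ j → c j * Φ j ((λ k → a * u k + v k) ∷ w))
        ≈⟨ sum-cong-≋ (λ j → trans (*-congˡ (proj₁ (alt j) a u v w))
             (solve 4 (λ c a x y → c :* (a :* x :+ y) := a :* (c :* x) :+ c :* y) refl _ _ _ _)) ⟩
      sum (λ j → a * (c j * Φ j (u ∷ w)) + c j * Φ j (v ∷ w))
        ≈⟨ ∑-distrib-+ (λ j → a * (c j * Φ j (u ∷ w))) (λ j → c j * Φ j (v ∷ w)) ⟩
      sum (λ j → a * (c j * Φ j (u ∷ w))) + sum (λ j → c j * Φ j (v ∷ w))
        ≈⟨ +-congʳ (*-distribˡ-sum a (λ j → c j * Φ j (u ∷ w))) ⟨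
      a * sum (λ j → c j * Φ j (u ∷ w)) + sum (λ j → c j * Φ j (v ∷ w))
        ∎
    repeat : ∀ n {m p} (c : Fin p → Carrier) (Φ : Fin p → Form (suc n) m) →
      (∀ j → Alternating (suc n) (Φ j)) → VanishesOnRepeat n (λ w → sum λ j → c j * Φ j w)
    repeat zero    c Φ alt = tt
    repeat (suc n) {p = p} c Φ alt u w = trans
      (sum-cong-≋ (λ j → trans (*-congˡ (proj₁ (proj₂ (alt j)) u w)) (zeroʳ (c j))))
      (sum-replicate-zero p)

  -- For `g = punchIn j` and `Φ = det` this says that a minor is an alternating form in the rows of
  -- full length.
  alternating-pull : ∀ n {m p} (g : Fin p → Fin m) (Φ : Form n p) → Congruent Φ →
    Alternating n Φ → Alternating n (λ w → Φ (λ i k → w i (g k)))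
  alternating-pull zero    g Φ Φ-cong alt = tt
  alternating-pull (suc n) g Φ Φ-cong (lin , rep , alt) =
      (λ a u v w → trans (Φ-cong ∷-pull) (trans (lin a (u ∘ g) (v ∘ g) (λ i → w i ∘ g))
        (+-cong (*-congˡ (Φ-cong ∷-pull′)) (Φ-cong ∷-pull′))))
    , repeat n g Φ Φ-cong rep
    , λ v → alternating-resp n (λ w → Φ-cong ∷-pull′)
        (alternating-pull n g (λ w → Φ ((v ∘ g) ∷ w)) (λ e → Φ-cong (∷-cong (λ _ → refl) e)) (alt (v ∘ g)))
    where
    ∷-pull : ∀ {n m p} {g : Fin p → Fin m} {v} {w : Rows n m} →
      ∀ i k → (v ∷ w) i (g k) ≈ ((v ∘ g) ∷ (λ i → w i ∘ g)) i k
    ∷-pull zero    k = refl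
    ∷-pull (suc i) k = refl
    ∷-pull′ : ∀ {n m p} {g : Fin p → Fin m} {v} {w : Rows n m} →
      ∀ i k → ((v ∘ g) ∷ (λ i → w i ∘ g)) i k ≈ (v ∷ w) i (g k)
    ∷-pull′ zero    k = refl
    ∷-pull′ (suc i) k = refl
    repeat : ∀ n {m p} (g : Fin p → Fin m) (Φ : Form (suc n) p) → Congruent Φ →
      VanishesOnRepeat n Φ → VanishesOnRepeat n (λ w → Φ (λ i k → w i (g k)))
    repeat zero    g Φ Φ-cong _   = tt
    repeat (suc n) g Φ Φ-cong rep u w =
      trans (Φ-cong λ { zero k → refl ; (suc zero) k → refl ; (suc (suc i)) k → refl })
            (rep (u ∘ g) (λ i → w i ∘ g))

  det-cong : ∀ {n} → Congruent (det {n})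
  det-cong {zero}  e = refl
  det-cong {suc n} e = sum-cong-≋ {suc n} λ j →
    *-cong (*-congˡ {sgn j} (e zero j)) (det-cong λ i k → e (suc i) (punchIn j k))

  -- Deleting the columns j and punchIn j k in either order leaves the same
  -- columns, but the two orders come with opposite signs.
  minor-pairs-cancel : ∀ n (u : Fin (suc (suc n)) → Carrier)
    (f : (Fin n → Fin (suc (suc n))) → Carrier) →
    (∀ {g h} → (∀ c → g c ≡ h c) → f g ≈ f h) →
    sum (λ j → sum λ k → sgn j * sgn k * (u j * u (punchIn j k))
                         * f (punchIn j ∘ punchIn k)) ≈ 0#
  minor-pairs-cancel n u f f-cong = begin
    sum (λ k → t zero k) + sum (λ j → t (suc j) zero + sum (λ k → t (suc j) (suc k)))
      ≈⟨ +-congˡ (∑-distrib-+ (λ j → t (suc j) zero) (λ j → sum (λ k → t (suc j) (suc k)))) ⟩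
    sum (λ k → t zero k) + (sum (λ j → t (suc j) zero) + sum (λ j → sum λ k → t (suc j) (suc k)))
      ≈⟨ +-assoc _ _ _ ⟨
    (sum (λ k → t zero k) + sum (λ j → t (suc j) zero)) + sum (λ j → sum λ k → t (suc j) (suc k))
      ≈⟨ +-cong (trans (sym (∑-distrib-+ (λ k → t zero k) (λ j → t (suc j) zero)))
                       (trans (sum-cong-≋ first) (sum-replicate-zero (suc n))))
                (rest n u f f-cong) ⟩
    0# + 0#
      ≈⟨ +-identityˡ 0# ⟩
    0#
      ∎
    where
    t : Fin (suc (suc n)) → Fin (suc n) → Carrier
    t j k = sgn j * sgn k * (u j * u (punchIn j k)) * f (punchIn j ∘ punchIn k)
    first : ∀ k → t zero k + t (suc k) zero ≈ 0#
    first k = trans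
      (+-congˡ (*-congˡ (f-cong {punchIn (suc k) ∘ punchIn zero} {suc ∘ punchIn k} λ c → ≡.refl)))
      (solve 4 (λ s a b d → con (+ 1) :* s :* (a :* b) :* d
                          :+ (:- con (+ 1) :* s) :* con (+ 1) :* (b :* a) :* d
                          := con (+ 0)) refl (sgn k) (u zero) (u (suc k)) (f (suc ∘ punchIn k)))
    lift : ∀ {n m} → (Fin n → Fin m) → Fin (suc n) → Fin (suc m)
    lift g zero    = zero
    lift g (suc c) = suc (g c)
    -- Neither deletion touches column 0, which therefore remains the first column of every minor.
    -- What is left is the same sum over the other columns, one size smaller.
    rest : ∀ n (u : Fin (suc (suc n)) → Carrier) (f : (Fin n → Fin (suc (suc n))) → Carrier) →
      (∀ {g h} → (∀ c → g c ≡ h c) → f g ≈ f h) →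
      sum (λ (j : Fin (suc n)) → sum λ (k : Fin n) → sgn (suc j) * sgn (suc k) *
          (u (suc j) * u (punchIn (suc j) (suc k)))
                         * f (punchIn (suc j) ∘ punchIn (suc k))) ≈ 0#
    rest zero    u f f-cong = +-identityˡ 0#
    rest (suc n) u f f-cong = trans
      (sum-cong-≋ {suc (suc n)} λ j → sum-cong-≋ {suc n} λ k → trans
        (*-congˡ (f-cong {g = punchIn (suc j) ∘ punchIn (suc k)} {h = lift (punchIn j ∘ punchIn k)}
          λ { zero → ≡.refl ; (suc c) → ≡.refl }))
        (solve 5 (λ s r a b d → (:- con (+ 1) :* s) :* (:- con (+ 1) :* r) :* (a :* b) :* d
                              := s :* r :* (a :* b) :* d) refl
          (sgn j) (sgn k) (u (suc j)) (u (suc (punchIn j k))) (f (lift (punchIn j ∘ punchIn k)))))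
      (minor-pairs-cancel n (u ∘ suc) (f ∘ lift)
        (λ {g} {h} e → f-cong {lift g} {lift h} λ { zero → ≡.refl ; (suc c) → ≡.cong suc (e c) }))

  -- With its first row fixed, the Laplace expansion is a linear combination of minors, which are
  -- alternating by induction. A repetition in the first two rows is the only place where signs have
  -- to cancel.
  det-alternating : ∀ n → Alternating n (det {n})
  det-alternating zero    = tt
  det-alternating (suc n) = linear , repeat n , λ v →
    alternating-sum n (λ j → sgn j * v j) (λ j w → det (λ i k → w i (punchIn j k)))
      (λ j → alternating-pull n (punchIn j) det det-cong (det-alternating n))
    where
    linear : ∀ a u v w → det ((λ k → a * u k + v k) ∷ w) ≈ a * det (u ∷ w) + det (v ∷ w)
    linear a u v w = begin
      sum (λ j → sgn j * (a * u j + v j) * d j)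
        ≈⟨ sum-cong-≋ (λ j → solve 5 (λ s a u v d → s :* (a :* u :+ v) :* d
                                := a :* (s :* u :* d) :+ s :* v :* d) refl (sgn j) a (u j) (v j) (d j)) ⟩
      sum (λ j → a * (sgn j * u j * d j) + sgn j * v j * d j)
        ≈⟨ ∑-distrib-+ (λ j → a * (sgn j * u j * d j)) (λ j → sgn j * v j * d j) ⟩
      sum (λ j → a * (sgn j * u j * d j)) + sum (λ j → sgn j * v j * d j)
        ≈⟨ +-congʳ (*-distribˡ-sum a (λ j → sgn j * u j * d j)) ⟨
      a * det (u ∷ w) + det (v ∷ w)
        ∎
      where
      d : Fin (suc n) → Carrier
      d j = det (λ i k → w i (punchIn j k))
    repeat : ∀ n → VanishesOnRepeat n (det {suc n})
    repeat zero    = tt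
    repeat (suc n) u w = begin
      sum (λ j → sgn j * u j * sum (λ k → sgn k * u (punchIn j k) * d j k))
        ≈⟨ sum-cong-≋ (λ j → trans (*-distribˡ-sum (sgn j * u j) (λ k → sgn k * u (punchIn j k) * d j k))
             (sum-cong-≋ {suc n} λ k →
             solve 5 (λ s r a b d → s :* a :* (r :* b :* d) := s :* r :* (a :* b) :* d)
               refl (sgn j) (sgn k) (u j) (u (punchIn j k)) (d j k))) ⟩
      sum (λ j → sum λ k → sgn j * sgn k * (u j * u (punchIn j k)) * d j k)
        ≈⟨ minor-pairs-cancel n u (λ g → det (λ i c → w i (g c)))
             (λ e → det-cong λ i c → reflexive (≡.cong (w i) (e c))) ⟩
      0# ∎
      where
      d : Fin (suc (suc n)) → Fin (suc n) → Carrier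
      d j k = det (λ i c → w i (punchIn j (punchIn k c)))

  module _ {m : ℕ} where

    -- Polarisation: `Φ` vanishes when u + v stands in both rows. The sum is written
    -- `1# * u k + v k` so that linearity applies in the form in which it is given.
    swap-first : ∀ {n} (Φ : Form (suc (suc n)) m) → Alternating (suc (suc n)) Φ →
      ∀ u v w → Φ (u ∷ v ∷ w) ≈ - Φ (v ∷ u ∷ w)
    swap-first Φ (lin , rep , alt) u v w = begin
      Φ (u ∷ v ∷ w)                                    ≈⟨ solve 4 (λ a b c d →
           b := (con (+ 1) :* (con (+ 1) :* a :+ b) :+ (con (+ 1) :* c :+ d)) :- (a :+ d) :- c) refl _ _ _ _ ⟩
      (1# * (1# * Φ (u ∷ u ∷ w) + Φ (u ∷ v ∷ w)) + (1# * Φ (v ∷ u ∷ w) + Φ (v ∷ v ∷ w)))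
        - (Φ (u ∷ u ∷ w) + Φ (v ∷ v ∷ w)) - Φ (v ∷ u ∷ w)
                                                       ≈⟨ +-congʳ (+-cong (sym (trans (lin 1# u v (s ∷ w))
           (+-cong (*-congˡ (proj₁ (alt u) 1# u v w)) (proj₁ (alt v) 1# u v w))))
           (-‿cong (+-cong (rep u w) (rep v w)))) ⟩
      Φ (s ∷ s ∷ w) - (0# + 0#) - Φ (v ∷ u ∷ w)        ≈⟨ +-congʳ (+-congʳ (rep s w)) ⟩
      0# - (0# + 0#) - Φ (v ∷ u ∷ w)                   ≈⟨ solve 1 (λ a →
           con (+ 0) :- (con (+ 0) :+ con (+ 0)) :- a := :- a) refl _ ⟩
      - Φ (v ∷ u ∷ w)                                  ∎
      where
      s : Fin m → Carrier
      s k = 1# * u k + v k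

    -- Linearity and the vanishing on repetition clear the second row. Exchanging it with `u` brings
    -- `u` in front of the remaining rows, where induction applies to the form with the cleared row
    -- fixed; the exchange is then undone.
    drop-multiples : ∀ {n} (Φ : Form (suc n) m) → Congruent Φ → Alternating (suc n) Φ →
      ∀ u (c : Fin n → Carrier) (w : Rows n m) → Φ (u ∷ (λ i k → c i * u k + w i k)) ≈ Φ (u ∷ w)
    drop-multiples {zero}  Φ Φ-cong _ u c w = Φ-cong λ { zero k → refl ; (suc ()) }
    drop-multiples {suc n} Φ Φ-cong alternating@(lin , rep , alt) u c w = begin
      Φ (u ∷ (λ i k → c i * u k + w i k))
        ≈⟨ Φ-cong (λ { zero k → refl ; (suc zero) k → refl ; (suc (suc i)) k → refl }) ⟩
      Φ (u ∷ (λ k → c zero * u k + w zero k) ∷ w′)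
        ≈⟨ proj₁ (alt u) (c zero) u (w zero) w′ ⟩
      c zero * Φ (u ∷ u ∷ w′) + Φ (u ∷ w zero ∷ w′)
        ≈⟨ +-congʳ (trans (*-congˡ (rep u w′)) (zeroʳ (c zero))) ⟩
      0# + Φ (u ∷ w zero ∷ w′)
        ≈⟨ trans (+-identityˡ _) (swap-first Φ alternating u (w zero) w′) ⟩
      - Φ (w zero ∷ u ∷ w′)
        ≈⟨ -‿cong (drop-multiples (λ x → Φ (w zero ∷ x)) (λ e → Φ-cong (∷-cong (λ _ → refl) e)) (alt (w zero)) u
             (c ∘ suc) (w ∘ suc)) ⟩
      - Φ (w zero ∷ u ∷ (w ∘ suc))
        ≈⟨ swap-first Φ alternating u (w zero) (w ∘ suc) ⟨
      Φ (u ∷ w zero ∷ (w ∘ suc))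
        ≈⟨ Φ-cong (λ { zero k → refl ; (suc zero) k → refl ; (suc (suc i)) k → refl }) ⟩
      Φ (u ∷ w)
        ∎
      where
      w′ : Rows n m
      w′ i k = c (suc i) * u k + w (suc i) k

    move-first : ∀ {n} (Φ : Form (suc n) m) → Congruent Φ → Alternating (suc n) Φ →
      ∀ k (B : Rows (suc n) m) → Φ (B k ∷ (B ∘ punchIn k)) ≈ sgn k * Φ B
    move-first         Φ Φ-cong _ zero    B =
      trans (Φ-cong λ { zero k → refl ; (suc i) k → refl }) (sym (*-identityˡ _))
    move-first {suc n} Φ Φ-cong alternating@(lin , rep , alt) (suc k) B = begin
      Φ (B (suc k) ∷ (B ∘ punchIn (suc k)))
        ≈⟨ Φ-cong (λ { zero k → refl ; (suc zero) k → refl ; (suc (suc i)) k → refl }) ⟩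
      Φ (B (suc k) ∷ B zero ∷ (B ∘ suc ∘ punchIn k))
        ≈⟨ swap-first Φ alternating (B (suc k)) (B zero) _ ⟩
      - Φ (B zero ∷ B (suc k) ∷ (B ∘ suc ∘ punchIn k))
        ≈⟨ -‿cong (move-first (λ x → Φ (B zero ∷ x)) (λ e → Φ-cong (∷-cong (λ _ → refl) e)) (alt (B zero)) k
             (B ∘ suc)) ⟩
      - (sgn k * Φ (B zero ∷ (B ∘ suc)))
        ≈⟨ -‿cong (*-congˡ {sgn k} (Φ-cong λ { zero k → refl ; (suc i) k → refl })) ⟩
      - (sgn k * Φ B)
        ≈⟨ solve 2 (λ s x → :- (s :* x) := :- con (+ 1) :* s :* x) refl (sgn k) (Φ B) ⟩
      - 1# * sgn k * Φ B
        ∎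

    linear-sum : ∀ {n} (Φ : Form (suc n) m) → Congruent Φ → Alternating (suc n) Φ →
      ∀ p (a : Fin p → Carrier) (B : Rows p m) w →
      Φ ((λ c → sum λ k → a k * B k c) ∷ w) ≈ sum λ k → a k * Φ (B k ∷ w)
    -- Linearity is given only for rows of the form a u + v. Its instance 1 · 0 + 0 yields Φ(0) +
    -- Φ(0) = Φ(0), hence Φ(0) = 0.
    linear-sum Φ Φ-cong (lin , _) zero    a B w = x+x≈x⇒x≈0 _ (begin
      Φ (o ∷ w) + Φ (o ∷ w)        ≈⟨ +-congʳ (*-identityˡ _) ⟨
      1# * Φ (o ∷ w) + Φ (o ∷ w)   ≈⟨ lin 1# o o w ⟨
      Φ ((λ _ → 1# * 0# + 0#) ∷ w) ≈⟨ Φ-cong (∷-cong (λ _ → trans (+-identityʳ _) (*-identityˡ 0#)) (λ _ _ → refl)) ⟩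
      Φ (o ∷ w)                    ∎)
      where
      o : Fin m → Carrier
      o _ = 0#
    linear-sum Φ Φ-cong alternating@(lin , _) (suc p) a B w = begin
      Φ ((λ c → a zero * B zero c + sum (λ k → a (suc k) * B (suc k) c)) ∷ w)
        ≈⟨ lin (a zero) (B zero) _ w ⟩
      a zero * Φ (B zero ∷ w) + Φ ((λ c → sum (λ k → a (suc k) * B (suc k) c)) ∷ w)
        ≈⟨ +-congˡ (linear-sum Φ Φ-cong alternating p (a ∘ suc) (B ∘ suc) w) ⟩
      a zero * Φ (B zero ∷ w) + sum (λ k → a (suc k) * Φ (B (suc k) ∷ w))
        ∎

    -- Expanding the first row of the product as a sum over k, the multiples of
    -- B k can be dropped from the other rows; what is left of them is the product
    -- of a minor of A with the rows of B other than B k.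
    alternating-product : ∀ n (Φ : Form n m) → Congruent Φ → Alternating n Φ →
      ∀ (A : Rows n n) (B : Rows n m) →
      Φ (λ i c → sum λ k → A i k * B k c) ≈ det A * Φ B
    alternating-product zero    Φ Φ-cong alternating A B = trans (Φ-cong λ ()) (sym (*-identityˡ _))
    alternating-product (suc n) Φ Φ-cong alternating@(lin , rep , alt) A B = begin
      Φ (λ i c → sum λ k → A i k * B k c)
        ≈⟨ Φ-cong (λ { zero c → refl ; (suc i) c → refl }) ⟩
      Φ ((λ c → sum λ k → A zero k * B k c) ∷ rest)
        ≈⟨ linear-sum Φ Φ-cong alternating (suc n) (A zero) B rest ⟩
      sum (λ k → A zero k * Φ (B k ∷ rest))
        ≈⟨ sum-cong-≋ {suc n} term ⟩
      sum (λ k → sgn k * A zero k * det (minor k) * Φ B)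
        ≈⟨ *-distribʳ-sum (Φ B) (λ k → sgn k * A zero k * det (minor k)) ⟨
      det A * Φ B
        ∎
      where
      rest : Rows n m
      rest i c = sum λ k → A (suc i) k * B k c
      minor : Fin (suc n) → Rows n n
      minor k i l = A (suc i) (punchIn k l)
      term : ∀ k → A zero k * Φ (B k ∷ rest) ≈ sgn k * A zero k * det (minor k) * Φ B
      term k = begin
        A zero k * Φ (B k ∷ rest)
          ≈⟨ *-congˡ (Φ-cong (∷-cong (λ _ → refl) λ i c →
               sum-remove {i = k} (λ l → A (suc i) l * B l c))) ⟩
        A zero k * Φ (B k ∷ (λ i c → A (suc i) k * B k c + rest′ i c))
          ≈⟨ *-congˡ (drop-multiples Φ Φ-cong alternating (B k) (λ i → A (suc i) k) rest′) ⟩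
        A zero k * Φ (B k ∷ rest′)
          ≈⟨ *-congˡ (alternating-product n (λ x → Φ (B k ∷ x)) (λ e → Φ-cong (∷-cong (λ _ → refl) e)) (alt (B k))
               (minor k) (B ∘ punchIn k)) ⟩
        A zero k * (det (minor k) * Φ (B k ∷ (B ∘ punchIn k)))
          ≈⟨ *-congˡ (*-congˡ (move-first Φ Φ-cong alternating k B)) ⟩
        A zero k * (det (minor k) * (sgn k * Φ B))
          ≈⟨ solve 4 (λ a d s x → a :* (d :* (s :* x)) := s :* a :* d :* x) refl
               (A zero k) (det (minor k)) (sgn k) (Φ B) ⟩
        sgn k * A zero k * det (minor k) * Φ B
          ∎
        where
        rest′ : Rows n m
        rest′ i c = sum λ l → A (suc i) (punchIn k l) * B (punchIn k l) c

-- Determinants indexed by ℕ: block reductions and Krattenthaler's determinant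

module DeterminantEvaluation {c ℓ} (R : CommutativeRing c ℓ) where
  open CommutativeRing R hiding (zero)
  open RingNotions R using (det; _^_; ∏<)
  open import Algebra.Properties.Semiring.Exp semiring using (^-homo-*)
  open import Algebra.Properties.Semiring.Sum semiring using (*-distribˡ-sum; sum-cong-≋)
  open IntegerSolver R
  open Determinant R
  open SetoidReasoning setoid
  open Fold +-commutativeMonoid public
    using () renaming
    ( fold< to ∑<; fold<-cong to ∑<-cong; fold<-cong′ to ∑<-cong′; fold<-∙ to ∑<-+
    ; fold<-ε to ∑<-0; fold<-snoc to ∑<-snoc; fold<-+ to ∑<-split; fold<-skip to ∑<-skip )
  open Fold *-commutativeMonoid public
    using () renaming
    ( fold<-cong to ∏<-cong; fold<-cong′ to ∏<-cong′; fold<-∙ to ∏<-*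
    ; fold<-ε to ∏<-1; fold<-snoc to ∏<-snoc; fold<-+ to ∏<-split; fold<-skip to ∏<-skip
    ; fold<-reverse to ∏<-reverse )

  Matrix : Set c
  Matrix = ℕ → ℕ → Carrier

  -1^ : ℕ → Carrier
  -1^ n = (- 1#) ^ n

  -1^n*-1^n : ∀ n → -1^ n * -1^ n ≈ 1#
  -1^n*-1^n zero    = *-identityˡ 1#
  -1^n*-1^n (suc n) = trans
    (solve 1 (λ s → (:- con (+ 1) :* s) :* (:- con (+ 1) :* s) := s :* s) refl (-1^ n)) (-1^n*-1^n n)

  -1^[n*2] : ∀ n → -1^ (n ℕ.* 2) ≈ 1#
  -1^[n*2] zero    = refl
  -1^[n*2] (suc n) = trans
    (solve 1 (λ s → :- con (+ 1) :* (:- con (+ 1) :* s) := s) refl (-1^ (n ℕ.* 2))) (-1^[n*2] n)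

  det< : ℕ → Matrix → Carrier
  det< n f = det {n} λ i j → f (toℕ i) (toℕ j)

  minor : ℕ → Matrix → Matrix
  minor j f i k = f (suc i) (skip j k)

  det<-cong : ∀ n {f g} → (∀ i j → i < n → j < n → f i j ≈ g i j) → det< n f ≈ det< n g
  det<-cong n e = det-cong λ i j → e (toℕ i) (toℕ j) (Fin.toℕ<n i) (Fin.toℕ<n j)

  det<-expand : ∀ n f → det< (suc n) f ≈ ∑< (suc n) λ j → -1^ j * f 0 j * det< n (minor j f)
  det<-expand n f = sum-cong-≋ {suc n} λ j → *-congˡ { -1^ (toℕ j) * f 0 (toℕ j)} (det-cong λ i k →
    reflexive (≡.cong (f (suc (toℕ i))) (toℕ-punchIn j k)))

  det<-product : ∀ n A B → det< n (λ i j → ∑< n λ k → A i k * B k j) ≈ det< n A * det< n B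
  det<-product n A B = alternating-product n det det-cong (det-alternating n) _ _

  ∑<-single : ∀ n f j → j < suc n → (∀ k → k < n → f (skip j k) ≈ 0#) → ∑< (suc n) f ≈ f j
  ∑<-single n f j j<n z =
    trans (∑<-skip n f j j<n) (trans (+-congˡ (∑<-0 n z)) (+-identityʳ (f j)))

  cofactor : ℕ → Matrix → ℕ → Carrier
  cofactor n f j = -1^ j * f 0 j * det< n (minor j f)

  cofactor-0 : ∀ n f j → f 0 j ≈ 0# → cofactor n f j ≈ 0#
  cofactor-0 n f j z = trans (*-congʳ {det< n (minor j f)} (trans (*-congˡ { -1^ j} z) (zeroʳ _))) (zeroˡ _)

  cofactor-minor-0 : ∀ n f j → det< n (minor j f) ≈ 0# → cofactor n f j ≈ 0#
  cofactor-minor-0 n f j z = trans (*-congˡ { -1^ j * f 0 j} z) (zeroʳ _)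

  det<-single : ∀ n f j → j < suc n → (∀ k → k < n → f 0 (skip j k) ≈ 0#) →
    det< (suc n) f ≈ -1^ j * f 0 j * det< n (minor j f)
  det<-single n f j j<n z = trans (det<-expand n f)
    (∑<-single n (cofactor n f) j j<n λ k k<n → cofactor-0 n f (skip j k) (z k k<n))

  det<-zeroRow : ∀ n f i → i < n → (∀ j → j < n → f i j ≈ 0#) → det< n f ≈ 0#
  det<-zeroRow (suc n) f zero    i<n       z = trans (det<-expand n f) (∑<-0 (suc n) λ j j<n →
    cofactor-0 n f j (z j j<n))
  det<-zeroRow (suc n) f (suc i) (s<s i<n) z = trans (det<-expand n f) (∑<-0 (suc n) λ j j<n →
    cofactor-minor-0 n f j (det<-zeroRow n (minor j f) i i<n λ k k<n → z (skip j k) (skip-bound j k<n)))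

  det<-zeroColumn : ∀ n f → (∀ i → i < suc n → f i 0 ≈ 0#) → det< (suc n) f ≈ 0#
  det<-zeroColumn n f z = trans (det<-expand n f) (∑<-0 (suc n) (term n f z))
    where
    term : ∀ n f → (∀ i → i < suc n → f i 0 ≈ 0#) → ∀ j → j < suc n → cofactor n f j ≈ 0#
    term n       f z zero    _ = cofactor-0 n f 0 (z 0 z<s)
    term (suc n) f z (suc j) _ = cofactor-minor-0 (suc n) f (suc j)
      (det<-zeroColumn n (minor (suc j) f) λ i i<n → z (suc i) (s<s i<n))
    term zero    f z (suc j) (s<s ())

  det<-lower : ∀ n f → (∀ i j → i < j → f i j ≈ 0#) → det< n f ≈ ∏< n λ i → f i i
  det<-lower zero    f z = refl
  det<-lower (suc n) f z = begin
    det< (suc n) f                                    ≈⟨ det<-single n f 0 z<s (λ k _ → z 0 (suc k) z<s) ⟩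
    1# * f 0 0 * det< n (λ i k → f (suc i) (suc k))   ≈⟨ *-cong (*-identityˡ _)
                                                           (det<-lower n _ λ i j i<j → z (suc i) (suc j) (s<s i<j)) ⟩
    f 0 0 * ∏< n (λ i → f (suc i) (suc i))            ∎

  det<-upper : ∀ n f → (∀ i j → j < i → f i j ≈ 0#) → det< n f ≈ ∏< n λ i → f i i
  det<-upper zero    f z = refl
  det<-upper (suc n) f z = begin
    det< (suc n) f
      ≈⟨ det<-expand n f ⟩
    1# * f 0 0 * det< n (λ i k → f (suc i) (suc k)) + ∑< n (λ j → cofactor n f (suc j))
      ≈⟨ +-cong (*-cong (*-identityˡ _) (det<-upper n _ λ i j j<i → z (suc i) (suc j) (s<s j<i)))
           (∑<-0 n (others n f z)) ⟩
    f 0 0 * ∏< n (λ i → f (suc i) (suc i)) + 0#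
      ≈⟨ +-identityʳ _ ⟩
    f 0 0 * ∏< n (λ i → f (suc i) (suc i))
      ∎
    where
    others : ∀ n f → (∀ i j → j < i → f i j ≈ 0#) → ∀ j → j < n → cofactor n f (suc j) ≈ 0#
    others (suc n) f z j j<n = cofactor-minor-0 (suc n) f (suc j)
      (det<-zeroColumn n (minor (suc j) f) λ i _ → z (suc i) 0 z<s)

  det<-scale : ∀ n u v f → det< n (λ i j → u i * v j * f i j) ≈ ∏< n u * ∏< n v * det< n f
  det<-scale zero    u v f = sym (trans (*-identityʳ _) (*-identityˡ 1#))
  det<-scale (suc n) u v f = begin
    det< (suc n) (λ i j → u i * v j * f i j)
      ≈⟨ det<-expand n (λ i j → u i * v j * f i j) ⟩
    ∑< (suc n) (λ j → -1^ j * (u 0 * v j * f 0 j) * det< n (minor j (λ i j → u i * v j * f i j)))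
      ≈⟨ ∑<-cong (suc n) term ⟩
    ∑< (suc n) (λ j → ∏< (suc n) u * ∏< (suc n) v * (-1^ j * f 0 j * det< n (minor j f)))
      ≈⟨ *-distribˡ-sum (∏< (suc n) u * ∏< (suc n) v)
           (λ (j : Fin (suc n)) → -1^ (toℕ j) * f 0 (toℕ j) * det< n (minor (toℕ j) f)) ⟨
    ∏< (suc n) u * ∏< (suc n) v * ∑< (suc n) (λ j → -1^ j * f 0 j * det< n (minor j f))
      ≈⟨ *-congˡ (det<-expand n f) ⟨
    ∏< (suc n) u * ∏< (suc n) v * det< (suc n) f
      ∎
    where
    term : ∀ j → j < suc n →
      -1^ j * (u 0 * v j * f 0 j) * det< n (minor j (λ i j → u i * v j * f i j))
      ≈ ∏< (suc n) u * ∏< (suc n) v * (-1^ j * f 0 j * det< n (minor j f))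
    term j j<n = begin
      -1^ j * (u 0 * v j * f 0 j) * det< n (minor j (λ i j → u i * v j * f i j))
        ≈⟨ *-congˡ (det<-scale n (u ∘ suc) (v ∘ skip j) (minor j f)) ⟩
      -1^ j * (u 0 * v j * f 0 j) * (∏< n (u ∘ suc) * ∏< n (v ∘ skip j) * det< n (minor j f))
        ≈⟨ solve 7 (λ s u v f u′ v′ d → s :* (u :* v :* f) :* (u′ :* v′ :* d)
             := u :* u′ :* (v :* v′) :* (s :* f :* d)) refl
             (-1^ j) (u 0) (v j) (f 0 j) (∏< n (u ∘ suc)) (∏< n (v ∘ skip j)) (det< n (minor j f)) ⟩
      u 0 * ∏< n (u ∘ suc) * (v j * ∏< n (v ∘ skip j)) * (-1^ j * f 0 j * det< n (minor j f))
        ≈⟨ *-congʳ (*-congˡ (∏<-skip n v j j<n)) ⟨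
      ∏< (suc n) u * ∏< (suc n) v * (-1^ j * f 0 j * det< n (minor j f))
        ∎

  det<-scaleRows : ∀ n u f → det< n (λ i j → u i * f i j) ≈ ∏< n u * det< n f
  det<-scaleRows n u f = begin
    det< n (λ i j → u i * f i j)           ≈⟨ det<-cong n (λ i j _ _ → *-congʳ {f i j} (*-identityʳ (u i))) ⟨
    det< n (λ i j → u i * 1# * f i j)      ≈⟨ det<-scale n u (λ _ → 1#) f ⟩
    ∏< n u * ∏< n (λ _ → 1#) * det< n f    ≈⟨ *-congʳ (trans (*-congˡ (∏<-1 n λ _ _ → refl)) (*-identityʳ _)) ⟩
    ∏< n u * det< n f                      ∎

  δ : Matrix
  δ zero    zero    = 1#
  δ zero    (suc j) = 0#
  δ (suc i) zero    = 0#
  δ (suc i) (suc j) = δ i j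

  δ-diagonal : ∀ i → δ i i ≈ 1#
  δ-diagonal zero    = refl
  δ-diagonal (suc i) = δ-diagonal i

  δ-≢ : ∀ i j → i ≢ j → δ i j ≈ 0#
  δ-≢ zero    zero    i≢j = contradiction ≡.refl i≢j
  δ-≢ zero    (suc j) i≢j = refl
  δ-≢ (suc i) zero    i≢j = refl
  δ-≢ (suc i) (suc j) i≢j = δ-≢ i j (i≢j ∘ ≡.cong suc)

  δ-skip : ∀ i j k → i < j → δ i (skip j k) ≈ δ i k
  δ-skip zero    (suc j) zero    i<j       = refl
  δ-skip zero    (suc j) (suc k) i<j       = refl
  δ-skip (suc i) (suc j) zero    i<j       = refl
  δ-skip (suc i) (suc j) (suc k) (s<s i<j) = δ-skip i j k i<j

  ∑<-δ : ∀ n (f : ℕ → Carrier) t → t < n → ∑< n (λ k → f k * δ k t) ≈ f t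
  ∑<-δ (suc n) f t t<n = trans
    (∑<-single n (λ k → f k * δ k t) t t<n λ k _ → trans (*-congˡ (δ-≢ (skip t k) t (skip-≢ t k))) (zeroʳ _))
    (trans (*-congˡ (δ-diagonal t)) (*-identityʳ (f t)))

  ∑<-δ-out : ∀ n (f : ℕ → Carrier) t → n ≤ t → ∑< n (λ k → f k * δ k t) ≈ 0#
  ∑<-δ-out n f t n≤t = ∑<-0 n λ k k<n →
    trans (*-congˡ {f k} (δ-≢ k t (ℕ.<⇒≢ (ℕ.<-≤-trans k<n n≤t)))) (zeroʳ _)

  ∑<-δˡ : ∀ n (f : ℕ → Carrier) t → t < n → ∑< n (λ k → δ t k * f k) ≈ f t
  ∑<-δˡ (suc n) f t t<n = trans
    (∑<-single n (λ k → δ t k * f k) t t<n λ k _ → trans (*-congʳ (δ-≢ t (skip t k) (skip-≢ t k ∘ ≡.sym))) (zeroˡ _))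
    (trans (*-congʳ (δ-diagonal t)) (*-identityˡ (f t)))

  -- The rows S (m - 1), ..., S 0, followed by those of W.
  stack : ℕ → Matrix → Matrix → Matrix
  stack zero    S W i       = W i
  stack (suc m) S W zero    = S m
  stack (suc m) S W (suc i) = stack m S W i

  stack-bottom : ∀ m S W i → stack m S W (m ℕ.+ i) ≡ W i
  stack-bottom zero    S W i = ≡.refl
  stack-bottom (suc m) S W i = stack-bottom m S W i

  stack-rel : ∀ {p n} m {S S′ W W′ : Matrix} (P : (ℕ → Carrier) → (ℕ → Carrier) → Set p) →
    (∀ l → l < m → P (S l) (S′ l)) → (∀ i → i < n → P (W i) (W′ i)) →
    ∀ i → i < m ℕ.+ n → P (stack m S W i) (stack m S′ W′ i)
  stack-rel zero    P s w i       i<n       = w i i<n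
  stack-rel (suc m) P s w zero    i<n       = s m (ℕ.n<1+n m)
  stack-rel (suc m) P s w (suc i) (s<s i<n) =
    stack-rel m P (λ l l<m → s l (ℕ.m<n⇒m<1+n l<m)) w i i<n

  -- In the expansion along the top row, deleting a column j < n leaves row j of `δ` without its 1,
  -- so that the minor vanishes. At column n + j the sign is `-1^ n` times `-1^ j`; thus every row
  -- of `S` picks up one `-1^ n`.
  det<-block : ∀ m n S → det< (m ℕ.+ n) (stack m S δ)
             ≈ det< m λ r t → -1^ n * S (m ∸ suc r) (n ℕ.+ t)
  det<-block zero    n S = trans (det<-lower n δ λ i j i<j → δ-≢ i j (ℕ.<⇒≢ i<j))
    (∏<-1 n λ i _ → δ-diagonal i)
  det<-block (suc m) n S = begin
    det< (suc m ℕ.+ n) (stack (suc m) S δ)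
      ≈⟨ det<-expand (m ℕ.+ n) (stack (suc m) S δ) ⟩
    ∑< (suc m ℕ.+ n) t
      ≡⟨ ≡.cong (λ N → ∑< N t) (ℕ.+-comm (suc m) n) ⟩
    ∑< (n ℕ.+ suc m) t
      ≈⟨ ∑<-split n (suc m) t ⟩
    ∑< n t + ∑< (suc m) (λ j → t (n ℕ.+ j))
      ≈⟨ +-cong (∑<-0 n left) (∑<-cong′ (suc m) right) ⟩
    0# + ∑< (suc m) (λ j → -1^ j * (-1^ n * S m (n ℕ.+ j)) * det< m (minor j f))
      ≈⟨ +-identityˡ _ ⟩
    ∑< (suc m) (λ j → -1^ j * (-1^ n * S m (n ℕ.+ j)) * det< m (minor j f))
      ≈⟨ det<-expand m f ⟨
    det< (suc m) f
      ∎
    where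
    f : Matrix
    f r t = -1^ n * S (suc m ∸ suc r) (n ℕ.+ t)
    t : ℕ → Carrier
    t j = -1^ j * S m j * det< (m ℕ.+ n) (λ i k → stack m S δ i (skip j k))
    left : ∀ j → j < n → t j ≈ 0#
    left j j<n = trans (*-congˡ (det<-zeroRow (m ℕ.+ n) (λ i k → stack m S δ i (skip j k)) (m ℕ.+ j)
        (ℕ.+-monoʳ-< m j<n) λ k _ →
      trans (reflexive (≡.cong (λ w → w (skip j k)) (stack-bottom m S δ j)))
          (δ-≢ j (skip j k) (skip-≢ j k ∘ ≡.sym)))) (zeroʳ _)
    right : ∀ j → t (n ℕ.+ j) ≈ -1^ j * (-1^ n * S m (n ℕ.+ j)) * det< m (minor j f)
    right j = *-cong
      (trans (*-congʳ (^-homo-* (- 1#) n j))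
        (solve 3 (λ a b s → a :* b :* s := b :* (a :* s)) refl (-1^ n) (-1^ j) (S m (n ℕ.+ j))))
      (begin
        det< (m ℕ.+ n) (λ i k → stack m S δ i (skip (n ℕ.+ j) k))
          ≈⟨ det<-cong (m ℕ.+ n) (λ i k i<N _ → stack-rel {n = n} m {S} {λ l k → S l (skip (n ℕ.+ j) k)}
               (λ v v′ → ∀ k → v (skip (n ℕ.+ j) k) ≈ v′ k) (λ _ _ _ → refl)
               (λ i i<n k → δ-skip i (n ℕ.+ j) k (ℕ.<-≤-trans i<n (ℕ.m≤m+n n j))) i i<N k) ⟩
        det< (m ℕ.+ n) (stack m (λ l k → S l (skip (n ℕ.+ j) k)) δ)
          ≈⟨ det<-block m n _ ⟩
        det< m (λ r t → -1^ n * S (m ∸ suc r) (skip (n ℕ.+ j) (n ℕ.+ t)))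
          ≈⟨ det<-cong m (λ r t _ _ → *-congˡ (reflexive (≡.cong (S (m ∸ suc r)) (skip-+ n j t)))) ⟩
        det< m (minor j f)
          ∎)

  -- The columns that are left after columns 2(n-1), ..., 2m have been deleted:
  -- all columns below 2m, and the odd ones.
  columns : ℕ → ℕ → ℕ
  columns zero    k             = suc (k ℕ.* 2)
  columns (suc m) zero          = 0
  columns (suc m) (suc zero)    = 1
  columns (suc m) (suc (suc k)) = suc (suc (columns m k))

  columns-even : ∀ m → columns (suc m) (m ℕ.* 2) ≡ m ℕ.* 2
  columns-even zero    = ≡.refl
  columns-even (suc m) = ≡.cong (λ k → suc (suc k)) (columns-even m)

  columns-skip : ∀ m k → columns (suc m) (skip (m ℕ.* 2) k) ≡ columns m k
  columns-skip zero    zero          = ≡.refl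
  columns-skip zero    (suc k)       = ≡.refl
  columns-skip (suc m) zero          = ≡.refl
  columns-skip (suc m) (suc zero)    = ≡.refl
  columns-skip (suc m) (suc (suc k)) = ≡.cong (λ k → suc (suc k)) (columns-skip m k)

  columns-full : ∀ m k → k < m ℕ.* 2 → columns m k ≡ k
  columns-full (suc m) zero          _                 = ≡.refl
  columns-full (suc m) (suc zero)    _                 = ≡.refl
  columns-full (suc m) (suc (suc k)) (s<s (s<s k<m*2)) = ≡.cong (λ k → suc (suc k)) (columns-full m k k<m*2)

  columns-low-or-odd : ∀ m n k → m ≤ n → k < m ℕ.+ n →
    columns m k < m ℕ.* 2 ⊎ ∃ λ r → columns m k ≡ suc (r ℕ.* 2) × r < n
  columns-low-or-odd zero    n       k             _         k<n = inj₂ (k , ≡.refl , k<n)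
  columns-low-or-odd (suc m) (suc n) zero          _         _   = inj₁ z<s
  columns-low-or-odd (suc m) (suc n) (suc zero)    _         _   = inj₁ (s<s z<s)
  columns-low-or-odd (suc m) (suc n) (suc (suc k)) (s≤s m≤n) (s<s k<N)
    with columns-low-or-odd m n k m≤n (ℕ.s<s⁻¹ (≡.subst (suc k <_) (ℕ.+-suc m n) k<N))
  ... | inj₁ low            = inj₁ (s<s (s<s low))
  ... | inj₂ (r , eq , r<n) = inj₂ (suc r , ≡.cong (λ k → suc (suc k)) eq , s<s r<n)

  -- The rows of `S` are used up from the last one downwards: nothing is assumed about `S l` in the
  -- even columns beyond 2l, and these are gone when `S l` is expanded. Its only remaining entry
  -- then stands at position 2l, which is even, so no sign arises.
  det<-strip : ∀ n m (S W : Matrix) → m ≤ n →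
    (∀ l → l < m → S l (l ℕ.* 2) ≈ 1#) →
    (∀ l c → l < m → c < l ℕ.* 2 → S l c ≈ 0#) →
    (∀ l r → l < m → r < n → S l (suc (r ℕ.* 2)) ≈ 0#) →
    det< (m ℕ.+ n) (λ i k → stack m S W i (columns m k)) ≈ det< n (λ i k → W i (suc (k ℕ.* 2)))
  det<-strip n zero    S W m≤n one low odd = refl
  det<-strip n (suc m) S W m<n one low odd = begin
    det< (suc m ℕ.+ n) f
      ≈⟨ det<-single (m ℕ.+ n) f (m ℕ.* 2) (s≤s 2m≤m+n) others ⟩
    -1^ (m ℕ.* 2) * S m (columns (suc m) (m ℕ.* 2)) * det< (m ℕ.+ n) (minor (m ℕ.* 2) f)
      ≈⟨ *-cong (*-cong (-1^[n*2] m) (trans (reflexive (≡.cong (S m) (columns-even m))) (one m (ℕ.n<1+n m))))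
           (det<-cong (m ℕ.+ n) λ i k _ _ → reflexive (≡.cong (stack m S W i) (columns-skip m k))) ⟩
    1# * 1# * det< (m ℕ.+ n) (λ i k → stack m S W i (columns m k))
      ≈⟨ trans (*-congʳ (*-identityˡ 1#)) (*-identityˡ _) ⟩
    det< (m ℕ.+ n) (λ i k → stack m S W i (columns m k))
      ≈⟨ det<-strip n m S W (ℕ.<⇒≤ m<n) (λ l l<m → one l (ℕ.m<n⇒m<1+n l<m))
           (λ l c l<m → low l c (ℕ.m<n⇒m<1+n l<m)) (λ l r l<m → odd l r (ℕ.m<n⇒m<1+n l<m)) ⟩
    det< n (λ i k → W i (suc (k ℕ.* 2)))
      ∎
    where
    f : Matrix
    f i k = stack (suc m) S W i (columns (suc m) k)
    2m≤m+n : m ℕ.* 2 ≤ m ℕ.+ n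
    2m≤m+n = ≡.subst (_≤ m ℕ.+ n) (≡.trans (≡.cong (m ℕ.+_) (≡.sym (ℕ.+-identityʳ m))) (ℕ.*-comm 2 m))
      (ℕ.+-monoʳ-≤ m (ℕ.<⇒≤ m<n))
    others : ∀ k → k < m ℕ.+ n → f 0 (skip (m ℕ.* 2) k) ≈ 0#
    others k k<N with columns-low-or-odd m n k (ℕ.<⇒≤ m<n) k<N
    ... | inj₁ c<2m = trans (reflexive (≡.cong (S m) (columns-skip m k))) (low m (columns m k) (ℕ.n<1+n m) c<2m)
    ... | inj₂ (r , eq , r<n) = trans (reflexive (≡.cong (S m) (≡.trans (columns-skip m k) eq)))
        (odd m r (ℕ.n<1+n m) r<n)

  -- Cancellation in place of division, so that the evaluation applies to polynomials and to their
  -- fractions alike.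
  Regular : Carrier → Set (c ⊔ ℓ)
  Regular r = ∀ u v → r * u ≈ r * v → u ≈ v

  ∏<-regular : ∀ n f → (∀ i → i < n → Regular (f i)) → Regular (∏< n f)
  ∏<-regular zero    f reg u v e = trans (sym (*-identityˡ u)) (trans e (*-identityˡ v))
  ∏<-regular (suc n) f reg u v e = ∏<-regular n (f ∘ suc) (λ i i<n → reg (suc i) (s<s i<n)) u v
    (reg 0 z<s _ _ (trans (sym (*-assoc _ _ _)) (trans e (*-assoc _ _ _))))

  ∏<-neg : ∀ n f → -1^ n * ∏< n f ≈ ∏< n λ i → - f i
  ∏<-neg zero    f = *-identityˡ 1#
  ∏<-neg (suc n) f = begin
    (- 1# * -1^ n) * (f 0 * ∏< n (f ∘ suc))    ≈⟨ solve 3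
        (λ s a p → (:- con (+ 1) :* s) :* (a :* p) := (:- a) :* (s :* p)) refl (-1^ n) (f 0) _ ⟩
    - f 0 * (-1^ n * ∏< n (f ∘ suc))           ≈⟨ *-congˡ (∏<-neg n (f ∘ suc)) ⟩
    - f 0 * ∏< n (λ i → - f (suc i))           ∎

  -- As a polynomial in `ξ r`, column t has the zeros a 0, ..., a (t - 1) and b (t + 1), ..., b (n -
  -- 1). Neighbouring columns thus share all but one of their zeros.
  krattenthalerMatrix : ℕ → (ℕ → Carrier) → (ℕ → Carrier) → (ℕ → Carrier) → Matrix
  krattenthalerMatrix n a b ξ r t = ∏< (n ∸ suc t) (λ s → b (suc t ℕ.+ s) - ξ r) * ∏< t (λ s → a s - ξ r)

  -- Krattenthaler's determinant.  The combination
  -- (a t - ξ 0) column t - (b (t + 1) - ξ 0) column (t + 1) has the factor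
  -- (ξ 0 - ξ r) (a t - b (t + 1)) in row r, so that row 0 is cleared except in
  -- the last column and the cofactor is of the same form.
  krattenthaler : ∀ n a b ξ → (∀ i r → i < n → r < n → Regular (a i - ξ r)) →
    det< n (krattenthalerMatrix n a b ξ)
    ≈ ∏< n (λ t → ∏< t λ s → ξ t - ξ s) * ∏< n (λ t → ∏< t λ s → a s - b t)
  krattenthaler zero    a b ξ reg = sym (*-identityˡ 1#)
  krattenthaler (suc n) a b ξ reg =
    ∏<-regular (suc n) (λ t → a t - ξ 0) (λ t t≤n → reg t 0 t≤n z<s) _ _ (begin
    w * det< (suc n) P
      ≈⟨ *-comm w _ ⟩
    det< (suc n) P * w
      ≈⟨ *-congˡ det-C ⟨
    det< (suc n) P * det< (suc n) C
      ≈⟨ det<-product (suc n) P C ⟨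
    det< (suc n) PC
      ≈⟨ det<-single n PC n (ℕ.n<1+n n) (λ k k<n → trans (reflexive (≡.cong (PC 0) (skip-< k<n)))
           (trans (PC-< 0 k k<n) (trans (*-congʳ (trans (*-congʳ (-‿inverseʳ (ξ 0))) (zeroˡ _))) (zeroˡ _)))) ⟩
    -1^ n * PC 0 n * det< n (minor n PC)
      ≈⟨ *-cong (*-congˡ PC-n) (trans
           (det<-cong n λ i k _ k<n → trans (reflexive (≡.cong (PC (suc i)) (skip-< k<n))) (PC-< (suc i) k k<n))
           (det<-scale n (λ i → ξ 0 - ξ (suc i)) (λ k → a k - b (suc k)) P′)) ⟩
    -1^ n * w * (∏< n (λ i → ξ 0 - ξ (suc i)) * ∏< n (λ k → a k - b (suc k)) * det< n P′)
      ≈⟨ solve 5 (λ e w x y d → e :* w :* (x :* y :* d) := w :* ((e :* x) :* y :* d)) refl (-1^ n) w _ _ _ ⟩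
    w * ((-1^ n * ∏< n (λ i → ξ 0 - ξ (suc i))) * ∏< n (λ k → a k - b (suc k)) * det< n P′)
      ≈⟨ *-congˡ (*-cong (*-congʳ (trans (∏<-neg n (λ i → ξ 0 - ξ (suc i))) (∏<-cong′ n λ i →
           solve 2 (λ x y → :- (x :- y) := y :- x) refl (ξ 0) (ξ (suc i)))))
           (krattenthaler n a (b ∘ suc) (ξ ∘ suc) λ i r i<n r<n → reg i (suc r) (ℕ.m<n⇒m<1+n i<n) (s<s r<n))) ⟩
    w * (∏< n (λ i → ξ (suc i) - ξ 0) * ∏< n (λ k → a k - b (suc k))
      * (∏< n (λ t → ∏< t λ s → ξ (suc t) - ξ (suc s)) * ∏< n (λ t → ∏< t λ s → a s - b (suc t))))
      ≈⟨ *-congˡ (solve 4 (λ x y z v → x :* y :* (z :* v) := (con (+ 1) :* (x :* z)) :* (con (+ 1) :* (v :* y))) refl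
           (∏< n (λ i → ξ (suc i) - ξ 0)) (∏< n (λ k → a k - b (suc k)))
           (∏< n (λ t → ∏< t λ s → ξ (suc t) - ξ (suc s))) (∏< n (λ t → ∏< t λ s → a s - b (suc t)))) ⟩
    w * ((1# * (∏< n (λ i → ξ (suc i) - ξ 0) * ∏< n (λ t → ∏< t λ s → ξ (suc t) - ξ (suc s))))
      * (1# * (∏< n (λ t → ∏< t λ s → a s - b (suc t)) * ∏< n (λ k → a k - b (suc k)))))
      ≈⟨ *-congˡ (*-cong (*-congˡ (sym (∏<-* n (λ i → ξ (suc i) - ξ 0) (λ t → ∏< t λ s → ξ (suc t) - ξ (suc s)))))
           (*-congˡ (trans (sym (∏<-* n (λ t → ∏< t λ s → a s - b (suc t)) (λ k → a k - b (suc k))))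
             (∏<-cong′ n λ t → sym (∏<-snoc t λ s → a s - b (suc t)))))) ⟩
    w * (∏< (suc n) (λ t → ∏< t λ s → ξ t - ξ s) * ∏< (suc n) (λ t → ∏< t λ s → a s - b t))
      ∎)
    where
    P P′ C PC : Matrix
    P  = krattenthalerMatrix (suc n) a b ξ
    P′ = krattenthalerMatrix n a (b ∘ suc) (ξ ∘ suc)
    -- Multiplication by `C` on the right carries out the column operations. It multiplies the
    -- determinant by `w`. The last column has no right neighbour and is only scaled, which makes
    -- its entry in row 0 equal to `w` as well; hence `w` can be cancelled.
    C k t = δ k t * (a t - ξ 0) + δ k (suc t) * (ξ 0 - b (suc t))
    PC r t = ∑< (suc n) λ k → P r k * C k t
    w : Carrier
    w = ∏< (suc n) (λ t → a t - ξ 0)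
    det-C : det< (suc n) C ≈ w
    det-C = trans
      (det<-lower (suc n) C λ i j i<j → trans
        (+-cong (trans (*-congʳ (δ-≢ i j (ℕ.<⇒≢ i<j))) (zeroˡ _))
                (trans (*-congʳ (δ-≢ i (suc j) (ℕ.<⇒≢ (ℕ.m<n⇒m<1+n i<j)))) (zeroˡ _))) (+-identityˡ 0#))
      (∏<-cong′ (suc n) {g = λ i → a i - ξ 0} λ i → trans
        (+-cong (trans (*-congʳ (δ-diagonal i)) (*-identityˡ _))
                (trans (*-congʳ {ξ 0 - b (suc i)} (δ-≢ i (suc i) (ℕ.<⇒≢ (ℕ.n<1+n i)))) (zeroˡ _))) (+-identityʳ _))
    PC-sum : ∀ r t → PC r t ≈ ∑< (suc n) (λ k → P r k * δ k t) * (a t - ξ 0)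
                            + ∑< (suc n) (λ k → P r k * δ k (suc t)) * (ξ 0 - b (suc t))
    PC-sum r t = begin
      ∑< (suc n) (λ k → P r k * C k t)
        ≈⟨ ∑<-cong′ (suc n) (λ k → solve 5 (λ p d x d′ y → p :* (d :* x :+ d′ :* y)
             := x :* (p :* d) :+ y :* (p :* d′)) refl (P r k) (δ k t) (a t - ξ 0) (δ k (suc t)) (ξ 0 - b (suc t))) ⟩
      ∑< (suc n) (λ k → (a t - ξ 0) * (P r k * δ k t) + (ξ 0 - b (suc t)) * (P r k * δ k (suc t)))
        ≈⟨ ∑<-+ (suc n) (λ k → (a t - ξ 0) * (P r k * δ k t)) (λ k → (ξ 0 - b (suc t)) * (P r k * δ k (suc t))) ⟩
      ∑< (suc n) (λ k → (a t - ξ 0) * (P r k * δ k t)) + ∑< (suc n) (λ k → (ξ 0 - b (suc t)) * (P r k * δ k (suc t)))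
        ≈⟨ +-cong (trans (sym (*-distribˡ-sum {suc n} (a t - ξ 0) (λ k → P r (toℕ k) * δ (toℕ k) t))) (*-comm _ _))
                  (trans (sym (*-distribˡ-sum {suc n} (ξ 0 - b (suc t))
                      (λ k → P r (toℕ k) * δ (toℕ k) (suc t)))) (*-comm _ _)) ⟩
      ∑< (suc n) (λ k → P r k * δ k t) * (a t - ξ 0) + ∑< (suc n) (λ k → P r k * δ k (suc t)) * (ξ 0 - b (suc t))
        ∎
    PC-< : ∀ r t → t < n → PC r t ≈ (ξ 0 - ξ r) * (a t - b (suc t))
      * (∏< (n ∸ suc t) (λ s → b (suc (suc t ℕ.+ s)) - ξ r) * ∏< t (λ s → a s - ξ r))
    PC-< r t t<n = begin
      PC r t
        ≈⟨ PC-sum r t ⟩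
      ∑< (suc n) (λ k → P r k * δ k t) * (a t - ξ 0) + ∑< (suc n) (λ k → P r k * δ k (suc t)) * (ξ 0 - b (suc t))
        ≈⟨ +-cong (*-congʳ (trans (∑<-δ (suc n) (P r) t (ℕ.m<n⇒m<1+n t<n)) (*-congʳ peel)))
                  (*-congʳ (trans (∑<-δ (suc n) (P r) (suc t) (s<s t<n)) (*-congˡ (∏<-snoc t λ s → a s - ξ r)))) ⟩
      (b (suc t) - ξ r) * β * α * (a t - ξ 0) + β * (α * (a t - ξ r)) * (ξ 0 - b (suc t))
        ≈⟨ solve 6 (λ β α x y a b → (b :- y) :* β :* α :* (a :- x) :+ β :* (α :* (a :- y)) :* (x :- b)
             := (x :- y) :* (a :- b) :* (β :* α)) refl β α (ξ 0) (ξ r) (a t) (b (suc t)) ⟩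
      (ξ 0 - ξ r) * (a t - b (suc t)) * (β * α)
        ∎
      where
      α β : Carrier
      α = ∏< t (λ s → a s - ξ r)
      β = ∏< (n ∸ suc t) (λ s → b (suc (suc t ℕ.+ s)) - ξ r)
      peel : ∏< (n ∸ t) (λ s → b (suc t ℕ.+ s) - ξ r) ≈ (b (suc t) - ξ r) * β
      peel = trans
        (reflexive (≡.cong (λ m → ∏< m (λ s → b (suc t ℕ.+ s) - ξ r)) (ℕ.+-∸-assoc 1 t<n)))
        (*-cong (+-congʳ (reflexive (≡.cong (b ∘ suc) (ℕ.+-identityʳ t))))
          (∏<-cong′ (n ∸ suc t) λ s → +-congʳ (reflexive (≡.cong (b ∘ suc) (ℕ.+-suc t s)))))
    PC-n : PC 0 n ≈ w
    PC-n = begin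
      PC 0 n
        ≈⟨ PC-sum 0 n ⟩
      ∑< (suc n) (λ k → P 0 k * δ k n) * (a n - ξ 0) + ∑< (suc n) (λ k → P 0 k * δ k (suc n)) * (ξ 0 - b (suc n))
        ≈⟨ +-cong (*-congʳ (trans (∑<-δ (suc n) (P 0) n (ℕ.n<1+n n)) (*-congʳ
             (reflexive (≡.cong (λ m → ∏< m (λ s → b (suc n ℕ.+ s) - ξ 0)) (ℕ.n∸n≡0 n))))))
             (*-congʳ (∑<-δ-out (suc n) (P 0) (suc n) ℕ.≤-refl)) ⟩
      1# * ∏< n (λ s → a s - ξ 0) * (a n - ξ 0) + 0# * (ξ 0 - b (suc n))
        ≈⟨ trans (+-cong (*-congʳ (*-identityˡ _)) (zeroˡ _)) (+-identityʳ _) ⟩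
      ∏< n (λ s → a s - ξ 0) * (a n - ξ 0)
        ≈⟨ ∏<-snoc n (λ s → a s - ξ 0) ⟨
      w
        ∎

-- Formal power series

module PowerSeries {c ℓ} (R : CommutativeRing c ℓ) where
  open CommutativeRing R hiding (zero)
  open import Algebra.Properties.CommutativeSemigroup +-commutativeSemigroup
    using (interchange; x∙yz≈y∙xz)
  open SetoidReasoning setoid

  Series : Set c
  Series = ℕ → Carrier

  infix 4 _≈ₛ_
  record _≈ₛ_ (f g : Series) : Set ℓ where
    constructor mk≈ₛ
    field at : ∀ n → f n ≈ g n
  open _≈ₛ_ public

  tail : Series → Series
  tail f n = f (suc n)

  0ₛ : Series
  0ₛ _ = 0#

  constant : Carrier → Series
  constant a zero    = a
  constant a (suc n) = 0#

  infixl 6 _+ₛ_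
  infixl 7 _*ₛ_
  _+ₛ_ _*ₛ_ : Series → Series → Series
  (f +ₛ g) n       = f n + g n
  (f *ₛ g) zero    = f 0 * g 0
  (f *ₛ g) (suc n) = f 0 * g (suc n) + (tail f *ₛ g) n

  -ₛ_ : Series → Series
  (-ₛ f) n = - f n

  *ₛ-cong : ∀ {f f′ g g′} → f ≈ₛ f′ → g ≈ₛ g′ → f *ₛ g ≈ₛ f′ *ₛ g′
  *ₛ-cong e e′ = mk≈ₛ (go e e′)
    where
    go : ∀ {f f′ g g′} → f ≈ₛ f′ → g ≈ₛ g′ → ∀ n → (f *ₛ g) n ≈ (f′ *ₛ g′) n
    go e e′ zero    = *-cong (at e 0) (at e′ 0)
    go e e′ (suc n) = +-cong (*-cong (at e 0) (at e′ (suc n))) (go (mk≈ₛ λ m → at e (suc m)) e′ n)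

  *ₛ-zeroˡ : ∀ f n → (0ₛ *ₛ f) n ≈ 0#
  *ₛ-zeroˡ f zero    = zeroˡ (f 0)
  *ₛ-zeroˡ f (suc n) = trans (+-cong (zeroˡ _) (*ₛ-zeroˡ f n)) (+-identityˡ 0#)

  constant-* : ∀ a f n → (constant a *ₛ f) n ≈ a * f n
  constant-* a f zero    = refl
  constant-* a f (suc n) = trans (+-congˡ (*ₛ-zeroˡ f n)) (+-identityʳ _)

  *ₛ-distribʳ : ∀ f g k n → ((g +ₛ k) *ₛ f) n ≈ (g *ₛ f +ₛ k *ₛ f) n
  *ₛ-distribʳ f g k zero    = distribʳ (f 0) (g 0) (k 0)
  *ₛ-distribʳ f g k (suc n) = trans
    (+-cong (distribʳ (f (suc n)) (g 0) (k 0)) (*ₛ-distribʳ f (tail g) (tail k) n))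
    (interchange _ _ _ _)

  *ₛ-scale : ∀ a f g n → ((λ m → a * f m) *ₛ g) n ≈ a * (f *ₛ g) n
  *ₛ-scale a f g zero    = *-assoc a (f 0) (g 0)
  *ₛ-scale a f g (suc n) = trans (+-cong (*-assoc _ _ _) (*ₛ-scale a (tail f) g n)) (sym (distribˡ _ _ _))

  *ₛ-suc : ∀ f g n → (f *ₛ g) (suc n) ≈ f (suc n) * g 0 + (f *ₛ tail g) n
  *ₛ-suc f g zero    = +-comm _ _
  *ₛ-suc f g (suc n) = trans (+-congˡ (*ₛ-suc (tail f) g n)) (x∙yz≈y∙xz _ _ _)

  *ₛ-comm : ∀ f g n → (f *ₛ g) n ≈ (g *ₛ f) n
  *ₛ-comm f g zero    = *-comm (f 0) (g 0)
  *ₛ-comm f g (suc n) = begin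
    f 0 * g (suc n) + (tail f *ₛ g) n    ≈⟨ +-cong (*-comm _ _) (*ₛ-comm (tail f) g n) ⟩
    g (suc n) * f 0 + (g *ₛ tail f) n    ≈⟨ *ₛ-suc g f n ⟨
    (g *ₛ f) (suc n)                     ∎

  *ₛ-assoc : ∀ f g k n → ((f *ₛ g) *ₛ k) n ≈ (f *ₛ (g *ₛ k)) n
  *ₛ-assoc f g k zero    = *-assoc (f 0) (g 0) (k 0)
  *ₛ-assoc f g k (suc n) = begin
    f 0 * g 0 * k (suc n) + (tail (f *ₛ g) *ₛ k) n
      ≈⟨ +-cong (*-assoc _ _ _) (*ₛ-distribʳ k (λ m → f 0 * g (suc m)) (tail f *ₛ g) n) ⟩
    f 0 * (g 0 * k (suc n)) + (((λ m → f 0 * tail g m) *ₛ k) n + ((tail f *ₛ g) *ₛ k) n)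
      ≈⟨ +-congˡ (+-cong (*ₛ-scale (f 0) (tail g) k n) (*ₛ-assoc (tail f) g k n)) ⟩
    f 0 * (g 0 * k (suc n)) + (f 0 * (tail g *ₛ k) n + (tail f *ₛ (g *ₛ k)) n)
      ≈⟨ +-assoc _ _ _ ⟨
    f 0 * (g 0 * k (suc n)) + f 0 * (tail g *ₛ k) n + (tail f *ₛ (g *ₛ k)) n
      ≈⟨ +-congʳ (distribˡ _ _ _) ⟨
    (f *ₛ (g *ₛ k)) (suc n)
      ∎

  *ₛ-identityˡ : ∀ f → constant 1# *ₛ f ≈ₛ f
  *ₛ-identityˡ f = mk≈ₛ λ n → trans (constant-* 1# f n) (*-identityˡ (f n))

  series : CommutativeRing c ℓ
  series = record
    { Carrier = Series
    ; _≈_ = _≈ₛ_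
    ; _+_ = _+ₛ_
    ; _*_ = _*ₛ_
    ; -_  = -ₛ_
    ; 0#  = 0ₛ
    ; 1#  = constant 1#
    ; isCommutativeRing = record
      { isRing = record
        { +-isAbelianGroup = record
          { isGroup = record
            { isMonoid = record
              { isSemigroup = record
                { isMagma = record
                  { isEquivalence = record
                    { refl  = mk≈ₛ λ _ → refl
                    ; sym   = λ e → mk≈ₛ λ n → sym (at e n)
                    ; trans = λ e e′ → mk≈ₛ λ n → trans (at e n) (at e′ n)
                    }
                  ; ∙-cong = λ e e′ → mk≈ₛ λ n → +-cong (at e n) (at e′ n)
                  }
                ; assoc = λ f g k → mk≈ₛ λ n → +-assoc (f n) (g n) (k n)
                }
              ; identity = (λ f → mk≈ₛ λ n → +-identityˡ (f n)) , (λ f → mk≈ₛ λ n → +-identityʳ (f n))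
              }
            ; inverse = (λ f → mk≈ₛ λ n → -‿inverseˡ (f n)) , (λ f → mk≈ₛ λ n → -‿inverseʳ (f n))
            ; ⁻¹-cong = λ e → mk≈ₛ λ n → -‿cong (at e n)
            }
          ; comm = λ f g → mk≈ₛ λ n → +-comm (f n) (g n)
          }
        ; *-cong = *ₛ-cong
        ; *-assoc = λ f g k → mk≈ₛ (*ₛ-assoc f g k)
        ; *-identity = *ₛ-identityˡ
            , λ f → mk≈ₛ λ n → trans (*ₛ-comm f (constant 1#) n) (at (*ₛ-identityˡ f) n)
        ; distrib = (λ f g k → mk≈ₛ λ n → trans (*ₛ-comm f (g +ₛ k) n)
                       (trans (*ₛ-distribʳ f g k n) (+-cong (*ₛ-comm g f n) (*ₛ-comm k f n))))
                  , λ f g k → mk≈ₛ (*ₛ-distribʳ f g k)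
        }
      ; *-comm = λ f g → mk≈ₛ (*ₛ-comm f g)
      }
    }

  z : Series
  z zero    = 0#
  z (suc n) = constant 1# n

  z*-zero : ∀ f → (z *ₛ f) 0 ≈ 0#
  z*-zero f = zeroˡ (f 0)

  z*-suc : ∀ f n → (z *ₛ f) (suc n) ≈ f n
  z*-suc f n = trans (+-cong (zeroˡ _) (at (*ₛ-identityˡ f) n)) (+-identityˡ (f n))

  constant-+ : ∀ a b → constant (a + b) ≈ₛ constant a +ₛ constant b
  constant-+ a b = mk≈ₛ λ { zero → refl ; (suc n) → sym (+-identityˡ 0#) }

  constant-*-homo : ∀ a b → constant (a * b) ≈ₛ constant a *ₛ constant b
  constant-*-homo a b = mk≈ₛ λ
    { zero → refl
    ; (suc n) → sym (trans (constant-* a (constant b) (suc n)) (zeroʳ a)) }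

  constant-neg : ∀ a → constant (- a) ≈ₛ -ₛ constant a
  constant-neg a = mk≈ₛ λ { zero → refl ; (suc n) → sym -0#≈0# }
    where open import Algebra.Properties.Ring ring using (-0#≈0#)

  constant-cong : ∀ {a b} → a ≈ b → constant a ≈ₛ constant b
  constant-cong e = mk≈ₛ λ { zero → e ; (suc n) → refl }

-- Rising factorials

-- The divisions by integers that the binomial coefficients call for, in a form that ℚ[x] and its
-- fraction field both provide.
record InverseFactorials {c ℓ} (R : CommutativeRing c ℓ) : Set (c ⊔ ℓ) where
  open CommutativeRing R
  open RingNotions R using (ι)
  field
    1/_!  : ℕ → Carrier
    1/!*! : ∀ n → 1/ n ! * ι (n !) ≈ 1#

module RisingFactorials {c ℓ} (R : CommutativeRing c ℓ) (inverses : InverseFactorials R) where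
  open CommutativeRing R hiding (zero)
  open RingNotions R using (ι; ∏<) renaming (pochhammer to rise) public
  open import Algebra.Properties.Semiring.Mult semiring using (×-homo-+; ×1-homo-*)
  open InverseFactorials inverses
  open IntegerSolver R
  open DeterminantEvaluation R
  open SetoidReasoning setoid

  ι-+ : ∀ m n → ι (m ℕ.+ n) ≈ ι m + ι n
  ι-+ = ×-homo-+ 1#

  ι-* : ∀ m n → ι (m ℕ.* n) ≈ ι m * ι n
  ι-* = ×1-homo-*

  rise-cong : ∀ {β γ} p → β ≈ γ → rise β p ≈ rise γ p
  rise-cong p e = ∏<-cong′ p λ k → +-congʳ {ι k} e

  rise-suc : ∀ β p → rise β (suc p) ≈ β * rise (β + 1#) p
  rise-suc β p = *-cong (+-identityʳ β) (∏<-cong′ p λ k → sym (+-assoc β 1# (ι k)))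

  rise-snoc : ∀ β p → rise β (suc p) ≈ rise β p * (β + ι p)
  rise-snoc β p = ∏<-snoc p λ k → β + ι k

  rise-+ : ∀ β p q → rise β (p ℕ.+ q) ≈ rise β p * rise (β + ι p) q
  rise-+ β p q = trans (∏<-split p q λ k → β + ι k) (*-congˡ (∏<-cong′ q λ k →
    trans (+-congˡ (ι-+ p k)) (sym (+-assoc β (ι p) (ι k)))))

  -- (1 - z)^(-β) = ∑ H β p z^p.
  H : Carrier → ℕ → Carrier
  H β p = 1/ p ! * rise β p

  H-cong : ∀ {β γ} p → β ≈ γ → H β p ≈ H γ p
  H-cong p e = *-congˡ (rise-cong p e)

  ι-suc*1/! : ∀ n → ι (suc n) * 1/ suc n ! ≈ 1/ n !
  ι-suc*1/! n = begin
    ι (suc n) * 1/ suc n !                                   ≈⟨ *-identityʳ _ ⟨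
    ι (suc n) * 1/ suc n ! * 1#                              ≈⟨ *-congˡ (1/!*! n) ⟨
    ι (suc n) * 1/ suc n ! * (1/ n ! * ι (n !))              ≈⟨ solve 4
        (λ a b c d → a :* b :* (c :* d) := b :* (a :* d) :* c) refl _ _ _ _ ⟩
    1/ suc n ! * (ι (suc n) * ι (n !)) * 1/ n !              ≈⟨ *-congʳ (*-congˡ (ι-* (suc n) (n !))) ⟨
    1/ suc n ! * ι (suc n !) * 1/ n !                        ≈⟨ *-congʳ (1/!*! (suc n)) ⟩
    1# * 1/ n !                                              ≈⟨ *-identityˡ _ ⟩
    1/ n !                                                   ∎

  1/0! : 1/ 0 ! ≈ 1#
  1/0! = trans (sym (*-identityʳ _)) (trans (*-congˡ (sym (+-identityʳ 1#))) (1/!*! 0))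

  ι-suc-regular : ∀ n → Regular (ι (suc n))
  ι-suc-regular n u v e = begin
    u                          ≈⟨ unit u ⟨
    r * (ι (suc n) * u)        ≈⟨ *-congˡ e ⟩
    r * (ι (suc n) * v)        ≈⟨ unit v ⟩
    v                          ∎
    where
    r : Carrier
    r = ι (n !) * 1/ suc n !
    unit : ∀ u → r * (ι (suc n) * u) ≈ u
    unit u = begin
      ι (n !) * 1/ suc n ! * (ι (suc n) * u)    ≈⟨ solve 4
          (λ a b c d → a :* b :* (c :* d) := (c :* b) :* a :* d) refl _ _ _ _ ⟩
      ι (suc n) * 1/ suc n ! * ι (n !) * u      ≈⟨ *-congʳ (*-congʳ (ι-suc*1/! n)) ⟩
      1/ n ! * ι (n !) * u                      ≈⟨ *-congʳ (1/!*! n) ⟩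
      1# * u                                    ≈⟨ *-identityˡ u ⟩
      u                                         ∎

  H-zero : ∀ β → H β 0 ≈ 1#
  H-zero β = trans (*-identityʳ _) 1/0!

  ι-suc*H : ∀ β p → ι (suc p) * H β (suc p) ≈ β * H (β + 1#) p
  ι-suc*H β p = begin
    ι (suc p) * (1/ suc p ! * rise β (suc p))          ≈⟨ *-congˡ (*-congˡ (rise-suc β p)) ⟩
    ι (suc p) * (1/ suc p ! * (β * rise (β + 1#) p))   ≈⟨ solve 4
        (λ a b c d → a :* (b :* (c :* d)) := c :* ((a :* b) :* d)) refl _ _ _ _ ⟩
    β * (ι (suc p) * 1/ suc p ! * rise (β + 1#) p)     ≈⟨ *-congˡ (*-congʳ (ι-suc*1/! p)) ⟩
    β * H (β + 1#) p                                   ∎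

  H-pascal : ∀ β p → H (β + 1#) (suc p) ≈ H (β + 1#) p + H β (suc p)
  H-pascal β p = begin
    1/ suc p ! * rise (β + 1#) (suc p)
      ≈⟨ *-congˡ (rise-snoc (β + 1#) p) ⟩
    1/ suc p ! * (rise (β + 1#) p * (β + 1# + ι p))
      ≈⟨ solve 4 (λ i r b n → i :* (r :* (b :+ con (+ 1) :+ n))
           := (con (+ 1) :+ n) :* i :* r :+ i :* (b :* r)) refl (1/ suc p !) (rise (β + 1#) p) β (ι p) ⟩
    ι (suc p) * 1/ suc p ! * rise (β + 1#) p + 1/ suc p ! * (β * rise (β + 1#) p)
      ≈⟨ +-cong (*-congʳ (ι-suc*1/! p)) (*-congˡ (sym (rise-suc β p))) ⟩
    H (β + 1#) p + H β (suc p)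
      ∎

  -- Both sides are `rise β (suc p)` divided by p!, once with the first and once with the last
  -- factor split off.
  β*H≈[β+p]*H : ∀ β p → β * H (β + 1#) p ≈ (β + ι p) * H β p
  β*H≈[β+p]*H β p = begin
    β * (1/ p ! * rise (β + 1#) p)      ≈⟨ solve 3 (λ b i r → b :* (i :* r) := i :* (b :* r)) refl _ _ _ ⟩
    1/ p ! * (β * rise (β + 1#) p)      ≈⟨ *-congˡ (rise-suc β p) ⟨
    1/ p ! * rise β (suc p)             ≈⟨ *-congˡ (rise-snoc β p) ⟩
    1/ p ! * (rise β p * (β + ι p))     ≈⟨ solve 3 (λ i r b → i :* (r :* b) := b :* (i :* r)) refl _ _ _ ⟩
    (β + ι p) * H β p                   ∎

-- Powers of 1 - z and the evenness of (1 + z²)^(-γ)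

module BinomialSeries {c ℓ} (R : CommutativeRing c ℓ) (inverses : InverseFactorials R) where
  open CommutativeRing R hiding (zero)
  open InverseFactorials inverses
  open DeterminantEvaluation R using (-1^)
  open RisingFactorials R inverses
  open PowerSeries R public
  private
    module R = IntegerSolver R
    module S = CommutativeRing series
  open IntegerSolver series
  open RingNotions series public using () renaming (_^_ to _^ₛ_)
  open import Algebra.Properties.Semiring.Exp S.semiring public using () renaming (^-homo-* to ^ₛ-+)
  open SetoidReasoning S.setoid

  -- Ȧ is the derivative of A.
  u A Ȧ : Series
  u = constant 1# S.- z
  A = z +ₛ z *ₛ z
  Ȧ = constant 1# +ₛ z +ₛ z

  h : Carrier → Series
  h β p = H β p

  h-cong : ∀ {β γ} → β ≈ γ → h β ≈ₛ h γ
  h-cong e = mk≈ₛ λ p → H-cong p e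

  u*f≈f-z*f : ∀ f → u *ₛ f ≈ₛ f S.- z *ₛ f
  u*f≈f-z*f f = solve 2 (λ z f → (con (+ 1) :- z) :* f := f :- z :* f) S.refl z f

  u*f-zero : ∀ f → (u *ₛ f) 0 ≈ f 0
  u*f-zero f = trans (at (u*f≈f-z*f f) 0) (trans (+-congˡ (-‿cong (z*-zero f)))
    (R.solve 1 (λ a → a R.:- R.con (+ 0) R.:= a) refl (f 0)))

  u*f-suc : ∀ f n → (u *ₛ f) (suc n) ≈ f (suc n) - f n
  u*f-suc f n = trans (at (u*f≈f-z*f f) (suc n)) (+-congˡ (-‿cong (z*-suc f n)))

  -- Multiplication by 1 - z takes differences of consecutive coefficients, and partial summation
  -- undoes it.
  u-regular : ∀ f g → u *ₛ f ≈ₛ u *ₛ g → f ≈ₛ g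
  u-regular f g e = mk≈ₛ go
    where
    go : ∀ n → f n ≈ g n
    go zero    = trans (sym (u*f-zero f)) (trans (at e 0) (u*f-zero g))
    go (suc n) = trans (split f) (trans (+-cong (at e (suc n)) (go n)) (sym (split g)))
      where
      split : ∀ f → f (suc n) ≈ (u *ₛ f) (suc n) + f n
      split f = trans (R.solve 2 (λ a b → a R.:= a R.:- b R.:+ b) refl (f (suc n)) (f n))
                      (+-congʳ (sym (u*f-suc f n)))

  -- Pascal's rule. It is what allows `h β` to be read as u^(-β).
  u*h : ∀ β → u *ₛ h (β + 1#) ≈ₛ h β
  u*h β = mk≈ₛ λ
    { zero    → trans (u*f-zero (h (β + 1#))) (trans (H-zero (β + 1#)) (sym (H-zero β)))
    ; (suc n) → trans (u*f-suc (h (β + 1#)) n) (trans (+-congʳ (H-pascal β n))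
        (R.solve 2 (λ a b → a R.:+ b R.:- a R.:= b) refl (H (β + 1#) n) (H β (suc n)))) }

  u^*h : ∀ β n → u ^ₛ n *ₛ h (β + ι n) ≈ₛ h β
  u^*h β zero    = S.trans (S.*-identityˡ _) (h-cong (+-identityʳ β))
  u^*h β (suc n) = begin
    u *ₛ u ^ₛ n *ₛ h (β + (1# + ι n))
      ≈⟨ S.*-congˡ (h-cong (R.solve 2 (λ b n → b R.:+ (R.con (+ 1) R.:+ n) R.:= b R.:+ n R.:+ R.con (+ 1)) refl
           β (ι n))) ⟩
    u *ₛ u ^ₛ n *ₛ h (β + ι n + 1#)
      ≈⟨ solve 3 (λ u v h → u :* v :* h := v :* (u :* h)) S.refl u (u ^ₛ n) _ ⟩
    u ^ₛ n *ₛ (u *ₛ h (β + ι n + 1#))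
      ≈⟨ S.*-congˡ (u*h (β + ι n)) ⟩
    u ^ₛ n *ₛ h (β + ι n)
      ≈⟨ u^*h β n ⟩
    h β
      ∎

  A*f≈ : ∀ f → A *ₛ f ≈ₛ z *ₛ f +ₛ z *ₛ (z *ₛ f)
  A*f≈ f = solve 2 (λ z f → (z :+ z :* z) :* f := z :* f :+ z :* (z :* f)) S.refl z f

  A*f-zero : ∀ f → (A *ₛ f) 0 ≈ 0#
  A*f-zero f = trans (at (A*f≈ f) 0) (trans (+-cong (z*-zero f) (z*-zero (z *ₛ f))) (+-identityˡ 0#))

  A*f-suc : ∀ f n → (A *ₛ f) (suc n) ≈ f n + (z *ₛ f) n
  A*f-suc f n = trans (at (A*f≈ f) (suc n)) (+-cong (z*-suc f n) (z*-suc (z *ₛ f) n))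

  A^*-low : ∀ k f n → n < k → (A ^ₛ k *ₛ f) n ≈ 0#
  z*A^*-low : ∀ k f n → n ≤ k → (z *ₛ (A ^ₛ k *ₛ f)) n ≈ 0#
  A^*-low (suc k) f zero    _         = trans (at (S.*-assoc A (A ^ₛ k) f) 0) (A*f-zero (A ^ₛ k *ₛ f))
  A^*-low (suc k) f (suc n) (s<s n<k) = trans (at (S.*-assoc A (A ^ₛ k) f) (suc n))
    (trans (A*f-suc (A ^ₛ k *ₛ f) n) (trans (+-cong (A^*-low k f n n<k) (z*A^*-low k f n (ℕ.<⇒≤ n<k)))
        (+-identityˡ 0#)))
  z*A^*-low k f zero    _   = z*-zero (A ^ₛ k *ₛ f)
  z*A^*-low k f (suc n) n≤k = trans (z*-suc (A ^ₛ k *ₛ f) n) (A^*-low k f n n≤k)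

  A^*-leading : ∀ k f → (A ^ₛ k *ₛ f) k ≈ f 0
  A^*-leading zero    f = at (S.*-identityˡ f) 0
  A^*-leading (suc k) f = trans (at (S.*-assoc A (A ^ₛ k) f) (suc k)) (trans (A*f-suc (A ^ₛ k *ₛ f) k)
    (trans (+-cong (A^*-leading k f) (z*A^*-low k f k ℕ.≤-refl)) (+-identityʳ (f 0))))

  D : Series → Series
  D f n = ι (suc n) * f (suc n)

  D-cong : ∀ {f g} → f ≈ₛ g → D f ≈ₛ D g
  D-cong e = mk≈ₛ λ n → *-congˡ (at e (suc n))

  D-+ : ∀ f g → D (f +ₛ g) ≈ₛ D f +ₛ D g
  D-+ f g = mk≈ₛ λ n → distribˡ _ _ _

  D-constant* : ∀ a f → D (constant a *ₛ f) ≈ₛ constant a *ₛ D f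
  D-constant* a f = mk≈ₛ λ n → trans (*-congˡ (constant-* a f (suc n)))
    (trans (R.solve 3 (λ n a f → n R.:* (a R.:* f) R.:= a R.:* (n R.:* f)) refl (ι (suc n)) a (f (suc n)))
      (sym (constant-* a (D f) n)))

  D-z* : ∀ f → D (z *ₛ f) ≈ₛ f +ₛ z *ₛ D f
  D-z* f = mk≈ₛ λ
    { zero    → trans (*-congˡ (z*-suc f 0)) (trans
        (R.solve 1 (λ a → (R.con (+ 1) R.:+ R.con (+ 0)) R.:* a R.:= a R.:+ R.con (+ 0)) refl (f 0))
            (+-congˡ (sym (z*-zero (D f)))))
    ; (suc n) → trans (*-congˡ (z*-suc f (suc n))) (trans
        (R.solve 2 (λ a n → (R.con (+ 1) R.:+ n) R.:* a R.:= a R.:+ n R.:* a) refl (f (suc n)) (ι (suc n)))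
        (+-congˡ (sym (z*-suc (D f) n)))) }

  D-A* : ∀ f → D (A *ₛ f) ≈ₛ Ȧ *ₛ f +ₛ A *ₛ D f
  D-A* f = begin
    D (A *ₛ f)                                               ≈⟨ D-cong (A*f≈ f) ⟩
    D (z *ₛ f +ₛ z *ₛ (z *ₛ f))                              ≈⟨ D-+ (z *ₛ f) (z *ₛ (z *ₛ f)) ⟩
    D (z *ₛ f) +ₛ D (z *ₛ (z *ₛ f))                          ≈⟨ S.+-cong (D-z* f)
        (S.trans (D-z* (z *ₛ f)) (S.+-congˡ (S.*-congˡ (D-z* f)))) ⟩
    (f +ₛ z *ₛ D f) +ₛ (z *ₛ f +ₛ z *ₛ (f +ₛ z *ₛ D f))      ≈⟨ solve 3 (λ z f d →
      (f :+ z :* d) :+ (z :* f :+ z :* (f :+ z :* d)) := (con (+ 1) :+ z :+ z) :* f :+ (z :+ z :* z) :* d)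
          S.refl z f (D f) ⟩
    Ȧ *ₛ f +ₛ A *ₛ D f                                       ∎

  D-A^* : ∀ k f → D (A ^ₛ suc k *ₛ f) ≈ₛ constant (ι (suc k)) *ₛ (Ȧ *ₛ (A ^ₛ k *ₛ f)) +ₛ A ^ₛ suc k *ₛ D f
  D-A^* k f = begin
    D (A *ₛ A ^ₛ k *ₛ f)
      ≈⟨ D-cong (S.*-assoc A (A ^ₛ k) f) ⟩
    D (A *ₛ (A ^ₛ k *ₛ f))
      ≈⟨ D-A* (A ^ₛ k *ₛ f) ⟩
    Ȧ *ₛ (A ^ₛ k *ₛ f) +ₛ A *ₛ D (A ^ₛ k *ₛ f)
      ≈⟨ rest k ⟩
    constant (ι (suc k)) *ₛ (Ȧ *ₛ (A ^ₛ k *ₛ f)) +ₛ A *ₛ A ^ₛ k *ₛ D f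
      ∎
    where
    rest : ∀ k → Ȧ *ₛ (A ^ₛ k *ₛ f) +ₛ A *ₛ D (A ^ₛ k *ₛ f)
      ≈ₛ constant (ι (suc k)) *ₛ (Ȧ *ₛ (A ^ₛ k *ₛ f)) +ₛ A *ₛ A ^ₛ k *ₛ D f
    rest zero    = begin
      Ȧ *ₛ (constant 1# *ₛ f) +ₛ A *ₛ D (constant 1# *ₛ f)
        ≈⟨ S.+-congˡ (S.*-congˡ (D-cong (S.*-identityˡ f))) ⟩
      Ȧ *ₛ (constant 1# *ₛ f) +ₛ A *ₛ D f
        ≈⟨ solve 4 (λ a b f d → a :* (con (+ 1) :* f) :+ b :* d
             := con (+ 1) :* (a :* (con (+ 1) :* f)) :+ b :* con (+ 1) :* d) S.refl Ȧ A f (D f) ⟩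
      constant 1# *ₛ (Ȧ *ₛ (constant 1# *ₛ f)) +ₛ A *ₛ constant 1# *ₛ D f
        ≈⟨ S.+-congʳ (S.*-congʳ (constant-cong (+-identityʳ 1#))) ⟨
      constant (ι 1) *ₛ (Ȧ *ₛ (constant 1# *ₛ f)) +ₛ A *ₛ constant 1# *ₛ D f
        ∎
    rest (suc k) = begin
      Ȧ *ₛ (A *ₛ A ^ₛ k *ₛ f) +ₛ A *ₛ D (A ^ₛ suc k *ₛ f)
        ≈⟨ S.+-congˡ (S.*-congˡ (D-A^* k f)) ⟩
      Ȧ *ₛ (A *ₛ A ^ₛ k *ₛ f) +ₛ A *ₛ (constant (ι (suc k)) *ₛ (Ȧ *ₛ (A ^ₛ k *ₛ f)) +ₛ A *ₛ A ^ₛ k *ₛ D f)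
        ≈⟨ solve 6 (λ e a p f n d → e :* (a :* p :* f) :+ a :* (n :* (e :* (p :* f)) :+ a :* p :* d)
             := (con (+ 1) :+ n) :* (e :* (a :* p :* f)) :+ a :* (a :* p) :* d) S.refl
             Ȧ A (A ^ₛ k) f (constant (ι (suc k))) (D f) ⟩
      (constant 1# +ₛ constant (ι (suc k))) *ₛ (Ȧ *ₛ (A *ₛ A ^ₛ k *ₛ f)) +ₛ A *ₛ (A *ₛ A ^ₛ k) *ₛ D f
        ≈⟨ S.+-congʳ (S.*-congʳ (constant-+ 1# (ι (suc k)))) ⟨
      constant (ι (suc (suc k))) *ₛ (Ȧ *ₛ (A *ₛ A ^ₛ k *ₛ f)) +ₛ A *ₛ (A *ₛ A ^ₛ k) *ₛ D f
        ∎

  D-h : ∀ β → D (h β) ≈ₛ constant β *ₛ h (β + 1#)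
  D-h β = mk≈ₛ λ n → trans (ι-suc*H β n) (sym (constant-* β (h (β + 1#)) n))

  -- The k-th term in the expansion of (u + A)^(-γ) by powers of A. Because u + A = 1 + z², the full
  -- sum is even, although this cannot be seen term by term.
  term : ℕ → Carrier → Series
  term k γ = constant (-1^ k * H γ k) *ₛ (A ^ₛ k *ₛ h (γ + ι k))

  partialSum : ℕ → Carrier → Series
  partialSum zero    γ = 0ₛ
  partialSum (suc k) γ = partialSum k γ +ₛ term k γ

  D-term-zero : ∀ γ → D (term 0 γ) ≈ₛ constant γ *ₛ term 0 (γ + 1#)
  D-term-zero γ = begin
    D (constant (1# * H γ 0) *ₛ (constant 1# *ₛ h (γ + 0#)))
      ≈⟨ D-cong (S.*-cong (constant-cong (*-congˡ (trans (H-zero γ) (sym (H-zero (γ + 1#))))))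
           (S.trans (S.*-identityˡ _) (h-cong (+-identityʳ γ)))) ⟩
    D (constant (1# * H (γ + 1#) 0) *ₛ h γ)
      ≈⟨ S.trans (D-constant* _ (h γ)) (S.*-congˡ (D-h γ)) ⟩
    constant (1# * H (γ + 1#) 0) *ₛ (constant γ *ₛ h (γ + 1#))
      ≈⟨ solve 3 (λ a b h → a :* (b :* h) := b :* (a :* (con (+ 1) :* h))) S.refl _ (constant γ) (h (γ + 1#)) ⟩
    constant γ *ₛ (constant (1# * H (γ + 1#) 0) *ₛ (constant 1# *ₛ h (γ + 1#)))
      ≈⟨ S.*-congˡ (S.*-congˡ (S.*-congˡ (h-cong (sym (+-identityʳ (γ + 1#)))))) ⟩
    constant γ *ₛ term 0 (γ + 1#)
      ∎

  -- Differentiating the power of `A` lowers k by one, differentiating the power of `u` keeps k. In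
  -- both cases the coefficient turns into γ times the one that belongs to γ + 1, with a change of
  -- sign in the first case.
  D-term-suc : ∀ k γ → D (term (suc k) γ)
    ≈ₛ constant γ *ₛ term (suc k) (γ + 1#) S.- constant γ *ₛ (Ȧ *ₛ term k (γ + 1#))
  D-term-suc k γ = begin
    D (constant c′ *ₛ (A ^ₛ suc k *ₛ h (γ + ι (suc k))))
      ≈⟨ S.trans (D-constant* c′ _) (S.*-congˡ (D-A^* k (h (γ + ι (suc k))))) ⟩
    constant c′ *ₛ (constant (ι (suc k)) *ₛ (Ȧ *ₛ (A ^ₛ k *ₛ h (γ + ι (suc k)))) +ₛ A ^ₛ suc k *ₛ D
        (h (γ + ι (suc k))))
      ≈⟨ S.*-congˡ (S.+-cong (S.*-congˡ (S.*-congˡ (S.*-congˡ (h-cong γ+1+k))))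
           (S.*-congˡ (S.trans (D-h (γ + ι (suc k))) (S.*-congˡ (h-cong γ+1+k′))))) ⟩
    constant c′ *ₛ (constant (ι (suc k)) *ₛ (Ȧ *ₛ (A ^ₛ k *ₛ h (γ + 1# + ι k)))
      +ₛ A ^ₛ suc k *ₛ (constant (γ + ι (suc k)) *ₛ h (γ + 1# + ι (suc k))))
      ≈⟨ solve 8 (λ c n e p f q g d → c :* (n :* (e :* (p :* f)) :+ q :* (g :* d))
           := (c :* g) :* (q :* d) :+ (c :* n) :* (e :* (p :* f))) S.refl
           (constant c′) (constant (ι (suc k))) Ȧ (A ^ₛ k) (h (γ + 1# + ι k)) (A ^ₛ suc k)
           (constant (γ + ι (suc k))) (h (γ + 1# + ι (suc k))) ⟩
    (constant c′ *ₛ constant (γ + ι (suc k))) *ₛ (A ^ₛ suc k *ₛ h (γ + 1# + ι (suc k)))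
      +ₛ (constant c′ *ₛ constant (ι (suc k))) *ₛ (Ȧ *ₛ (A ^ₛ k *ₛ h (γ + 1# + ι k)))
      ≈⟨ S.+-cong (S.*-congʳ coefficient₁) (S.*-congʳ coefficient₂) ⟩
    (constant γ *ₛ constant (-1^ (suc k) * H (γ + 1#) (suc k))) *ₛ (A ^ₛ suc k *ₛ h (γ + 1# + ι (suc k)))
      +ₛ (-ₛ (constant γ *ₛ constant (-1^ k * H (γ + 1#) k))) *ₛ (Ȧ *ₛ (A ^ₛ k *ₛ h (γ + 1# + ι k)))
      ≈⟨ solve 6 (λ g a q b e p → (g :* a) :* q :+ (:- (g :* b)) :* (e :* p)
           := g :* (a :* q) :- g :* (e :* (b :* p))) S.refl (constant γ)
           (constant (-1^ (suc k) * H (γ + 1#) (suc k))) (A ^ₛ suc k *ₛ h (γ + 1# + ι (suc k)))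
           (constant (-1^ k * H (γ + 1#) k)) Ȧ (A ^ₛ k *ₛ h (γ + 1# + ι k)) ⟩
    constant γ *ₛ term (suc k) (γ + 1#) S.- constant γ *ₛ (Ȧ *ₛ term k (γ + 1#))
      ∎
    where
    c′ : Carrier
    c′ = -1^ (suc k) * H γ (suc k)
    γ+1+k : γ + ι (suc k) ≈ γ + 1# + ι k
    γ+1+k = sym (+-assoc γ 1# (ι k))
    γ+1+k′ : γ + ι (suc k) + 1# ≈ γ + 1# + ι (suc k)
    γ+1+k′ = R.solve 2 (λ g n → g R.:+ n R.:+ R.con (+ 1) R.:= g R.:+ R.con (+ 1) R.:+ n) refl γ (ι (suc k))
    coefficient₁ : constant c′ *ₛ constant (γ + ι (suc k)) ≈ₛ constant γ *ₛ constant
        (-1^ (suc k) * H (γ + 1#) (suc k))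
    coefficient₁ = S.trans (S.sym (constant-*-homo c′ (γ + ι (suc k)))) (S.trans (constant-cong
      (trans (R.solve 3 (λ s h g → s R.:* h R.:* g R.:= s R.:* (g R.:* h)) refl (-1^ (suc k)) (H γ (suc k))
          (γ + ι (suc k)))
        (trans (*-congˡ (sym (β*H≈[β+p]*H γ (suc k))))
          (R.solve 3 (λ s g h → s R.:* (g R.:* h) R.:= g R.:* (s R.:* h)) refl (-1^ (suc k)) γ
              (H (γ + 1#) (suc k))))))
      (constant-*-homo γ _))
    coefficient₂ : constant c′ *ₛ constant (ι (suc k)) ≈ₛ -ₛ (constant γ *ₛ constant (-1^ k * H (γ + 1#) k))
    coefficient₂ = S.trans (S.sym (constant-*-homo c′ (ι (suc k)))) (S.trans (constant-cong
      (trans (R.solve 3 (λ s h n → R.:- R.con (+ 1) R.:* s R.:* h R.:* n R.:= R.:- (s R.:* (n R.:* h))) refl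
          (-1^ k) (H γ (suc k)) (ι (suc k)))
        (trans (-‿cong (*-congˡ (ι-suc*H γ k)))
          (R.solve 3 (λ s g h → R.:- (s R.:* (g R.:* h)) R.:= R.:- (g R.:* (s R.:* h))) refl (-1^ k) γ
              (H (γ + 1#) k)))))
      (S.trans (constant-neg _) (S.-‿cong (constant-*-homo γ _))))

  -- The truncated form of the fact that (1 + z²)^(-γ) has the derivative -2 γ z (1 + z²)^(-γ-1). As
  -- Ȧ = 1 + 2z, the right-hand side is -2 γ z times the sum for γ + 1, up to one boundary term.
  D-partialSum : ∀ k γ → D (partialSum (suc k) γ)
    ≈ₛ constant γ *ₛ partialSum (suc k) (γ + 1#) S.- constant γ *ₛ (Ȧ *ₛ partialSum k (γ + 1#))
  D-partialSum zero    γ = begin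
    D (0ₛ +ₛ term 0 γ)
      ≈⟨ D-cong (S.+-identityˡ (term 0 γ)) ⟩
    D (term 0 γ)
      ≈⟨ D-term-zero γ ⟩
    constant γ *ₛ term 0 (γ + 1#)
      ≈⟨ solve 3 (λ g e t → g :* t := g :* (con (+ 0) :+ t) :- g :* (e :* con (+ 0))) S.refl (constant γ) Ȧ
           (term 0 (γ + 1#)) ⟩
    constant γ *ₛ partialSum 1 (γ + 1#) S.- constant γ *ₛ (Ȧ *ₛ 0ₛ)
      ∎
  D-partialSum (suc k) γ = begin
    D (partialSum (suc k) γ +ₛ term (suc k) γ)
      ≈⟨ S.trans (D-+ (partialSum (suc k) γ) (term (suc k) γ)) (S.+-cong (D-partialSum k γ) (D-term-suc k γ)) ⟩
    (constant γ *ₛ partialSum (suc k) (γ + 1#) S.- constant γ *ₛ (Ȧ *ₛ partialSum k (γ + 1#)))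
      +ₛ (constant γ *ₛ term (suc k) (γ + 1#) S.- constant γ *ₛ (Ȧ *ₛ term k (γ + 1#)))
      ≈⟨ solve 6 (λ g e p q s t → (g :* p :- g :* (e :* q)) :+ (g :* s :- g :* (e :* t))
           := g :* (p :+ s) :- g :* (e :* (q :+ t))) S.refl (constant γ) Ȧ
           (partialSum (suc k) (γ + 1#)) (partialSum k (γ + 1#)) (term (suc k) (γ + 1#)) (term k (γ + 1#)) ⟩
    constant γ *ₛ partialSum (suc (suc k)) (γ + 1#) S.- constant γ *ₛ (Ȧ *ₛ partialSum (suc k) (γ + 1#))
      ∎

  term-low : ∀ k γ n → n < k → term k γ n ≈ 0#
  term-low k γ n n<k = trans (constant-* _ (A ^ₛ k *ₛ h (γ + ι k)) n)
    (trans (*-congˡ (A^*-low k (h (γ + ι k)) n n<k)) (zeroʳ _))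

  partialSum-0 : ∀ k γ → partialSum (suc k) γ 0 ≈ 1#
  partialSum-0 zero    γ = trans (+-identityˡ _) (trans (constant-* _ (constant 1# *ₛ h (γ + 0#)) 0)
    (trans (*-cong (trans (*-identityˡ _) (H-zero γ)) (trans (*-identityˡ _) (H-zero (γ + 0#)))) (*-identityˡ 1#)))
  partialSum-0 (suc k) γ = trans (+-cong (partialSum-0 k γ) (term-low (suc k) γ 0 z<s)) (+-identityʳ 1#)

  -- partialSum k γ agrees with (1 + z²)^(-γ) up to terms of order k.
  partialSum-odd : ∀ r k γ → suc (r ℕ.* 2) < k → partialSum k γ (suc (r ℕ.* 2)) ≈ 0#
  partialSum-odd r (suc k) γ (s<s 2r<k) = ι-suc-regular (r ℕ.* 2) _ _ (trans (at D-even (r ℕ.* 2)) (trans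
    (+-cong (trans (constant-* γ (term k (γ + 1#)) (r ℕ.* 2))
        (trans (*-congˡ (term-low k (γ + 1#) (r ℕ.* 2) 2r<k)) (zeroʳ γ)))
      (-‿cong (trans (constant-* γ _ (r ℕ.* 2)) (trans
          (*-congˡ (trans (+-cong (lower r 2r<k) (lower r 2r<k)) (+-identityˡ 0#))) (zeroʳ γ)))))
    (R.solve 1 (λ a → R.con (+ 0) R.:- R.con (+ 0) R.:= a R.:* R.con (+ 0)) refl (ι (suc (r ℕ.* 2))))))
    where
    P : Series
    P = partialSum k (γ + 1#)
    -- Coefficient 2r of the derivative decides coefficient 2r + 1. The boundary term starts only at
    -- z^k, where k > 2r, and z P draws on coefficient 2r - 1 of P, again an odd one; so induction
    -- applies with γ + 1 in place of γ.
    D-even : D (partialSum (suc k) γ) ≈ₛ constant γ *ₛ term k (γ + 1#) S.- constant γ *ₛ (z *ₛ P +ₛ z *ₛ P)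
    D-even = S.trans (D-partialSum k γ) (solve 4 (λ g p t z → g :* (p :+ t) :- g :* ((con (+ 1) :+ z :+ z) :* p)
      := g :* t :- g :* (z :* p :+ z :* p)) S.refl (constant γ) P (term k (γ + 1#)) z)
    lower : ∀ r → r ℕ.* 2 < k → (z *ₛ P) (r ℕ.* 2) ≈ 0#
    lower zero    _  = z*-zero P
    lower (suc r) lt = trans (z*-suc P (suc (r ℕ.* 2))) (partialSum-odd r k (γ + 1#) (ℕ.<-trans (ℕ.n<1+n _) lt))

-- From odd coefficients to binomial coefficients: change of basis

module DeterminantTransformation {c ℓ} (R : CommutativeRing c ℓ) (inverses : InverseFactorials R)
  (b : CommutativeRing.Carrier R) where
  open CommutativeRing R hiding (zero)
  open RingNotions R using (_^_)
  open DeterminantEvaluation R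
  open RisingFactorials R inverses
  open BinomialSeries R inverses
  private
    module R = IntegerSolver R
    module S = CommutativeRing series
  open IntegerSolver series
  open Fold S.+-commutativeMonoid using () renaming
    ( fold< to ∑ₛ<; fold<-cong′ to ∑ₛ<-cong′; fold<-∙ to ∑ₛ<-+
    ; fold<-ε to ∑ₛ<-0; fold<-snoc to ∑ₛ<-snoc )
  open import Algebra.Properties.Semiring.Sum S.semiring using (*-distribˡ-sum)
  open SetoidReasoning S.setoid

  at-∑ : ∀ n f N → ∑ₛ< n f N ≈ ∑< n λ k → f k N
  at-∑ zero    f N = refl
  at-∑ (suc n) f N = +-congˡ (at-∑ n (f ∘ suc) N)

  *-∑ₛ< : ∀ n a f → a *ₛ ∑ₛ< n f ≈ₛ ∑ₛ< n λ k → a *ₛ f k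
  *-∑ₛ< n a f = *-distribˡ-sum {n} a (f ∘ toℕ)

  T : ℕ → Series
  T k = A ^ₛ k *ₛ h (b + ι k)

  u*T-suc : ∀ k → u *ₛ T (suc k) ≈ₛ A *ₛ T k
  u*T-suc k = begin
    u *ₛ (A *ₛ A ^ₛ k *ₛ h (b + (1# + ι k)))
      ≈⟨ S.*-congˡ (S.*-congˡ (h-cong (R.solve 2 (λ b n → b R.:+ (R.con (+ 1) R.:+ n) R.:= b R.:+ n R.:+ R.con
           (+ 1)) refl b (ι k)))) ⟩
    u *ₛ (A *ₛ A ^ₛ k *ₛ h (b + ι k + 1#))
      ≈⟨ solve 4 (λ u a p h → u :* (a :* p :* h) := a :* (p :* (u :* h))) S.refl u A (A ^ₛ k) _ ⟩
    A *ₛ (A ^ₛ k *ₛ (u *ₛ h (b + ι k + 1#)))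
      ≈⟨ S.*-congˡ (S.*-congˡ (u*h (b + ι k))) ⟩
    A *ₛ T k
      ∎

  T-low : ∀ k n → n < k → T k n ≈ 0#
  T-low k n = A^*-low k (h (b + ι k)) n

  T-leading : ∀ k → T k k ≈ 1#
  T-leading k = trans (A^*-leading k (h (b + ι k))) (H-zero (b + ι k))

  -- The generating function of row i of D₂: with u = 1 - z it is
  -- u^(-b) ((2 / u)^i + u^i), where (2 / u)^i + u^i is a polynomial of degree i
  -- in 2 / u + u = 3 + A / u, and T k = u^(-b) (A / u)^k.
  G : ℕ → Series
  G i = constant (ι 2 ^ i) *ₛ h (b + ι i) +ₛ h (b - ι i)

  -- Since 2 / u and u have the product 2, v i = (2 / u)^i + u^i satisfies v (i + 2) = (2 / u + u) v
  -- (i + 1) - 2 v i. The identity is multiplied by `u`, so that σ enters as `A`.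
  G-recurrence : ∀ i → u *ₛ G (suc (suc i)) ≈ₛ A *ₛ G (suc i)
    +ₛ constant (ι 3) *ₛ (u *ₛ G (suc i)) S.- constant (ι 2) *ₛ (u *ₛ G i)
  G-recurrence i = begin
    u *ₛ (constant (ι 2 * (ι 2 * ι 2 ^ i)) *ₛ h (b + ι (2 ℕ.+ i)) +ₛ h (b - ι (2 ℕ.+ i)))
      ≈⟨ S.*-congˡ (S.+-cong (S.*-cong (S.trans (constant-*-homo (ι 2) _) (S.*-congˡ (constant-*-homo (ι 2) _)))
           (h-cong up₂))
           (S.trans (S.sym (u*h (b - ι (2 ℕ.+ i)))) (S.*-congˡ
               (S.trans (S.sym (u*h (b - ι (2 ℕ.+ i) + 1#))) (S.*-congˡ (h-cong down₂)))))) ⟩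
    u *ₛ (constant (ι 2) *ₛ (constant (ι 2) *ₛ constant (ι 2 ^ i)) *ₛ p +ₛ u *ₛ (u *ₛ q))
      ≈⟨ S.*-congˡ (S.+-congʳ (S.*-congʳ (S.*-cong constant-2 (S.*-congʳ constant-2)))) ⟩
    u *ₛ (two *ₛ (two *ₛ constant (ι 2 ^ i)) *ₛ p +ₛ u *ₛ (u *ₛ q))
      ≈⟨ solve 4 (λ z c p q → let u = con (+ 1) :- z ; a = z :+ z :* z ; g = con (+ 2) :* c :* (u :* p) :+ u :* q in
           u :* (con (+ 2) :* (con (+ 2) :* c) :* p :+ u :* (u :* q))
           := a :* g :+ con (+ 3) :* (u :* g) :- con (+ 2) :* (u :* (c :* (u :* (u :* p)) :+ q)))
           S.refl z (constant (ι 2 ^ i)) p q ⟩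
    A *ₛ G₁ +ₛ three *ₛ (u *ₛ G₁) S.- two *ₛ (u *ₛ (constant (ι 2 ^ i) *ₛ (u *ₛ (u *ₛ p)) +ₛ q))
      ≈⟨ S.+-cong (S.+-cong (S.*-congˡ G₁≈) (S.*-cong (S.sym constant-3) (S.*-congˡ G₁≈)))
           (S.-‿cong (S.*-cong (S.sym constant-2) (S.*-congˡ
               (S.+-congʳ (S.*-congˡ (S.trans (S.*-congˡ (u*h (b + ι i + 1#))) (u*h (b + ι i)))))))) ⟩
    A *ₛ G (suc i) +ₛ constant (ι 3) *ₛ (u *ₛ G (suc i)) S.- constant (ι 2) *ₛ (u *ₛ G i)
      ∎
    where
    two three p q G₁ : Series
    two   = RingNotions.ι series 2
    three = RingNotions.ι series 3
    p  = h (b + ι i + 1# + 1#)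
    q  = h (b - ι i)
    G₁ = two *ₛ constant (ι 2 ^ i) *ₛ (u *ₛ p) +ₛ u *ₛ q
    constant-ι : ∀ n → constant (ι n) ≈ₛ RingNotions.ι series n
    constant-ι zero    = mk≈ₛ λ { zero → refl ; (suc _) → refl }
    constant-ι (suc n) = S.trans (constant-+ 1# (ι n)) (S.+-congˡ (constant-ι n))
    constant-2 : constant (ι 2) ≈ₛ two
    constant-2 = constant-ι 2
    constant-3 : constant (ι 3) ≈ₛ three
    constant-3 = constant-ι 3
    up₂ : b + ι (2 ℕ.+ i) ≈ b + ι i + 1# + 1#
    up₂ = R.solve 2 (λ b n → b R.:+ (R.con (+ 1) R.:+ (R.con (+ 1) R.:+ n)) R.:= b R.:+ n R.:+ R.con (+ 1) R.:+
        R.con (+ 1)) refl b (ι i)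
    down₂ : b - ι (2 ℕ.+ i) + 1# + 1# ≈ b - ι i
    down₂ = R.solve 2 (λ b n → b R.:- (R.con (+ 1) R.:+ (R.con (+ 1) R.:+ n)) R.:+ R.con (+ 1) R.:+ R.con (+ 1)
        R.:= b R.:- n) refl b (ι i)
    G₁≈ : G₁ ≈ₛ G (suc i)
    G₁≈ = S.+-cong
      (S.*-cong (S.trans (S.*-congʳ (S.sym constant-2)) (S.sym (constant-*-homo (ι 2) (ι 2 ^ i))))
        (S.trans (u*h (b + ι i + 1#)) (h-cong (R.solve 2
            (λ b n → b R.:+ n R.:+ R.con (+ 1) R.:= b R.:+ (R.con (+ 1) R.:+ n)) refl b (ι i)))))
      (S.trans (S.*-congˡ (h-cong (R.solve 2 (λ b n → b R.:- n R.:= b R.:- (R.con (+ 1) R.:+ n) R.:+ R.con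
          (+ 1)) refl b (ι i)))) (u*h (b - ι (suc i))))

  shift : (ℕ → Carrier) → ℕ → Carrier
  shift f zero    = 0#
  shift f (suc k) = f k

  -- Row i lists the coefficients of v i = (2 / u)^i + u^i as a polynomial in σ: v 0 = 2, v 1 = 3 +
  -- σ, v (i + 2) = (3 + σ) v (i + 1) - 2 v i.
  C : Matrix
  C zero          zero          = ι 2
  C zero          (suc k)       = 0#
  C (suc zero)    zero          = ι 3
  C (suc zero)    (suc zero)    = 1#
  C (suc zero)    (suc (suc k)) = 0#
  C (suc (suc i)) k             = shift (C (suc i)) k + ι 3 * C (suc i) k - ι 2 * C i k

  C-upper : ∀ i k → i < k → C i k ≈ 0#
  C-upper zero          (suc k)       _ = refl
  C-upper (suc zero)    (suc (suc k)) _ = refl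
  C-upper (suc (suc i)) (suc k)       (s<s i<k) = trans
    (+-cong (+-cong (C-upper (suc i) k i<k) (*-congˡ (C-upper (suc i) (suc k) (ℕ.m<n⇒m<1+n i<k))))
            (-‿cong (*-congˡ (C-upper i (suc k) (ℕ.m<n⇒m<1+n (ℕ.<-trans (ℕ.n<1+n i) i<k))))))
    (R.solve 2 (λ x y → R.con (+ 0) R.:+ x R.:* R.con (+ 0) R.:- y R.:* R.con (+ 0) R.:= R.con (+ 0)) refl (ι 3)
        (ι 2))
  C-upper (suc zero)    (suc zero) (s<s ())

  C-diagonal : ∀ i → C (suc i) (suc i) ≈ 1#
  C-diagonal zero    = refl
  C-diagonal (suc i) = trans
    (+-cong (+-cong (C-diagonal i) (*-congˡ (C-upper (suc i) (suc (suc i)) (ℕ.n<1+n _))))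
            (-‿cong (*-congˡ (C-upper i (suc (suc i)) (ℕ.m<n⇒m<1+n (ℕ.n<1+n i))))))
    (R.solve 2 (λ x y → R.con (+ 1) R.:+ x R.:* R.con (+ 0) R.:- y R.:* R.con (+ 0) R.:= R.con (+ 1)) refl (ι 3)
        (ι 2))

  combination : ℕ → (ℕ → Carrier) → Series
  combination n c = ∑ₛ< n λ k → constant (c k) *ₛ T k

  combination-+ : ∀ n c d → combination n (λ k → c k + d k) ≈ₛ combination n c +ₛ combination n d
  combination-+ n c d = S.trans
    (∑ₛ<-cong′ n λ k → S.trans (S.*-congʳ (constant-+ (c k) (d k))) (S.distribʳ (T k) _ _))
    (∑ₛ<-+ n (λ k → constant (c k) *ₛ T k) (λ k → constant (d k) *ₛ T k))

  combination-* : ∀ n a c → combination n (λ k → a * c k) ≈ₛ constant a *ₛ combination n c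
  combination-* n a c = S.trans
    (∑ₛ<-cong′ n λ k → S.trans (S.*-congʳ (constant-*-homo a (c k))) (S.*-assoc _ _ (T k)))
    (S.sym (*-∑ₛ< n (constant a) (λ k → constant (c k) *ₛ T k)))

  combination-shift : ∀ n c → u *ₛ combination (suc n) (shift c) ≈ₛ A *ₛ combination n c
  combination-shift n c = begin
    u *ₛ (constant 0# *ₛ T 0 +ₛ ∑ₛ< n (λ k → constant (c k) *ₛ T (suc k)))
      ≈⟨ S.*-congˡ (S.trans (S.+-congʳ (mk≈ₛ λ m → trans (constant-* 0# (T 0) m) (zeroˡ _))) (S.+-identityˡ _)) ⟩
    u *ₛ ∑ₛ< n (λ k → constant (c k) *ₛ T (suc k))
      ≈⟨ *-∑ₛ< n u (λ k → constant (c k) *ₛ T (suc k)) ⟩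
    ∑ₛ< n (λ k → u *ₛ (constant (c k) *ₛ T (suc k)))
      ≈⟨ ∑ₛ<-cong′ n (λ k → S.trans (swap u (constant (c k)) (T (suc k)))
           (S.trans (S.*-congˡ (u*T-suc k)) (S.sym (swap A (constant (c k)) (T k))))) ⟩
    ∑ₛ< n (λ k → A *ₛ (constant (c k) *ₛ T k))
      ≈⟨ *-∑ₛ< n A (λ k → constant (c k) *ₛ T k) ⟨
    A *ₛ combination n c
      ∎
    where
    swap : ∀ f g k → f *ₛ (g *ₛ k) ≈ₛ g *ₛ (f *ₛ k)
    swap = solve 3 (λ f g k → f :* (g :* k) := g :* (f :* k)) S.refl

  -- Stated for every n > i rather than for one n, because multiplication by σ lengthens a
  -- combination by one. The induction runs along the recurrence, and the factor `u` is cancelled at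
  -- each step.
  G-expansion : ∀ i n → i < n → G i ≈ₛ combination n (C i)
  G-expansion zero (suc n) _ = begin
    constant 1# *ₛ h (b + 0#) +ₛ h (b - 0#)
      ≈⟨ S.+-congˡ (h-cong (R.solve 1 (λ b → b R.:- R.con (+ 0) R.:= b R.:+ R.con (+ 0)) refl b)) ⟩
    constant 1# *ₛ h (b + 0#) +ₛ h (b + 0#)
      ≈⟨ solve 1 (λ h → con (+ 1) :* h :+ h := (con (+ 1) :+ (con (+ 1) :+ con (+ 0))) :* (con (+ 1) :* h) :+
           con (+ 0)) S.refl (h (b + 0#)) ⟩
    (constant 1# +ₛ (constant 1# +ₛ 0ₛ)) *ₛ (constant 1# *ₛ h (b + 0#)) +ₛ 0ₛ
      ≈⟨ S.+-cong (S.*-congʳ (mk≈ₛ λ { zero → refl ; (suc _) → trans (+-identityˡ _) (+-identityˡ _) }))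
                  (S.sym (∑ₛ<-0 n λ k _ → mk≈ₛ λ m → trans (constant-* 0# (T (suc k)) m) (zeroˡ _))) ⟩
    combination (suc n) (C 0)
      ∎
  G-expansion (suc zero) (suc (suc n)) _ = begin
    constant (ι 2 * 1#) *ₛ h (b + ι 1) +ₛ h (b - ι 1)
      ≈⟨ S.+-cong (S.*-cong {y = constant 1# +ₛ constant 1#}
           (mk≈ₛ λ { zero → trans (*-identityʳ _) (+-congˡ (+-identityʳ 1#)) ; (suc _) → sym (+-identityˡ 0#) }) b+1)
           (S.trans (S.sym (u*h (b - ι 1))) (S.*-congˡ (S.trans
               (h-cong (R.solve 1 (λ b → b R.:- (R.con (+ 1) R.:+ R.con (+ 0)) R.:+ R.con (+ 1) R.:= b) refl b))
               (S.sym (u*h b))))) ⟩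
    (constant 1# +ₛ constant 1#) *ₛ p +ₛ u *ₛ (u *ₛ p)
      ≈⟨ solve 2 (λ z p → let u = con (+ 1) :- z in (con (+ 1) :+ con (+ 1)) :* p :+ u :* (u :* p)
           := (con (+ 1) :+ con (+ 1) :+ con (+ 1)) :* (con (+ 1) :* (u :* p)) :+
               (con (+ 1) :* ((z :+ z :* z) :* con (+ 1) :* p) :+ con (+ 0))) S.refl z p ⟩
    (constant 1# +ₛ constant 1# +ₛ constant 1#) *ₛ (constant 1# *ₛ (u *ₛ p)) +ₛ
        (constant 1# *ₛ (A *ₛ constant 1# *ₛ p) +ₛ 0ₛ)
      ≈⟨ S.+-cong (S.*-cong {y = constant (ι 3)} (mk≈ₛ
           λ { zero → R.solve 1 (λ a → a R.:+ a R.:+ a R.:= a R.:+ (a R.:+ (a R.:+ R.con (+ 0)))) refl 1# ;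
           (suc _) → trans (+-identityʳ _) (+-identityˡ 0#) })
             (S.*-congˡ (S.trans (u*h b) (h-cong (sym (+-identityʳ b))))))
           (S.+-cong (S.*-congˡ (S.*-congˡ (S.sym b+1)))
               (S.sym (∑ₛ<-0 n λ k _ → mk≈ₛ λ m → trans (constant-* 0# (T (suc (suc k))) m) (zeroˡ _)))) ⟩
    combination (suc (suc n)) (C 1)
      ∎
    where
    p : Series
    p = h (b + 1#)
    b+1 : h (b + ι 1) ≈ₛ p
    b+1 = h-cong (+-congˡ (+-identityʳ 1#))
  G-expansion (suc (suc i)) (suc n) (s<s i<n) = u-regular _ _ (begin
    u *ₛ G (suc (suc i))
      ≈⟨ G-recurrence i ⟩
    A *ₛ G (suc i) +ₛ constant (ι 3) *ₛ (u *ₛ G (suc i)) S.- constant (ι 2) *ₛ (u *ₛ G i)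
      ≈⟨ S.+-cong (S.+-cong (S.trans (S.*-congˡ (G-expansion (suc i) n i<n))
           (S.sym (combination-shift n (C (suc i)))))
           (S.*-congˡ (S.*-congˡ (G-expansion (suc i) (suc n) (ℕ.m<n⇒m<1+n i<n)))))
           (S.-‿cong (S.*-congˡ (S.*-congˡ (G-expansion i (suc n) (ℕ.m<n⇒m<1+n (ℕ.<-trans (ℕ.n<1+n i) i<n)))))) ⟩
    u *ₛ combination (suc n) (shift (C (suc i))) +ₛ constant (ι 3) *ₛ (u *ₛ combination (suc n) (C (suc i)))
      S.- constant (ι 2) *ₛ (u *ₛ combination (suc n) (C i))
      ≈⟨ solve 6 (λ u s x c y d → u :* s :+ x :* (u :* c) :- y :* (u :* d) := u :* (s :+ x :* c :+ (:- y) :* d))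
           S.refl
           u (combination (suc n) (shift (C (suc i)))) (constant (ι 3)) (combination (suc n) (C (suc i)))
               (constant (ι 2)) (combination (suc n) (C i)) ⟩
    u *ₛ (combination (suc n) (shift (C (suc i))) +ₛ constant (ι 3) *ₛ combination (suc n) (C (suc i))
      +ₛ (-ₛ constant (ι 2)) *ₛ combination (suc n) (C i))
      ≈⟨ S.*-congˡ (S.sym (S.trans (combination-+ (suc n) (λ k → shift (C (suc i)) k + ι 3 * C (suc i) k)
           (λ k → - (ι 2 * C i k)))
           (S.+-cong (S.trans (combination-+ (suc n) (shift (C (suc i))) (λ k → ι 3 * C (suc i) k))
               (S.+-congˡ (combination-* (suc n) (ι 3) (C (suc i)))))
             (S.trans (∑ₛ<-cong′ (suc n) λ k → S.*-congʳ {T k} (constant-cong (-‿distribˡ-* (ι 2) (C i k))))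
               (S.trans (combination-* (suc n) (- ι 2) (C i)) (S.*-congʳ (constant-neg (ι 2)))))))) ⟩
    u *ₛ combination (suc n) (C (suc (suc i)))
      ∎)
    where open import Algebra.Properties.Ring ring using (-‿distribˡ-*)
  G-expansion (suc zero) (suc zero) (s<s ())

  -- `C` is triangular, and `C 0 0` = 2, from v 0 = 1 + 1, is its only diagonal entry other than 1.
  -- This is where the leading 2 of both formulas comes from.
  det-G : ∀ n → det< (suc n) (λ i j → G i (suc (j ℕ.* 2)))
        ≈ ι 2 * det< (suc n) (λ i j → T i (suc (j ℕ.* 2)))
  det-G n = trans
    (det<-cong (suc n) {g = λ i j → ∑< (suc n) λ k → C i k * T k (suc (j ℕ.* 2))} λ i j i<n _ → trans
        (at (G-expansion i (suc n) i<n) (suc (j ℕ.* 2)))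
      (trans (at-∑ (suc n) (λ k → constant (C i k) *ₛ T k) (suc (j ℕ.* 2)))
          (∑<-cong′ (suc n) λ k → constant-* (C i k) (T k) (suc (j ℕ.* 2)))))
    (trans (det<-product (suc n) C (λ k j → T k (suc (j ℕ.* 2))))
      (*-congʳ (trans (det<-lower (suc n) C C-upper)
        (trans (*-congˡ (∏<-1 n λ i _ → C-diagonal i)) (*-identityʳ (ι 2))))))

  shiftBy : ℕ → (ℕ → Carrier) → ℕ → Carrier
  shiftBy zero    f = f
  shiftBy (suc n) f = shift (shiftBy n f)

  shiftBy-+ : ∀ n f k → shiftBy n f (n ℕ.+ k) ≡ f k
  shiftBy-+ zero    f k = ≡.refl
  shiftBy-+ (suc n) f k = shiftBy-+ n f k

  shiftBy-low : ∀ n f k → k < n → shiftBy n f k ≈ 0#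
  shiftBy-low (suc n) f zero    _         = refl
  shiftBy-low (suc n) f (suc k) (s<s k<n) = shiftBy-low n f k k<n

  -- The coefficients of the even function (1 + z²)^(-b - 4l) (z - z³)^2l in
  -- the basis T.
  E : Matrix
  E l = shiftBy (l ℕ.* 2) λ m → -1^ m * H (b + ι (l ℕ.* 2 ℕ.+ l ℕ.* 2)) m

  ∑ₛ<-shiftBy : ∀ n K c (f : ℕ → Series) →
    ∑ₛ< (n ℕ.+ K) (λ k → constant (shiftBy n c k) *ₛ f k) ≈ₛ ∑ₛ< K λ m → constant (c m) *ₛ f (n ℕ.+ m)
  ∑ₛ<-shiftBy zero    K c f = S.refl
  ∑ₛ<-shiftBy (suc n) K c f = S.trans
    (S.+-cong (mk≈ₛ λ m → trans (constant-* 0# (f 0) m) (zeroˡ _)) (∑ₛ<-shiftBy n K c (f ∘ suc))) (S.+-identityˡ _)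

  partialSum≈∑ : ∀ K γ → partialSum K γ ≈ₛ ∑ₛ< K λ m → term m γ
  partialSum≈∑ zero    γ = S.refl
  partialSum≈∑ (suc K) γ = S.trans (S.+-congʳ (partialSum≈∑ K γ)) (S.sym (∑ₛ<-snoc K λ m → term m γ))

  -- In T (2l + m) the power u^(-b-2l-m) is rewritten as u^(2l) u^(-b-4l-m). This pairs A^(2l) with
  -- u^(2l) and leaves the m-th term for the exponent b + 4l.
  E-series : ∀ l K → combination (l ℕ.* 2 ℕ.+ K) (E l)
           ≈ₛ (A *ₛ u) ^ₛ (l ℕ.* 2) *ₛ partialSum K (b + ι (l ℕ.* 2 ℕ.+ l ℕ.* 2))
  E-series l K = begin
    combination (L ℕ.+ K) (E l)
      ≈⟨ ∑ₛ<-shiftBy L K _ T ⟩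
    ∑ₛ< K (λ m → constant (-1^ m * H γ m) *ₛ T (L ℕ.+ m))
      ≈⟨ ∑ₛ<-cong′ K summand ⟩
    ∑ₛ< K (λ m → (A *ₛ u) ^ₛ L *ₛ term m γ)
      ≈⟨ *-∑ₛ< K ((A *ₛ u) ^ₛ L) (λ m → term m γ) ⟨
    (A *ₛ u) ^ₛ L *ₛ ∑ₛ< K (λ m → term m γ)
      ≈⟨ S.*-congˡ (partialSum≈∑ K γ) ⟨
    (A *ₛ u) ^ₛ L *ₛ partialSum K γ
      ∎
    where
    open import Algebra.Properties.CommutativeSemiring.Exp S.commutativeSemiring using (^-distrib-*)
    L : ℕ
    L = l ℕ.* 2
    γ : Carrier
    γ = b + ι (L ℕ.+ L)
    summand : ∀ m → constant (-1^ m * H γ m) *ₛ T (L ℕ.+ m) ≈ₛ (A *ₛ u) ^ₛ L *ₛ term m γ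
    summand m = begin
      a *ₛ (A ^ₛ (L ℕ.+ m) *ₛ h (b + ι (L ℕ.+ m)))
        ≈⟨ S.*-congˡ (S.*-cong (^ₛ-+ A L m) (S.trans (S.sym (u^*h (b + ι (L ℕ.+ m)) L)) (S.*-congˡ (h-cong γ+m)))) ⟩
      a *ₛ (A ^ₛ L *ₛ A ^ₛ m *ₛ (u ^ₛ L *ₛ h (γ + ι m)))
        ≈⟨ solve 5 (λ a p q r h → a :* (p :* q :* (r :* h)) := p :* r :* (a :* (q :* h))) S.refl a (A ^ₛ L)
             (A ^ₛ m) (u ^ₛ L) (h (γ + ι m)) ⟩
      A ^ₛ L *ₛ u ^ₛ L *ₛ term m γ
        ≈⟨ S.*-congʳ (^-distrib-* A u L) ⟨
      (A *ₛ u) ^ₛ L *ₛ term m γ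
        ∎
      where
      a : Series
      a = constant (-1^ m * H γ m)
      γ+m : b + ι (L ℕ.+ m) + ι L ≈ γ + ι m
      γ+m = trans (+-congʳ (+-congˡ (ι-+ L m))) (trans
        (R.solve 3 (λ b l m → b R.:+ (l R.:+ m) R.:+ l R.:= b R.:+ (l R.:+ l) R.:+ m) refl b (ι L) (ι m))
        (+-congʳ (+-congˡ (sym (ι-+ L L)))))

  -- What `det<-strip` asks of one even series. The bound on `odd` is needed because the
  -- combinations are truncated: the terms left out start at z^(2l+K).
  record Peak (l K : ℕ) (f : Series) : Set ℓ where
    field
      low : ∀ c → c < l ℕ.* 2 → f c ≈ 0#
      one : f (l ℕ.* 2) ≈ 1#
      odd : ∀ r → suc (r ℕ.* 2) < l ℕ.* 2 ℕ.+ K → f (suc (r ℕ.* 2)) ≈ 0#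
  open Peak

  Peak-resp : ∀ {l K f g} → f ≈ₛ g → Peak l K f → Peak l K g
  Peak-resp e p = record
    { low = λ c lt → trans (sym (at e c)) (low p c lt)
    ; one = trans (sym (at e _)) (one p)
    ; odd = λ r lt → trans (sym (at e _)) (odd p r lt)
    }

  -- Multiplication by 1 - z². As (A u)² = z² (1 - z²)², a step from l to l + 1 consists of `w`
  -- twice, which leaves the leading term in place, and of z², which moves it.
  w : Series → Series
  w f = f S.- z *ₛ (z *ₛ f)

  z²*-suc : ∀ f n → (z *ₛ (z *ₛ f)) (suc (suc n)) ≈ f n
  z²*-suc f n = trans (z*-suc (z *ₛ f) (suc n)) (z*-suc f n)

  z²*-one : ∀ f → (z *ₛ (z *ₛ f)) 1 ≈ 0#
  z²*-one f = trans (z*-suc (z *ₛ f) 0) (z*-zero f)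

  a-0≈a : ∀ {a c} → c ≈ 0# → a - c ≈ a
  a-0≈a {a} {c} e = trans (+-congˡ (-‿cong e)) (R.solve 1 (λ a → a R.:- R.con (+ 0) R.:= a) refl a)

  Peak-w : ∀ {l K f} → Peak l K f → Peak l K (w f)
  Peak-w {l} {K} {f} p = record { low = low′ ; one = one′ l p ; odd = odd′ }
    where
    low′ : ∀ c → c < l ℕ.* 2 → w f c ≈ 0#
    low′ zero          lt = trans (a-0≈a (z*-zero (z *ₛ f))) (low p 0 lt)
    low′ (suc zero)    lt = trans (a-0≈a (z²*-one f)) (low p 1 lt)
    low′ (suc (suc c)) lt = trans (a-0≈a (trans (z²*-suc f c)
        (low p c (ℕ.<-trans (ℕ.m<n⇒m<1+n (ℕ.n<1+n c)) lt)))) (low p (suc (suc c)) lt)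
    one′ : ∀ l → Peak l K f → w f (l ℕ.* 2) ≈ 1#
    one′ zero    p = trans (a-0≈a (z*-zero (z *ₛ f))) (one p)
    one′ (suc l) p = trans (a-0≈a (trans (z²*-suc f (l ℕ.* 2)) (low p (l ℕ.* 2) (ℕ.m<n⇒m<1+n (ℕ.n<1+n _))))) (one p)
    odd′ : ∀ r → suc (r ℕ.* 2) < l ℕ.* 2 ℕ.+ K → w f (suc (r ℕ.* 2)) ≈ 0#
    odd′ zero    lt = trans (a-0≈a (z²*-one f)) (odd p 0 lt)
    odd′ (suc r) lt = trans (a-0≈a (trans (z²*-suc f (suc (r ℕ.* 2)))
      (odd p r (ℕ.<-trans (ℕ.m<n⇒m<1+n (ℕ.n<1+n _)) lt)))) (odd p (suc r) lt)

  Peak-z² : ∀ {l K f} → Peak l K f → Peak (suc l) K (z *ₛ (z *ₛ f))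
  Peak-z² {l} {K} {f} p = record
    { low = λ
      { zero          _              → z*-zero (z *ₛ f)
      ; (suc zero)    _              → z²*-one f
      ; (suc (suc c)) (s<s (s<s lt)) → trans (z²*-suc f c) (low p c lt) }
    ; one = trans (z²*-suc f (l ℕ.* 2)) (one p)
    ; odd = λ
      { zero    _              → z²*-one f
      ; (suc r) (s<s (s<s lt)) → trans (z²*-suc f (suc (r ℕ.* 2))) (odd p r lt) }
    }

  Peak-[Au]^ : ∀ l K f → Peak 0 K f → Peak l K ((A *ₛ u) ^ₛ (l ℕ.* 2) *ₛ f)
  Peak-[Au]^ zero    K f p = Peak-resp (S.sym (S.*-identityˡ f)) p
  Peak-[Au]^ (suc l) K f p = Peak-resp
    (solve 3 (λ z q f → let a = z :+ z :* z ; u = con (+ 1) :- z ; w = λ f → f :- z :* (z :* f) in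
      z :* (z :* w (w (q :* f))) := (a :* u) :* ((a :* u) :* q) :* f) S.refl z ((A *ₛ u) ^ₛ (l ℕ.* 2)) f)
    (Peak-z² (Peak-w (Peak-w (Peak-[Au]^ l K f p))))

  Peak-E : ∀ l K → Peak l (suc K) (combination (l ℕ.* 2 ℕ.+ suc K) (E l))
  Peak-E l K = Peak-resp (S.sym (E-series l (suc K))) (Peak-[Au]^ l (suc K) _ record
    { low = λ c ()
    ; one = partialSum-0 K γ
    ; odd = λ r lt → partialSum-odd r (suc K) γ lt
    })
    where
    γ : Carrier
    γ = b + ι (l ℕ.* 2 ℕ.+ l ℕ.* 2)

  n*2≡n+n : ∀ n → n ℕ.* 2 ≡ n ℕ.+ n
  n*2≡n+n n = ≡.trans (ℕ.*-comm n 2) (≡.cong (n ℕ.+_) (ℕ.+-identityʳ n))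

  Peak-even : ∀ n l → l < n → ∃ λ K → l ℕ.* 2 ℕ.+ K ≡ n ℕ.* 2 × Peak l K (combination (n ℕ.+ n) (E l))
  Peak-even n l l<n with ℕ.m≤n⇒∃[o]m+o≡n (ℕ.*-monoˡ-< 2 l<n)
  ... | K , eq = suc K , eq′ , ≡.subst (λ N → Peak l (suc K) (combination N (E l))) (≡.trans eq′ (n*2≡n+n n))
      (Peak-E l K)
    where
    eq′ : l ℕ.* 2 ℕ.+ suc K ≡ n ℕ.* 2
    eq′ = ≡.trans (ℕ.+-suc (l ℕ.* 2) K) eq

  at-combination : ∀ n c N → combination n c N ≈ ∑< n λ k → c k * T k N
  at-combination n c N = trans (at-∑ n (λ k → constant (c k) *ₛ T k) N) (∑<-cong′ n λ k → constant-* (c k) (T k) N)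

  det-T : ∀ n → det< n (λ i j → T i (suc (j ℕ.* 2)))
              ≈ det< n (λ r t → -1^ n * E (n ∸ suc r) (n ℕ.+ t))
  det-T n = trans (sym (det<-strip n n e T ℕ.≤-refl
      (λ l l<n → one (proj₂ (proj₂ (Peak-even n l l<n))))
      (λ l c l<n → low (proj₂ (proj₂ (Peak-even n l l<n))) c)
      (λ l r l<n r<n → let K , eq , p = Peak-even n l l<n in
         odd p r (≡.subst (suc (r ℕ.* 2) <_) (≡.sym eq) (ℕ.*-monoˡ-≤ 2 r<n)))))
    -- For m = n no column has been deleted yet, so `columns n` is the identity below 2n, and the
    -- rows can be rewritten in the basis `T`.
    (trans (det<-cong (n ℕ.+ n) λ i k i<N k<N → trans
      (reflexive (≡.cong (stack n e T i) (columns-full n k (≡.subst (k <_) (≡.sym (n*2≡n+n n)) k<N))))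
      (stack-rel {n = n} n {e} {E} {T} {δ} (λ v v′ → ∀ N → v N ≈ ∑< (n ℕ.+ n) λ k → v′ k * T k N)
        (λ l _ N → at-combination (n ℕ.+ n) (E l) N)
        (λ i i<n N → sym (∑<-δˡ (n ℕ.+ n) (λ k → T k N) i (ℕ.<-≤-trans i<n (ℕ.m≤m+n n n)))) i i<N k))
    (trans (det<-product (n ℕ.+ n) (stack n E δ) T)
    (trans (*-cong (det<-block n n E)
      (trans (det<-upper (n ℕ.+ n) T T-low) (∏<-1 (n ℕ.+ n) λ i _ → T-leading i)))
      (*-identityʳ _))))
    where
    e : Matrix
    e l = combination (n ℕ.+ n) (E l)

-- Evaluation of the determinant of binomial coefficients

module DeterminantValue {c ℓ} (R : CommutativeRing c ℓ) (inverses : InverseFactorials R)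
  (b : CommutativeRing.Carrier R) where
  open CommutativeRing R hiding (zero)
  open RingNotions R using (_^_)
  open InverseFactorials inverses
  open DeterminantEvaluation R
  open RisingFactorials R inverses
  open DeterminantTransformation R inverses b using (E; G; det-G; det-T; shiftBy-+; shiftBy-low; n*2≡n+n)
  open import Algebra.Properties.Semiring.Exp semiring using (^-homo-*)
  open IntegerSolver R
  open SetoidReasoning setoid

  regular-resp : ∀ {r s} → r ≈ s → Regular r → Regular s
  regular-resp e reg u v eq = reg u v (trans (*-congʳ e) (trans eq (*-congʳ (sym e))))

  regular-neg : ∀ {r} → Regular r → Regular (- r)
  regular-neg {r} reg u v eq = reg u v (trans (neg u) (trans (-‿cong eq) (sym (neg v))))
    where
    neg : ∀ u → r * u ≈ - (- r * u)
    neg u = solve 2 (λ r u → r :* u := :- (:- r :* u)) refl r u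

  ∏<-zero : ∀ n f i → i < n → f i ≈ 0# → ∏< n f ≈ 0#
  ∏<-zero (suc n) f i i<n z = trans (∏<-skip n f i i<n) (trans (*-congʳ z) (zeroˡ _))

  ∏<-constant : ∀ n a → ∏< n (λ _ → a) ≈ a ^ n
  ∏<-constant zero    a = refl
  ∏<-constant (suc n) a = *-congˡ (∏<-constant n a)

  factorial-quotient : ∀ m q → ι ((m ℕ.+ q) !) * 1/ m ! ≈ ∏< q λ s → ι (suc m ℕ.+ s)
  factorial-quotient m zero    = trans (*-congʳ (reflexive (≡.cong (λ k → ι (k !)) (ℕ.+-identityʳ m))))
    (trans (*-comm _ _) (1/!*! m))
  factorial-quotient m (suc q) = begin
    ι ((m ℕ.+ suc q) !) * 1/ m !                       ≡⟨ ≡.cong (λ k → ι (k !) * 1/ m !) (ℕ.+-suc m q) ⟩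
    ι (suc (m ℕ.+ q) ℕ.* (m ℕ.+ q) !) * 1/ m !         ≈⟨ *-congʳ (ι-* (suc (m ℕ.+ q)) ((m ℕ.+ q) !)) ⟩
    ι (suc (m ℕ.+ q)) * ι ((m ℕ.+ q) !) * 1/ m !       ≈⟨ solve 3 (λ a b c → a :* b :* c := b :* c :* a) refl _ _ _ ⟩
    ι ((m ℕ.+ q) !) * 1/ m ! * ι (suc m ℕ.+ q)         ≈⟨ *-congʳ (factorial-quotient m q) ⟩
    ∏< q (λ s → ι (suc m ℕ.+ s)) * ι (suc m ℕ.+ q)     ≈⟨ ∏<-snoc q (λ s → ι (suc m ℕ.+ s)) ⟨
    ∏< (suc q) (λ s → ι (suc m ℕ.+ s))                 ∎

  ι-∸ : ∀ m n → n ≤ m → ι (m ∸ n) ≈ ι m - ι n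
  ι-∸ m n n≤m = begin
    ι (m ∸ n)                    ≈⟨ solve 2 (λ a b → a := a :+ b :- b) refl _ (ι n) ⟩
    ι (m ∸ n) + ι n - ι n        ≈⟨ +-congʳ (ι-+ (m ∸ n) n) ⟨
    ι (m ∸ n ℕ.+ n) - ι n        ≡⟨ ≡.cong (λ k → ι k - ι n) (ℕ.m∸n+n≡m n≤m) ⟩
    ι m - ι n                    ∎

  ∏<-ι∸ : ∀ t → ∏< t (λ s → ι t - ι s) ≈ ι (t !)
  ∏<-ι∸ t = begin
    ∏< t (λ s → ι t - ι s)              ≈⟨ ∏<-cong t (λ s s<t → trans (sym (ι-∸ t s (ℕ.<⇒≤ s<t)))
                                             (reflexive (≡.cong ι (ℕ.+-∸-assoc 1 s<t)))) ⟩
    ∏< t (λ s → ι (suc (t ∸ suc s)))    ≈⟨ ∏<-reverse t (ι ∘ suc) ⟩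
    ∏< t (ι ∘ suc)                      ≈⟨ factorial-quotient 0 t ⟨
    ι (t !) * 1/ 0 !                    ≈⟨ trans (*-congˡ 1/0!) (*-identityʳ _) ⟩
    ι (t !)                             ∎

  -1^-cancel : ∀ m t → -1^ m * -1^ (m ℕ.+ t) ≈ -1^ t
  -1^-cancel m t = trans (*-congˡ (^-homo-* (- 1#) m t))
    (trans (sym (*-assoc _ _ _)) (trans (*-congʳ (-1^n*-1^n m)) (*-identityˡ _)))

  module _ (n : ℕ) where

    -- `α l` is empty for 2l ≤ n and `β l` for n ≤ 2l. They are made for the identity α l · (b +
    -- 4l)_(n+t-2l) = β l · (b + n + 2l)_t, valid as long as 2l ≤ n + t, whose last factor has a
    -- length that does not depend on l. The factors of `q t` come from the differences of the two
    -- node sequences `a` and `ι`.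
    α β q : ℕ → Carrier
    α l = rise (b + ι n + ι (l ℕ.* 2)) (l ℕ.* 2 ∸ n)
    β l = rise (b + ι (l ℕ.* 2 ℕ.+ l ℕ.* 2)) (n ∸ l ℕ.* 2)
    q t = rise (b + ι n + ι n + ι t) t

    -- Row r belongs to l = n - 1 - r, the order in which `stack` lists the rows, and ξ r = 2l - n.
    -- With these nodes a s - ξ r = -(b + n + 2l + s) is, up to sign, a factor of (b + n + 2l)_t,
    -- and t + 1 + s - ξ r is a factor of (2r + 1)! / (n + t - 2l)!.
    ξ a : ℕ → Carrier
    ξ r = ι ((n ∸ suc r) ℕ.* 2) - ι n
    a s = - (b + ι n + ι n + ι s)

    private
      even-row : ∀ l d t p → n ≡ l ℕ.* 2 ℕ.+ d → n ≡ suc t ℕ.+ p →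
        ι ((d ℕ.+ t ℕ.+ p) !) * α l * (-1^ n * E l (n ℕ.+ t))
        ≈ β l * (∏< p (λ s → ι (suc t ℕ.+ s) - (ι (l ℕ.* 2) - ι n)) * (-1^ t * rise (b + ι n + ι (l ℕ.* 2)) t))
      even-row l d t p eq _ = begin
        ι ((d ℕ.+ t ℕ.+ p) !) * α l * (-1^ n * E l (n ℕ.+ t))
          ≈⟨ *-cong (*-congˡ (reflexive (≡.cong (rise (b + ι n + ι L)) (ℕ.m≤n⇒m∸n≡0 L≤n))))
               (trans (*-cong sign E≈) (trans (sym (*-assoc _ _ _)) (*-congʳ (-1^-cancel d t)))) ⟩
        ι ((d ℕ.+ t ℕ.+ p) !) * 1# * (-1^ t * (1/ (d ℕ.+ t) ! * rise γ (d ℕ.+ t)))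
          ≈⟨ *-congˡ (*-congˡ (*-congˡ (trans (rise-+ γ d t) (*-congˡ (rise-cong t γ+d))))) ⟩
        ι ((d ℕ.+ t ℕ.+ p) !) * 1# * (-1^ t * (1/ (d ℕ.+ t) ! * (rise γ d * rise (b + ι n + ι L) t)))
          ≈⟨ solve 5 (λ f s i x y → f :* con (+ 1) :* (s :* (i :* (x :* y))) := x :* ((f :* i) :* (s :* y)))
               refl _ _ _ _ _ ⟩
        rise γ d * ((ι ((d ℕ.+ t ℕ.+ p) !) * 1/ (d ℕ.+ t) !) * (-1^ t * rise (b + ι n + ι L) t))
          ≈⟨ *-cong (reflexive (≡.cong (rise γ) (≡.trans (≡.sym (ℕ.m+n∸m≡n L d)) (≡.cong (_∸ L) (≡.sym eq)))))
               (*-congʳ (trans (factorial-quotient (d ℕ.+ t) p) (∏<-cong′ p factor))) ⟩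
        β l * (∏< p (λ s → ι (suc t ℕ.+ s) - (ι L - ι n)) * (-1^ t * rise (b + ι n + ι L) t))
          ∎
        where
        L : ℕ
        L = l ℕ.* 2
        γ : Carrier
        γ = b + ι (L ℕ.+ L)
        L≤n : L ≤ n
        L≤n = ≡.subst (L ≤_) (≡.sym eq) (ℕ.m≤m+n L d)
        sign : -1^ n ≈ -1^ d
        sign = trans (reflexive (≡.cong -1^ eq)) (trans (^-homo-* (- 1#) L d)
            (trans (*-congʳ (-1^[n*2] l)) (*-identityˡ _)))
        E≈ : E l (n ℕ.+ t) ≈ -1^ (d ℕ.+ t) * H γ (d ℕ.+ t)
        E≈ = reflexive (≡.trans (≡.cong (E l) (≡.trans (≡.cong (ℕ._+ t) eq) (ℕ.+-assoc L d t)))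
            (shiftBy-+ L _ (d ℕ.+ t)))
        ιn : ι n ≈ ι L + ι d
        ιn = trans (reflexive (≡.cong ι eq)) (ι-+ L d)
        γ+d : γ + ι d ≈ b + ι n + ι L
        γ+d = trans (+-congʳ (+-congˡ (ι-+ L L))) (trans
          (solve 3 (λ b l d → b :+ (l :+ l) :+ d := b :+ (l :+ d) :+ l) refl b (ι L) (ι d))
          (+-congʳ (+-congˡ (sym ιn))))
        factor : ∀ s → ι (suc (d ℕ.+ t) ℕ.+ s) ≈ ι (suc t ℕ.+ s) - (ι L - ι n)
        factor s = begin
          ι (suc (d ℕ.+ t) ℕ.+ s)           ≈⟨ trans (+-congˡ (trans (ι-+ (d ℕ.+ t) s) (+-congʳ (ι-+ d t))))
                                                (solve 4 (λ d t s l → con (+ 1) :+ (d :+ t :+ s) := con (+ 1) :+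
                                                    (t :+ s) :- (l :- (l :+ d))) refl (ι d) (ι t) (ι s) (ι L)) ⟩
          1# + (ι t + ι s) - (ι L - (ι L + ι d)) ≈⟨ +-cong (+-congˡ (sym (ι-+ t s)))
              (-‿cong (+-congˡ (-‿cong (sym ιn)))) ⟩
          ι (suc t ℕ.+ s) - (ι L - ι n)     ∎

      odd-row : ∀ l e d p → l ℕ.* 2 ≡ n ℕ.+ e →
        ι ((d ℕ.+ p) !) * α l * (-1^ n * E l (n ℕ.+ (e ℕ.+ d)))
        ≈ β l * (∏< p (λ s → ι (suc (e ℕ.+ d) ℕ.+ s) - (ι (l ℕ.* 2) - ι n)) *
            (-1^ (e ℕ.+ d) * rise (b + ι n + ι (l ℕ.* 2)) (e ℕ.+ d)))
      odd-row l e d p eq = begin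
        ι ((d ℕ.+ p) !) * α l * (-1^ n * E l (n ℕ.+ (e ℕ.+ d)))
          ≈⟨ *-cong (*-congˡ (reflexive (≡.cong (rise (b + ι n + ι L)) (≡.trans (≡.cong (_∸ n) eq) (ℕ.m+n∸m≡n n e)))))
               (*-cong sign E≈) ⟩
        ι ((d ℕ.+ p) !) * rise (b + ι n + ι L) e * (-1^ e * (-1^ d * (1/ d ! * rise γ d)))
          ≈⟨ solve 6 (λ f x s s′ i y → f :* x :* (s :* (s′ :* (i :* y))) := con (+ 1) :*
               ((f :* i) :* ((s :* s′) :* (x :* y)))) refl _ _ _ _ _ _ ⟩
        1# * ((ι ((d ℕ.+ p) !) * 1/ d !) * ((-1^ e * -1^ d) * (rise (b + ι n + ι L) e * rise γ d)))
          ≈⟨ *-cong (reflexive (≡.cong (rise γ) (≡.sym (ℕ.m≤n⇒m∸n≡0 n≤L)))) (*-cong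
               (trans (factorial-quotient d p) (∏<-cong′ p factor))
               (*-cong (sym (^-homo-* (- 1#) e d)) (trans (*-congˡ (rise-cong d γ≈))
                   (sym (rise-+ (b + ι n + ι L) e d))))) ⟩
        β l * (∏< p (λ s → ι (suc (e ℕ.+ d) ℕ.+ s) - (ι L - ι n)) * (-1^ (e ℕ.+ d) * rise (b + ι n + ι L) (e ℕ.+ d)))
          ∎
        where
        L : ℕ
        L = l ℕ.* 2
        γ : Carrier
        γ = b + ι (L ℕ.+ L)
        n≤L : n ≤ L
        n≤L = ≡.subst (n ≤_) (≡.sym eq) (ℕ.m≤m+n n e)
        sign : -1^ n ≈ -1^ e
        sign = begin
          -1^ n                              ≈⟨ trans (*-congˡ (-1^n*-1^n e)) (*-identityʳ _) ⟨
          -1^ n * (-1^ e * -1^ e)            ≈⟨ *-assoc _ _ _ ⟨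
          -1^ n * -1^ e * -1^ e              ≈⟨ *-congʳ (^-homo-* (- 1#) n e) ⟨
          -1^ (n ℕ.+ e) * -1^ e              ≡⟨ ≡.cong (λ k → -1^ k * -1^ e) eq ⟨
          -1^ L * -1^ e                      ≈⟨ trans (*-congʳ (-1^[n*2] l)) (*-identityˡ _) ⟩
          -1^ e                              ∎
        E≈ : E l (n ℕ.+ (e ℕ.+ d)) ≈ -1^ d * H γ d
        E≈ = reflexive (≡.trans (≡.cong (E l) (≡.trans (≡.sym (ℕ.+-assoc n e d)) (≡.cong (ℕ._+ d) (≡.sym eq))))
            (shiftBy-+ L _ d))
        ιL : ι L ≈ ι n + ι e
        ιL = trans (reflexive (≡.cong ι eq)) (ι-+ n e)
        γ≈ : γ ≈ b + ι n + ι L + ι e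
        γ≈ = trans (+-congˡ (trans (ι-+ L L) (+-congʳ ιL)))
          (solve 4 (λ b n e l → b :+ (n :+ e :+ l) := b :+ n :+ l :+ e) refl b (ι n) (ι e) (ι L))
        factor : ∀ s → ι (suc d ℕ.+ s) ≈ ι (suc (e ℕ.+ d) ℕ.+ s) - (ι L - ι n)
        factor s = begin
          1# + ι (d ℕ.+ s)                                 ≈⟨ +-congˡ (ι-+ d s) ⟩
          1# + (ι d + ι s)                                 ≈⟨ solve 4
              (λ e d s n → con (+ 1) :+ (d :+ s) := con (+ 1) :+ (e :+ d :+ s) :- (n :+ e :- n)) refl (ι e)
              (ι d) (ι s) (ι n) ⟩
          1# + (ι e + ι d + ι s) - (ι n + ι e - ι n)       ≈⟨ +-cong
              (+-congˡ (trans (+-congʳ (sym (ι-+ e d))) (sym (ι-+ (e ℕ.+ d) s)))) (-‿cong (+-congʳ (sym ιL))) ⟩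
          ι (suc (e ℕ.+ d) ℕ.+ s) - (ι L - ι n)            ∎

      -- On the left the column lies before the first nonzero entry of row l of `E`. On the right ξ
      -- = e, and the linear factor with t + 1 + s = e is zero; it occurs among the p factors
      -- because e < n.
      vanishing-row : ∀ l e t p → l ℕ.* 2 ≡ n ℕ.+ e → t < e → e < suc t ℕ.+ p → ∀ f z →
        f * (-1^ n * E l (n ℕ.+ t))
        ≈ β l * (∏< p (λ s → ι (suc t ℕ.+ s) - (ι (l ℕ.* 2) - ι n)) * z)
      vanishing-row l e t p eq t<e e<t+p f z = trans
        (trans (*-congˡ (trans (*-congˡ (shiftBy-low L _ (n ℕ.+ t)
            (≡.subst (n ℕ.+ t <_) (≡.sym eq) (ℕ.+-monoʳ-< n t<e)))) (zeroʳ _))) (zeroʳ f))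
        (sym (trans (*-congˡ (trans (*-congʳ (∏<-zero p (λ s → ι (suc t ℕ.+ s) - (ι L - ι n)) (e ∸ suc t) i<p
            factor)) (zeroˡ z))) (zeroʳ _)))
        where
        L : ℕ
        L = l ℕ.* 2
        i<p : e ∸ suc t < p
        i<p = ℕ.+-cancelˡ-< (suc t) (e ∸ suc t) p (≡.subst (_< suc t ℕ.+ p) (≡.sym (ℕ.m+[n∸m]≡n t<e)) e<t+p)
        factor : ι (suc t ℕ.+ (e ∸ suc t)) - (ι L - ι n) ≈ 0#
        factor = trans (+-cong (reflexive (≡.cong ι (ℕ.m+[n∸m]≡n t<e)))
          (-‿cong (+-congʳ (trans (reflexive (≡.cong ι eq)) (ι-+ n e)))))
          (solve 2 (λ e n → e :- (n :+ e :- n) := con (+ 0)) refl (ι e) (ι n))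

    -- E (n - 1 - r) (n + t) is a binomial coefficient; up to factors depending
    -- only on the row it is the product of linear factors in ξ r.
    row-factor : ∀ r t → r < n → t < n →
      ι (suc (r ℕ.* 2) !) * α (n ∸ suc r) * (-1^ n * E (n ∸ suc r) (n ℕ.+ t))
      ≈ β (n ∸ suc r) * krattenthalerMatrix n a ι ξ r t
    row-factor r t r<n t<n = trans (by-cases (ℕ.≤-total L n))
        (*-congˡ {β l} (*-congˡ {∏< p λ s → ι (suc t ℕ.+ s) - ξ r} (sym second)))
      where
      l L p : ℕ
      l = n ∸ suc r
      L = l ℕ.* 2
      p = n ∸ suc t
      n≡ : n ≡ suc t ℕ.+ p
      n≡ = ≡.sym (ℕ.m+[n∸m]≡n t<n)
      L+r : L ℕ.+ suc (suc (r ℕ.* 2)) ≡ n ℕ.+ n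
      L+r = ≡.trans (≡.sym (ℕ.*-distribʳ-+ 2 l (suc r))) (≡.trans (≡.cong (ℕ._* 2) (ℕ.m∸n+n≡m r<n)) (n*2≡n+n n))
      second : ∏< t (λ s → a s - ξ r) ≈ -1^ t * rise (b + ι n + ι L) t
      second = sym (trans (∏<-neg t λ s → b + ι n + ι L + ι s) (∏<-cong′ t λ s →
        solve 4 (λ b n l s → :- (b :+ n :+ l :+ s) := :- (b :+ n :+ n :+ s) :- (l :- n)) refl b (ι n) (ι L) (ι s)))
      Goal : Set ℓ
      Goal = ι (suc (r ℕ.* 2) !) * α l * (-1^ n * E l (n ℕ.+ t))
        ≈ β l * (∏< p (λ s → ι (suc t ℕ.+ s) - ξ r) * (-1^ t * rise (b + ι n + ι L) t))
      by-cases : L ≤ n ⊎ n ≤ L → Goal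
      by-cases (inj₁ L≤n) = trans
        (*-congʳ (*-congʳ (reflexive (≡.cong (λ k → ι (k !)) (≡.trans 2r+1≡ (≡.sym (ℕ.+-assoc d t p)))))))
        (even-row l d t p n≡L+d n≡)
        where
        d : ℕ
        d = n ∸ L
        n≡L+d : n ≡ L ℕ.+ d
        n≡L+d = ≡.sym (ℕ.m+[n∸m]≡n L≤n)
        2r+1≡ : suc (r ℕ.* 2) ≡ d ℕ.+ (t ℕ.+ p)
        2r+1≡ = ℕ.suc-injective (≡.trans
          (ℕ.+-cancelˡ-≡ L _ (d ℕ.+ n) (≡.trans L+r (≡.trans (≡.cong (ℕ._+ n) n≡L+d) (ℕ.+-assoc L d n))))
          (≡.trans (≡.cong (d ℕ.+_) n≡) (ℕ.+-suc d (t ℕ.+ p))))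
      by-cases (inj₂ n≤L) = odd-case (ℕ.<-≤-connex t e)
        where
        e : ℕ
        e = L ∸ n
        L≡n+e : L ≡ n ℕ.+ e
        L≡n+e = ≡.sym (ℕ.m+[n∸m]≡n n≤L)
        e+2r+1≡ : suc (e ℕ.+ suc (r ℕ.* 2)) ≡ n
        e+2r+1≡ = ≡.trans (≡.sym (ℕ.+-suc e (suc (r ℕ.* 2)))) (ℕ.+-cancelˡ-≡ n _ n
          (≡.trans (≡.sym (ℕ.+-assoc n e _)) (≡.trans (≡.cong (ℕ._+ suc (suc (r ℕ.* 2))) (≡.sym L≡n+e)) L+r)))
        e<n : e < n
        e<n = ≡.subst (e <_) e+2r+1≡ (s≤s (ℕ.m≤m+n e _))
        odd-case : t < e ⊎ e ≤ t → Goal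
        odd-case (inj₁ t<e) = vanishing-row l e t p L≡n+e t<e (≡.subst (e <_) n≡ e<n) _ _
        odd-case (inj₂ e≤t) = ≡.subst
          (λ t → suc (r ℕ.* 2) ≡ (t ∸ e) ℕ.+ p → e ≤ t → ι (suc (r ℕ.* 2) !) * α l * (-1^ n * E l (n ℕ.+ t))
            ≈ β l * (∏< p (λ s → ι (suc t ℕ.+ s) - ξ r) * (-1^ t * rise (b + ι n + ι L) t)))
          e+d≡t (λ eq _ → trans
            (*-congʳ (*-congʳ (reflexive (≡.cong (λ k → ι (k !))
                (≡.trans eq (≡.cong (ℕ._+ p) (ℕ.m+n∸m≡n e (t ∸ e))))))))
            (odd-row l e (t ∸ e) p L≡n+e))
          2r+1≡ e≤t
          where
          e+d≡t : e ℕ.+ (t ∸ e) ≡ t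
          e+d≡t = ℕ.m+[n∸m]≡n e≤t
          2r+1≡ : suc (r ℕ.* 2) ≡ (t ∸ e) ℕ.+ p
          2r+1≡ = ℕ.+-cancelˡ-≡ e _ _ (≡.trans (ℕ.suc-injective (≡.trans e+2r+1≡ n≡))
            (≡.trans (≡.cong (ℕ._+ p) (≡.sym e+d≡t)) (ℕ.+-assoc e (t ∸ e) p)))

    -- A pair s < t contributes -2 (t - s) from the nodes `ξ`, which decrease in steps of 2, and -(b
    -- + 2n + s + t) from `a` and `ι`. The two signs cancel in each pair.
    krattenthaler-value : (∀ k → Regular (b + ι k)) →
      det< n (krattenthalerMatrix n a ι ξ) ≈ ∏< n λ t → ι 2 ^ t * ι (t !) * q t
    krattenthaler-value regular = begin
      det< n (krattenthalerMatrix n a ι ξ)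
        ≈⟨ krattenthaler n a ι ξ (λ i r _ _ → regular-resp (node i r)
             (regular-neg (regular (n ℕ.+ (n ∸ suc r) ℕ.* 2 ℕ.+ i)))) ⟩
      ∏< n (λ t → ∏< t λ s → ξ t - ξ s) * ∏< n (λ t → ∏< t λ s → a s - ι t)
        ≈⟨ ∏<-* n (λ t → ∏< t λ s → ξ t - ξ s) (λ t → ∏< t λ s → a s - ι t) ⟨
      ∏< n (λ t → (∏< t λ s → ξ t - ξ s) * (∏< t λ s → a s - ι t))
        ≈⟨ ∏<-cong n (λ t t<n → trans (sym (∏<-* t (λ s → ξ t - ξ s) (λ s → a s - ι t)))
             (trans (∏<-cong t (λ s s<t → pair t s t<n s<t)) (collect t))) ⟩
      ∏< n (λ t → ι 2 ^ t * ι (t !) * q t)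
        ∎
      where
      node : ∀ i r → - (b + ι (n ℕ.+ (n ∸ suc r) ℕ.* 2 ℕ.+ i)) ≈ a i - ξ r
      node i r = trans (-‿cong (+-congˡ (trans (ι-+ (n ℕ.+ (n ∸ suc r) ℕ.* 2) i) (+-congʳ (ι-+ n _)))))
        (solve 4 (λ b n l i → :- (b :+ (n :+ l :+ i)) := :- (b :+ n :+ n :+ i) :- (l :- n)) refl b (ι n)
            (ι ((n ∸ suc r) ℕ.* 2)) (ι i))
      ξ≈ : ∀ r → r < n → ξ r ≈ ι n - ι 2 - ι 2 * ι r
      ξ≈ r r<n = trans (+-congʳ (trans (ι-* (n ∸ suc r) 2) (*-congʳ (ι-∸ n (suc r) r<n))))
        (solve 2 (λ n r → (n :- (con (+ 1) :+ r)) :* con (+ 2) :- n := n :- con (+ 2) :- con (+ 2) :* r) refl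
            (ι n) (ι r))
      pair : ∀ t s → t < n → s < t → (ξ t - ξ s) * (a s - ι t) ≈ ι 2 * (ι t - ι s) * (b + ι n + ι n + ι t + ι s)
      pair t s t<n s<t = trans (*-congʳ (+-cong (ξ≈ t t<n) (-‿cong (ξ≈ s (ℕ.<-trans s<t t<n)))))
        (solve 4 (λ b n t s → (n :- con (+ 2) :- con (+ 2) :* t :- (n :- con (+ 2) :- con (+ 2) :* s)) :*
            (:- (b :+ n :+ n :+ s) :- t)
          := con (+ 2) :* (t :- s) :* (b :+ n :+ n :+ t :+ s)) refl b (ι n) (ι t) (ι s))
      collect : ∀ t → ∏< t (λ s → ι 2 * (ι t - ι s) * (b + ι n + ι n + ι t + ι s)) ≈ ι 2 ^ t * ι (t !) * q t
      collect t = trans (∏<-* t (λ s → ι 2 * (ι t - ι s)) (λ s → b + ι n + ι n + ι t + ι s))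
        (*-congʳ (trans (∏<-* t (λ _ → ι 2) (λ s → ι t - ι s)) (*-cong (∏<-constant t (ι 2)) (∏<-ι∸ t))))

    det-T-value : (∀ k → Regular (b + ι k)) →
      ∏< n (λ r → ι (suc (r ℕ.* 2) !)) * ∏< n α * det< n (λ r t → -1^ n * E (n ∸ suc r) (n ℕ.+ t))
      ≈ ∏< n β * ∏< n (λ t → ι 2 ^ t * ι (t !) * q t)
    det-T-value regular = begin
      ∏< n (λ r → ι (suc (r ℕ.* 2) !)) * ∏< n α * det< n M
        ≈⟨ *-congʳ (trans (*-congˡ (sym (∏<-reverse n α)))
             (sym (∏<-* n (λ r → ι (suc (r ℕ.* 2) !)) (λ r → α (n ∸ suc r))))) ⟩
      ∏< n (λ r → ι (suc (r ℕ.* 2) !) * α (n ∸ suc r)) * det< n M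
        ≈⟨ det<-scaleRows n (λ r → ι (suc (r ℕ.* 2) !) * α (n ∸ suc r)) M ⟨
      det< n (λ r t → ι (suc (r ℕ.* 2) !) * α (n ∸ suc r) * M r t)
        ≈⟨ det<-cong n row-factor ⟩
      det< n (λ r t → β (n ∸ suc r) * krattenthalerMatrix n a ι ξ r t)
        ≈⟨ det<-scaleRows n (λ r → β (n ∸ suc r)) (krattenthalerMatrix n a ι ξ) ⟩
      ∏< n (λ r → β (n ∸ suc r)) * det< n (krattenthalerMatrix n a ι ξ)
        ≈⟨ *-cong (∏<-reverse n β) (krattenthaler-value regular) ⟩
      ∏< n β * ∏< n (λ t → ι 2 ^ t * ι (t !) * q t)
        ∎
      where
      M : Matrix
      M r t = -1^ n * E (n ∸ suc r) (n ℕ.+ t)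

  det-G-value : (∀ k → Regular (b + ι k)) → ∀ m → let n = suc m in
    ∏< n (λ r → ι (suc (r ℕ.* 2) !)) * ∏< n (α n) * det< n (λ i j → G i (suc (j ℕ.* 2)))
    ≈ ι 2 * (∏< n (β n) * ∏< n (λ t → ι 2 ^ t * ι (t !) * q n t))
  det-G-value regular m = begin
    f * det< n (λ i j → G i (suc (j ℕ.* 2)))        ≈⟨ *-congˡ (trans (det-G m) (*-congˡ (det-T n))) ⟩
    f * (ι 2 * d)                                   ≈⟨ solve 3 (λ f t d → f :* (t :* d) := t :* (f :* d)) refl f
        (ι 2) d ⟩
    ι 2 * (f * d)                                   ≈⟨ *-congˡ (det-T-value n regular) ⟩
    ι 2 * (∏< n (β n) * ∏< n (λ t → ι 2 ^ t * ι (t !) * q n t)) ∎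
    where
    n : ℕ
    n = suc m
    f d : Carrier
    f = ∏< n (λ r → ι (suc (r ℕ.* 2) !)) * ∏< n (α n)
    d = det< n (λ r t → -1^ n * E (n ∸ suc r) (n ℕ.+ t))

-- The product formula

module ProductFormula {c ℓ} (R : CommutativeRing c ℓ) (inverses : InverseFactorials R)
  (x : CommutativeRing.Carrier R) where
  open CommutativeRing R hiding (zero)
  open import Data.Nat.Combinatorics using (_C_; nCk+nC[k+1]≡[n+1]C[k+1]; nC1≡n)
  open RingNotions R using (_^_)
  open InverseFactorials inverses
  open DeterminantEvaluation R
  open RisingFactorials R inverses
  open import Algebra.Properties.Semiring.Exp semiring using (^-homo-*)
  open IntegerSolver R
  open SetoidReasoning setoid

  b : Carrier
  b = x + 1#

  open DeterminantTransformation R inverses b using (G)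
  open DeterminantValue R inverses b

  -- At ℚ[x] these unfold to binomial, entry and productFormula.
  binomialₓ : Carrier → ℕ → Carrier
  binomialₓ γ p = 1/ p ! * ∏< p λ k → γ - ι k

  entryₓ : Matrix
  entryₓ i j =
      ι 2 ^ i * binomialₓ (x + ι i + ι (2 ℕ.* j) + 1#) (2 ℕ.* j ℕ.+ 1)
    + binomialₓ (x - ι i + ι (2 ℕ.* j) + 1#) (2 ℕ.* j ℕ.+ 1)

  productFormulaₓ : ℕ → Carrier
  productFormulaₓ n =
      ι 2 ^ (n C 2 ℕ.+ 1)
    * ∏< n (λ i → ι (i !) * 1/ 2 ℕ.* i ℕ.+ 1 !)
    * ∏< (suc ⌊ n /2⌋) (λ i → rise (x + ι (4 ℕ.* i) + 1#) (n ∸ 2 ℕ.* i))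
    * ∏< (suc ⌊ n ∸ 1 /2⌋) (λ i → rise (x - ι (2 ℕ.* i) + ι (3 ℕ.* n)) (n ∸ 2 ℕ.* i ∸ 1))

  binomialₓ-rise : ∀ γ β m → γ ≈ β + ι m → binomialₓ γ (suc m) ≈ H β (suc m)
  binomialₓ-rise γ β m e = *-congˡ (begin
    ∏< (suc m) (λ k → γ - ι k)
      ≈⟨ ∏<-cong (suc m) (λ k k≤m → trans (+-congʳ e)
           (trans (+-assoc _ _ _) (+-congˡ (sym (ι-∸ m k (ℕ.≤-pred k≤m)))))) ⟩
    ∏< (suc m) (λ k → β + ι (suc m ∸ suc k))
      ≈⟨ ∏<-reverse (suc m) (λ k → β + ι k) ⟩
    rise β (suc m)
      ∎)

  2j+1≡ : ∀ j → 2 ℕ.* j ℕ.+ 1 ≡ suc (j ℕ.* 2)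
  2j+1≡ j = ≡.trans (ℕ.+-comm _ 1) (≡.cong suc (ℕ.*-comm 2 j))

  entryₓ≈G : ∀ i j → entryₓ i j ≈ G i (suc (j ℕ.* 2))
  entryₓ≈G i j = +-cong
    (trans (*-congˡ (value (x + ι i + ι (2 ℕ.* j) + 1#) (b + ι i)
             (solve 3 (λ x i j → x :+ i :+ j :+ con (+ 1) := x :+ con (+ 1) :+ i :+ j) refl x (ι i) (ι (2 ℕ.* j)))))
      (sym (PowerSeries.constant-* R (ι 2 ^ i) (λ p → H (b + ι i) p) (suc (j ℕ.* 2)))))
    (value (x - ι i + ι (2 ℕ.* j) + 1#) (b - ι i)
      (solve 3 (λ x i j → x :- i :+ j :+ con (+ 1) := x :+ con (+ 1) :- i :+ j) refl x (ι i) (ι (2 ℕ.* j))))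
    where
    value : ∀ γ β → γ ≈ β + ι (2 ℕ.* j) → binomialₓ γ (2 ℕ.* j ℕ.+ 1) ≈ H β (suc (j ℕ.* 2))
    value γ β e = trans (reflexive (≡.cong (binomialₓ γ) (2j+1≡ j)))
      (binomialₓ-rise γ β (j ℕ.* 2) (trans e (+-congˡ (reflexive (≡.cong ι (ℕ.*-comm 2 j))))))

  det-entryₓ : (∀ k → Regular (b + ι k)) → ∀ m → let n = suc m in
    ∏< n (λ r → ι (suc (r ℕ.* 2) !)) * ∏< n (α n) * det< n entryₓ
    ≈ ι 2 * (∏< n (β n) * ∏< n (λ t → ι 2 ^ t * ι (t !) * q n t))
  det-entryₓ regular m = trans (*-congˡ (det<-cong (suc m) λ i j _ _ → entryₓ≈G i j)) (det-G-value regular m)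

  ∏<-trim : ∀ m n f → m ≤ n → (∀ i → m ≤ i → f i ≈ 1#) → ∏< n f ≈ ∏< m f
  ∏<-trim m n f m≤n e = begin
    ∏< n f                                          ≡⟨ ≡.cong (λ k → ∏< k f) (ℕ.m+[n∸m]≡n m≤n) ⟨
    ∏< (m ℕ.+ (n ∸ m)) f                            ≈⟨ ∏<-split m (n ∸ m) f ⟩
    ∏< m f * ∏< (n ∸ m) (λ i → f (m ℕ.+ i))         ≈⟨ *-congˡ (∏<-1 (n ∸ m) λ i _ → e (m ℕ.+ i) (ℕ.m≤m+n m i)) ⟩
    ∏< m f * 1#                                     ≈⟨ *-identityʳ _ ⟩
    ∏< m f                                          ∎

  n<suc⌊n/2⌋*2 : ∀ n → n < suc ⌊ n /2⌋ ℕ.* 2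
  n<suc⌊n/2⌋*2 zero          = z<s
  n<suc⌊n/2⌋*2 (suc zero)    = s<s z<s
  n<suc⌊n/2⌋*2 (suc (suc n)) = s<s (s<s (n<suc⌊n/2⌋*2 n))

  n∸i*2≡0 : ∀ n i → suc ⌊ n /2⌋ ≤ i → n ∸ i ℕ.* 2 ≡ 0
  n∸i*2≡0 n i lt = ℕ.m≤n⇒m∸n≡0 (ℕ.<⇒≤ (ℕ.<-≤-trans (n<suc⌊n/2⌋*2 n) (ℕ.*-monoˡ-≤ 2 lt)))

  module _ (f : ℕ → Carrier) (f0≈1 : f 0 ≈ 1#) where

    -- The product f (n - 1) f (n - 3) f (n - 5) ..., with a convenient number of factors: truncated
    -- subtraction sends the surplus indices to 0, where `f` is 1.
    alternate : ℕ → Carrier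
    alternate n = ∏< n λ i → f (n ∸ suc (i ℕ.* 2))

    ∏<-alternate : ∀ n → ∏< (suc n) (λ i → f (n ∸ suc (i ℕ.* 2))) ≈ alternate n
    ∏<-alternate n = trans (∏<-snoc n λ i → f (n ∸ suc (i ℕ.* 2)))
      (trans (*-congˡ (trans (reflexive (≡.cong f (ℕ.m≤n⇒m∸n≡0 (ℕ.m≤n⇒m≤1+n (ℕ.m≤m*n n 2))))) f0≈1)) (*-identityʳ _))

    alternate-*-alternate : ∀ n → alternate (suc n) * alternate n ≈ ∏< (suc n) f
    alternate-*-alternate zero    = *-identityʳ _
    alternate-*-alternate (suc n) = begin
      f (suc n) * ∏< (suc n) (λ i → f (n ∸ suc (i ℕ.* 2))) * alternate
          (suc n)   ≈⟨ *-congʳ (*-congˡ (∏<-alternate n)) ⟩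
      f (suc n) * alternate n * alternate (suc n)                                ≈⟨ solve 3
          (λ f a c → f :* a :* c := c :* a :* f) refl _ _ _ ⟩
      alternate (suc n) * alternate n * f (suc n)                                ≈⟨ *-congʳ
          (alternate-*-alternate n) ⟩
      ∏< (suc n) f * f (suc n)                                                   ≈⟨ ∏<-snoc (suc n) f ⟨
      ∏< (suc (suc n)) f                                                         ∎

    -- Read from l = n downwards, 2l - (n + 1) runs through n - 1, n - 3, ... and is then truncated
    -- to 0.
    alternate-even : ∀ n → ∏< (suc n) (λ l → f (l ℕ.* 2 ∸ suc n)) ≈ alternate n
    alternate-even n = trans (sym (∏<-reverse (suc n) λ l → f (l ℕ.* 2 ∸ suc n)))
      (trans (∏<-cong (suc n) λ i i<n → reflexive (≡.cong f (index i))) (∏<-alternate n))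
      where
      index : ∀ i → (suc n ∸ suc i) ℕ.* 2 ∸ suc n ≡ suc n ∸ suc (suc (i ℕ.* 2))
      index i = ≡.trans (≡.cong (_∸ suc n) (ℕ.*-distribʳ-∸ 2 (suc n) (suc i)))
        (≡.trans (ℕ.∸-+-assoc (suc n ℕ.* 2) (suc i ℕ.* 2) (suc n))
        (≡.trans (≡.cong (suc n ℕ.* 2 ∸_) (ℕ.+-comm (suc i ℕ.* 2) (suc n)))
        (≡.trans (≡.sym (ℕ.∸-+-assoc (suc n ℕ.* 2) (suc n) (suc i ℕ.* 2)))
        (≡.cong (_∸ suc i ℕ.* 2) (≡.trans (≡.cong (_∸ suc n)
          (≡.trans (ℕ.*-comm (suc n) 2) (≡.cong (suc n ℕ.+_) (ℕ.+-identityʳ (suc n)))))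
              (ℕ.m+n∸m≡n (suc n) (suc n)))))))

    alternate-odd : ∀ n → ∏< (suc ⌊ n /2⌋) (λ i → f (n ∸ i ℕ.* 2)) ≈ alternate (suc n)
    alternate-odd n = sym (∏<-trim (suc ⌊ n /2⌋) (suc n) _ (s≤s (ℕ.⌊n/2⌋≤n n)) λ i lt →
      trans (reflexive (≡.cong f (n∸i*2≡0 n i lt))) f0≈1)

  ι2^C : ∀ n → ι 2 * ∏< n (λ t → ι 2 ^ t) ≈ ι 2 ^ (n C 2 ℕ.+ 1)
  ι2^C n = trans (*-comm _ _) (trans (*-cong (go n) (sym (*-identityʳ (ι 2)))) (sym (^-homo-* (ι 2) (n C 2) 1)))
    where
    go : ∀ n → ∏< n (λ t → ι 2 ^ t) ≈ ι 2 ^ (n C 2)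
    go zero    = refl
    go (suc n) = begin
      ∏< (suc n) (λ t → ι 2 ^ t)            ≈⟨ ∏<-snoc n (λ t → ι 2 ^ t) ⟩
      ∏< n (λ t → ι 2 ^ t) * ι 2 ^ n        ≈⟨ *-congʳ (go n) ⟩
      ι 2 ^ (n C 2) * ι 2 ^ n               ≈⟨ trans (*-comm _ _) (sym (^-homo-* (ι 2) n (n C 2))) ⟩
      ι 2 ^ (n ℕ.+ n C 2)                   ≡⟨ ≡.cong (λ k → ι 2 ^ (k ℕ.+ n C 2)) (nC1≡n n) ⟨
      ι 2 ^ (n C 1 ℕ.+ n C 2)               ≡⟨ ≡.cong (ι 2 ^_) (nCk+nC[k+1]≡[n+1]C[k+1] n 1) ⟩
      ι 2 ^ (suc n C 2)                     ∎

  module _ (m : ℕ) where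
    private
      n : ℕ
      n = suc m

    ∏β : ∏< n (β n) ≈ ∏< (suc ⌊ n /2⌋) (λ i → rise (x + ι (4 ℕ.* i) + 1#) (n ∸ 2 ℕ.* i))
    ∏β = trans (∏<-trim (suc ⌊ n /2⌋) n (β n) (s≤s (⌊suc/2⌋≤ m)) λ i lt →
        reflexive (≡.cong (rise (b + ι (i ℕ.* 2 ℕ.+ i ℕ.* 2))) (n∸i*2≡0 n i lt)))
      (∏<-cong′ (suc ⌊ n /2⌋) λ i → trans
        (rise-cong (n ∸ i ℕ.* 2) (trans (+-congˡ (reflexive (≡.cong ι (4i i))))
          (solve 2 (λ x k → x :+ con (+ 1) :+ k := x :+ k :+ con (+ 1)) refl x (ι (4 ℕ.* i)))))
        (reflexive (≡.cong (λ k → rise (x + ι (4 ℕ.* i) + 1#) (n ∸ k)) (ℕ.*-comm i 2))))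
      where
      ⌊suc/2⌋≤ : ∀ m → ⌊ suc m /2⌋ ≤ m
      ⌊suc/2⌋≤ m = ℕ.≤-pred (ℕ.⌊n/2⌋<n m)
      4i : ∀ i → i ℕ.* 2 ℕ.+ i ℕ.* 2 ≡ 4 ℕ.* i
      4i i = ≡.trans (≡.sym (ℕ.*-distribˡ-+ i 2 2)) (ℕ.*-comm i 4)

    -- Both are empty if 2l ≤ n. Otherwise they have the same length and the same first factor, as n
    -- + 2l = 2n + (2l - n).
    α≈q : ∀ l → α n l ≈ q n (l ℕ.* 2 ∸ n)
    α≈q l with ℕ.≤-total (l ℕ.* 2) n
    ... | inj₁ le rewrite ℕ.m≤n⇒m∸n≡0 le = refl
    ... | inj₂ ge = rise-cong (l ℕ.* 2 ∸ n) (trans (+-congˡ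
        (trans (reflexive (≡.cong ι (≡.sym (ℕ.m+[n∸m]≡n ge)))) (ι-+ n (l ℕ.* 2 ∸ n)))) (sym (+-assoc _ _ _)))

    -- The `α l` are every second `q t`, those with t of the parity of n. The other half, t = n - 1,
    -- n - 3, ..., is the last product of the formula.
    ∏q : ∏< n (q n) ≈ ∏< n (α n)
       * ∏< (suc ⌊ m /2⌋) (λ i → rise (x - ι (2 ℕ.* i) + ι (3 ℕ.* n)) (n ∸ 2 ℕ.* i ∸ 1))
    ∏q = begin
      ∏< n (q n)
        ≈⟨ alternate-*-alternate (q n) refl m ⟨
      alternate (q n) refl n * alternate (q n) refl m
        ≈⟨ *-comm _ _ ⟩
      alternate (q n) refl m * alternate (q n) refl n
        ≈⟨ *-cong (sym (trans (∏<-cong′ n α≈q) (alternate-even (q n) refl m)))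
             (trans (sym (alternate-odd (q n) refl m)) (∏<-cong (suc ⌊ m /2⌋) second)) ⟩
      ∏< n (α n) * ∏< (suc ⌊ m /2⌋) (λ i → rise (x - ι (2 ℕ.* i) + ι (3 ℕ.* n)) (n ∸ 2 ℕ.* i ∸ 1))
        ∎
      where
      second : ∀ i → i < suc ⌊ m /2⌋ → q n (m ∸ i ℕ.* 2) ≈ rise (x - ι (2 ℕ.* i) + ι (3 ℕ.* n)) (n ∸ 2 ℕ.* i ∸ 1)
      second i (s≤s i≤m/2) = trans
        (rise-cong (m ∸ i ℕ.* 2) (trans (+-congˡ (trans (ι-∸ m (i ℕ.* 2) 2i≤m)
            (+-congˡ (-‿cong (reflexive (≡.cong ι (ℕ.*-comm i 2)))))))
          (trans (solve 3 (λ x m i → x :+ con (+ 1) :+ (con (+ 1) :+ m) :+ (con (+ 1) :+ m) :+ (m :- i)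
               := x :- i :+ con (+ 3) :* (con (+ 1) :+ m)) refl x (ι m) (ι (2 ℕ.* i)))
            (+-congˡ (sym (ι-* 3 n))))))
        (reflexive (≡.cong (rise (x - ι (2 ℕ.* i) + ι (3 ℕ.* n))) (≡.sym
          (≡.trans (ℕ.∸-+-assoc n (2 ℕ.* i) 1) (≡.trans (≡.cong (n ∸_) (2j+1≡ i)) ≡.refl)))))
        where
        2⌊m/2⌋≤m : ∀ m → ⌊ m /2⌋ ℕ.* 2 ≤ m
        2⌊m/2⌋≤m zero          = z≤n
        2⌊m/2⌋≤m (suc zero)    = z≤n
        2⌊m/2⌋≤m (suc (suc m)) = s≤s (s≤s (2⌊m/2⌋≤m m))
        2i≤m : i ℕ.* 2 ≤ m
        2i≤m = ℕ.≤-trans (ℕ.*-monoˡ-≤ 2 i≤m/2) (2⌊m/2⌋≤m m)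

    det-productFormula : (∀ k → Regular (b + ι k)) → det< n entryₓ ≈ productFormulaₓ n
    det-productFormula regular = ∏<-regular n (α n) α-regular _ _ (begin
      ∏α * d
        ≈⟨ trans (*-congʳ facts⁻¹) (*-identityˡ _) ⟨
      f⁻¹ * f * (∏α * d)
        ≈⟨ solve 4 (λ i f a d → i :* f :* (a :* d) := i :* (f :* a :* d)) refl f⁻¹ f ∏α d ⟩
      f⁻¹ * (f * ∏α * d)
        ≈⟨ *-congˡ (det-entryₓ regular m) ⟩
      f⁻¹ * (ι 2 * (∏< n (β n) * ∏< n (λ t → ι 2 ^ t * ι (t !) * q n t)))
        ≈⟨ *-congˡ (*-congˡ (*-congˡ (trans (∏<-* n (λ t → ι 2 ^ t * ι (t !)) (q n))
             (*-congʳ (∏<-* n (λ t → ι 2 ^ t) (λ t → ι (t !))))))) ⟩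
      f⁻¹ * (ι 2 * (∏< n (β n) * (∏< n (λ t → ι 2 ^ t) * ∏< n (λ t → ι (t !)) * ∏< n (q n))))
        ≈⟨ *-congˡ (*-congˡ (*-cong ∏β (*-congˡ ∏q))) ⟩
      f⁻¹ * (ι 2 * (F * (∏< n (λ t → ι 2 ^ t) * ∏< n (λ t → ι (t !)) * (∏α * S))))
        ≈⟨ solve 7 (λ i t f p g a s → i :* (t :* (f :* (p :* g :* (a :* s)))) := a :*
             ((t :* p) :* (g :* i) :* f :* s)) refl
             f⁻¹ (ι 2) F (∏< n (λ t → ι 2 ^ t)) (∏< n (λ t → ι (t !))) ∏α S ⟩
      ∏α * ((ι 2 * ∏< n (λ t → ι 2 ^ t)) * (∏< n (λ t → ι (t !)) * f⁻¹) * F * S)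
        ≈⟨ *-congˡ (*-congʳ (*-congʳ (*-cong (ι2^C n) (sym (∏<-* n (λ t → ι (t !)) (λ i → 1/ 2 ℕ.* i ℕ.+ 1 !)))))) ⟩
      ∏α * productFormulaₓ n
        ∎)
      where
      d f f⁻¹ ∏α F S : Carrier
      d   = det< n entryₓ
      f   = ∏< n λ r → ι (suc (r ℕ.* 2) !)
      f⁻¹ = ∏< n λ i → 1/ 2 ℕ.* i ℕ.+ 1 !
      ∏α  = ∏< n (α n)
      F   = ∏< (suc ⌊ n /2⌋) (λ i → rise (x + ι (4 ℕ.* i) + 1#) (n ∸ 2 ℕ.* i))
      S   = ∏< (suc ⌊ m /2⌋) (λ i → rise (x - ι (2 ℕ.* i) + ι (3 ℕ.* n)) (n ∸ 2 ℕ.* i ∸ 1))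
      facts⁻¹ : f⁻¹ * f ≈ 1#
      facts⁻¹ = trans (sym (∏<-* n (λ i → 1/ 2 ℕ.* i ℕ.+ 1 !) (λ r → ι (suc (r ℕ.* 2) !)))) (∏<-1 n λ i _ →
        trans (*-congʳ (reflexive (≡.cong 1/_! (2j+1≡ i)))) (1/!*! (suc (i ℕ.* 2))))
      α-regular : ∀ l → l < n → Regular (α n l)
      α-regular l _ = ∏<-regular (l ℕ.* 2 ∸ n) _ λ k _ → regular-resp
        (trans (+-congˡ (trans (ι-+ (n ℕ.+ l ℕ.* 2) k) (+-congʳ (ι-+ n (l ℕ.* 2)))))
          (solve 4 (λ b n l k → b :+ (n :+ l :+ k) := b :+ n :+ l :+ k) refl b (ι n) (ι (l ℕ.* 2)) (ι k)))
        (regular (n ℕ.+ l ℕ.* 2 ℕ.+ k))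

-- Telescoping products of Gamma values

-- A Gamma function along b, b + 1, b + 2, ..., reduced to what the telescoping requires: the
-- recurrence and the right to cancel values.
record RisingSolution {c ℓ} (K : CommutativeRing c ℓ) (b : CommutativeRing.Carrier K) : Set (c ⊔ ℓ) where
  open CommutativeRing K
  open RingNotions K using (ι)
  open DeterminantEvaluation K using (Regular)
  field
    g         : ℕ → Carrier
    g-suc     : ∀ k → g (suc k) ≈ (b + ι k) * g k
    g-regular : ∀ k → Regular (g k)

module GammaProduct {c ℓ} (K : CommutativeRing c ℓ) (inverses : InverseFactorials K)
  (b : CommutativeRing.Carrier K) (solution : RisingSolution K b) where
  open CommutativeRing K hiding (zero)
  open RingNotions K using (_^_)
  open InverseFactorials inverses
  open DeterminantEvaluation K
  open RisingFactorials K inverses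
  open DeterminantValue K inverses b using (α; β; q; regular-resp)
  open RisingSolution solution
  open IntegerSolver K
  open SetoidReasoning setoid

  regular-* : ∀ {r s} → Regular r → Regular s → Regular (r * s)
  regular-* reg reg′ u v e =
    reg′ u v (reg _ _ (trans (sym (*-assoc _ _ _)) (trans e (*-assoc _ _ _))))

  regular-! : ∀ n → Regular (ι (n !))
  regular-! n u v e = begin
    u                        ≈⟨ unit u ⟨
    1/ n ! * (ι (n !) * u)   ≈⟨ *-congˡ e ⟩
    1/ n ! * (ι (n !) * v)   ≈⟨ unit v ⟩
    v                        ∎
    where
    unit : ∀ u → 1/ n ! * (ι (n !) * u) ≈ u
    unit u = trans (sym (*-assoc _ _ _)) (trans (*-congʳ (1/!*! n)) (*-identityˡ u))

  g-cong : ∀ {j k} → j ≡ k → g j ≈ g k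
  g-cong e = reflexive (≡.cong g e)

  b+ι-regular : ∀ k → Regular (b + ι k)
  b+ι-regular k u v e = g-regular (suc k) u v (begin
    g (suc k) * u                ≈⟨ *-congʳ (g-suc k) ⟩
    (b + ι k) * g k * u          ≈⟨ swap u ⟩
    (b + ι k) * u * g k          ≈⟨ *-congʳ e ⟩
    (b + ι k) * v * g k          ≈⟨ swap v ⟨
    (b + ι k) * g k * v          ≈⟨ *-congʳ (g-suc k) ⟨
    g (suc k) * v                ∎)
    where
    swap : ∀ u → (b + ι k) * g k * u ≈ (b + ι k) * u * g k
    swap u = solve 3 (λ r g u → r :* g :* u := r :* u :* g) refl (b + ι k) (g k) u

  rise-g : ∀ {γ} k p → γ ≈ b + ι k → rise γ p * g k ≈ g (k ℕ.+ p)
  rise-g k zero    e = trans (*-identityˡ _) (g-cong (≡.sym (ℕ.+-identityʳ k)))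
  rise-g {γ} k (suc p) e = begin
    rise γ (suc p) * g k                       ≈⟨ *-congʳ (rise-snoc γ p) ⟩
    rise γ p * (γ + ι p) * g k                 ≈⟨ solve 3 (λ r s g → r :* s :* g := s :* (r :* g)) refl _ _ _ ⟩
    (γ + ι p) * (rise γ p * g k)               ≈⟨ *-cong
        (trans (+-congʳ e) (trans (+-assoc _ _ _) (+-congˡ (sym (ι-+ k p))))) (rise-g k p e) ⟩
    (b + ι (k ℕ.+ p)) * g (k ℕ.+ p)            ≈⟨ g-suc (k ℕ.+ p) ⟨
    g (suc (k ℕ.+ p))                          ≡⟨ ≡.cong g (ℕ.+-suc k p) ⟨
    g (k ℕ.+ suc p)                            ∎

  module _ (n : ℕ) where

    -- For 2l ≤ n the factor `β l` is the quotient of g (n + 2l) by g (4l), for n ≤ 2l the factor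
    -- `α l` is the reciprocal quotient, and the other factor is 1. In this form the distinction
    -- between the two ranges of l disappears.
    β*g≈α*g : ∀ l → β n l * g (l ℕ.* 2 ℕ.* 2) ≈ α n l * g (n ℕ.+ l ℕ.* 2)
    β*g≈α*g l = by-cases (ℕ.≤-total L n)
      where
      L : ℕ
      L = l ℕ.* 2
      4l : L ℕ.* 2 ≡ L ℕ.+ L
      4l = ≡.trans (ℕ.*-comm L 2) (≡.cong (L ℕ.+_) (ℕ.+-identityʳ L))
      b+n+L : b + ι n + ι L ≈ b + ι (n ℕ.+ L)
      b+n+L = trans (+-assoc _ _ _) (+-congˡ (sym (ι-+ n L)))
      by-cases : L ≤ n ⊎ n ≤ L → β n l * g (L ℕ.* 2) ≈ α n l * g (n ℕ.+ L)
      by-cases (inj₁ L≤n) = begin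
        β n l * g (L ℕ.* 2)           ≈⟨ *-congˡ (g-cong 4l) ⟩
        β n l * g (L ℕ.+ L)           ≈⟨ rise-g (L ℕ.+ L) (n ∸ L) refl ⟩
        g (L ℕ.+ L ℕ.+ (n ∸ L))       ≈⟨ g-cong (≡.trans (ℕ.+-assoc L L (n ∸ L))
            (≡.trans (≡.cong (L ℕ.+_) (ℕ.m+[n∸m]≡n L≤n)) (ℕ.+-comm L n))) ⟩
        g (n ℕ.+ L)                   ≈⟨ *-identityˡ _ ⟨
        1# * g (n ℕ.+ L)              ≈⟨ *-congʳ (reflexive (≡.cong (rise (b + ι n + ι L)) (ℕ.m≤n⇒m∸n≡0 L≤n))) ⟨
        α n l * g (n ℕ.+ L)           ∎
      by-cases (inj₂ n≤L) = begin
        β n l * g (L ℕ.* 2)           ≈⟨ *-congʳ (reflexive (≡.cong (rise (b + ι (L ℕ.+ L))) (ℕ.m≤n⇒m∸n≡0 n≤L))) ⟩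
        1# * g (L ℕ.* 2)              ≈⟨ *-identityˡ _ ⟩
        g (L ℕ.* 2)                   ≈⟨ g-cong (≡.trans 4l (≡.trans (≡.cong (L ℕ.+_) (≡.sym (ℕ.m+[n∸m]≡n n≤L)))
                                           (≡.trans (≡.sym (ℕ.+-assoc L n (L ∸ n))) (≡.cong (ℕ._+ (L ∸ n))
                                               (ℕ.+-comm L n))))) ⟩
        g (n ℕ.+ L ℕ.+ (L ∸ n))       ≈⟨ rise-g (n ℕ.+ L) (L ∸ n) b+n+L ⟨
        α n l * g (n ℕ.+ L)           ∎

    q*g : ∀ t → q n t * g (n ℕ.* 2 ℕ.+ t) ≈ g ((n ℕ.+ t) ℕ.* 2)
    q*g t = trans (rise-g (n ℕ.* 2 ℕ.+ t) t (trans
        (solve 3 (λ b n t → b :+ n :+ n :+ t := b :+ (n :* con (+ 2) :+ t)) refl b (ι n) (ι t))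
        (+-congˡ (sym (trans (ι-+ (n ℕ.* 2) t) (+-congʳ (ι-* n 2)))))))
      (g-cong (≡.trans (ℕ.+-assoc (n ℕ.* 2) t t) (≡.trans
        (≡.cong (n ℕ.* 2 ℕ.+_) (≡.sym (≡.trans (ℕ.*-comm t 2) (≡.cong (t ℕ.+_) (ℕ.+-identityʳ t)))))
        (≡.sym (ℕ.*-distribʳ-+ 2 n t)))))

  -- With g k = Γ (b + k), the determinant is 2 numerator n / denominator n; each
  -- of the products G₁, ..., G₄ telescopes from n to n + 1.
  Fₙ Tₙ G₁ G₂ G₃ G₄ denominator numerator : ℕ → Carrier
  Fₙ n = ∏< n λ l → ι (suc (l ℕ.* 2) !)
  Tₙ n = ∏< n λ l → ι 2 ^ l * ι (l !)
  G₁ n = ∏< n λ l → g (n ℕ.+ l ℕ.* 2)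
  G₂ n = ∏< n λ l → g ((n ℕ.+ l) ℕ.* 2)
  G₃ n = ∏< n λ l → g (n ℕ.* 2 ℕ.+ l)
  G₄ n = ∏< n λ l → g (l ℕ.* 2 ℕ.* 2)
  denominator n = Fₙ n * G₄ n * G₃ n
  numerator   n = Tₙ n * G₁ n * G₂ n

  ∏g-regular : ∀ n (f : ℕ → ℕ) → Regular (∏< n λ l → g (f l))
  ∏g-regular n f = ∏<-regular n (g ∘ f) λ l _ → g-regular (f l)

  denominator-regular : ∀ n → Regular (denominator n)
  denominator-regular n = regular-*
    (regular-* (∏<-regular n (λ l → ι (suc (l ℕ.* 2) !)) λ l _ → regular-! (suc (l ℕ.* 2)))
        (∏g-regular n λ l → l ℕ.* 2 ℕ.* 2))
    (∏g-regular n λ l → n ℕ.* 2 ℕ.+ l)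

  α-regular : ∀ n → Regular (∏< n (α n))
  α-regular n = ∏<-regular n (α n) λ l _ → ∏<-regular (l ℕ.* 2 ∸ n) _ λ k _ → regular-resp
    (trans (+-congˡ (trans (ι-+ (n ℕ.+ l ℕ.* 2) k) (+-congʳ (ι-+ n (l ℕ.* 2)))))
      (solve 4 (λ b n l k → b :+ (n :+ l :+ k) := b :+ n :+ l :+ k) refl b (ι n) (ι (l ℕ.* 2)) (ι k)))
    (b+ι-regular (n ℕ.+ l ℕ.* 2 ℕ.+ k))

  evaluate : ∀ n d → Fₙ n * ∏< n (α n) * d ≈ ι 2 * (∏< n (β n) * ∏< n (λ t → ι 2 ^ t * ι (t !) * q n t)) →
    d * denominator n ≈ ι 2 * numerator n
  evaluate n d e = α-regular n _ _ (begin
    ∏α * (d * (Fₙ n * G₄ n * G₃ n))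
      ≈⟨ solve 5 (λ a d f h k → a :* (d :* (f :* h :* k)) := (f :* a :* d) :* (h :* k)) refl ∏α d (Fₙ n) (G₄ n)
           (G₃ n) ⟩
    Fₙ n * ∏α * d * (G₄ n * G₃ n)
      ≈⟨ *-congʳ e ⟩
    ι 2 * (∏< n (β n) * ∏< n (λ t → ι 2 ^ t * ι (t !) * q n t)) * (G₄ n * G₃ n)
      ≈⟨ *-congʳ (*-congˡ (*-congˡ (∏<-* n (λ t → ι 2 ^ t * ι (t !)) (q n)))) ⟩
    ι 2 * (∏< n (β n) * (Tₙ n * ∏< n (q n))) * (G₄ n * G₃ n)
      ≈⟨ solve 6 (λ s b t q h k → s :* (b :* (t :* q)) :* (h :* k) := s :* (t :* ((b :* h) :* (q :* k)))) refl
           (ι 2) (∏< n (β n)) (Tₙ n) (∏< n (q n)) (G₄ n) (G₃ n) ⟩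
    ι 2 * (Tₙ n * ((∏< n (β n) * G₄ n) * (∏< n (q n) * G₃ n)))
      ≈⟨ *-congˡ (*-congˡ (*-cong
           (trans (sym (∏<-* n (β n) (λ l → g (l ℕ.* 2 ℕ.* 2))))
               (trans (∏<-cong′ n (β*g≈α*g n)) (∏<-* n (α n) (λ l → g (n ℕ.+ l ℕ.* 2)))))
           (trans (sym (∏<-* n (q n) (λ l → g (n ℕ.* 2 ℕ.+ l)))) (∏<-cong′ n (q*g n))))) ⟩
    ι 2 * (Tₙ n * ((∏α * G₁ n) * G₂ n))
      ≈⟨ solve 5 (λ s t a h k → s :* (t :* ((a :* h) :* k)) := a :* (s :* (t :* h :* k))) refl (ι 2) (Tₙ n) ∏α
           (G₁ n) (G₂ n) ⟩
    ∏α * (ι 2 * (Tₙ n * G₁ n * G₂ n))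
      ∎)
    where
    ∏α : Carrier
    ∏α = ∏< n (α n)

  -- Going from n to n + 1 raises each argument n + 2l in `G₁` by one, at the cost of one factor
  -- each. These factors advance in steps of 2, which is the origin of the Gamma functions at half
  -- arguments.
  stepFactor : ℕ → Carrier
  stepFactor n = ∏< n λ l → b + ι (n ℕ.+ l ℕ.* 2)

  -- The quotient of `numerator` by `denominator` changes by ρ from n to n + 1. Here g (2n), g (3n +
  -- 1) and g (4n), which the four products contribute on both sides, have already been cancelled.
  IsRatio : ℕ → Carrier → Set ℓ
  IsRatio n ρ = ρ * (ι (suc (n ℕ.* 2) !) * g (n ℕ.* 2 ℕ.+ n) * g (n ℕ.* 2 ℕ.+ suc (suc n)))
    ≈ ι 2 ^ n * ι (n !) * stepFactor n * g (suc (n ℕ.* 2)) * g (suc (suc (n ℕ.* 2 ℕ.* 2)))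

  G₁-suc : ∀ n → G₁ (suc n) ≈ g (n ℕ.* 2 ℕ.+ suc n) * stepFactor n * G₁ n
  G₁-suc n = begin
    ∏< (suc n) (λ l → g (suc n ℕ.+ l ℕ.* 2))
      ≈⟨ ∏<-snoc n (λ l → g (suc n ℕ.+ l ℕ.* 2)) ⟩
    ∏< n (λ l → g (suc n ℕ.+ l ℕ.* 2)) * g (suc n ℕ.+ n ℕ.* 2)
      ≈⟨ *-cong (trans (∏<-cong′ n λ l → g-suc (n ℕ.+ l ℕ.* 2))
           (∏<-* n (λ l → b + ι (n ℕ.+ l ℕ.* 2)) (λ l → g (n ℕ.+ l ℕ.* 2))))
                (g-cong (ℕ.+-comm (suc n) (n ℕ.* 2))) ⟩
    stepFactor n * G₁ n * g (n ℕ.* 2 ℕ.+ suc n)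
      ≈⟨ solve 3 (λ s h c → s :* h :* c := c :* s :* h) refl _ _ _ ⟩
    g (n ℕ.* 2 ℕ.+ suc n) * stepFactor n * G₁ n
      ∎

  G₂-suc : ∀ n → G₂ (suc n) * g (n ℕ.* 2) ≈ G₂ n * g (n ℕ.* 2 ℕ.* 2) * g (suc (suc (n ℕ.* 2 ℕ.* 2)))
  G₂-suc n = begin
    G₂ (suc n) * g (n ℕ.* 2)
      ≈⟨ *-comm _ _ ⟩
    g (n ℕ.* 2) * ∏< (suc n) (λ l → g ((suc n ℕ.+ l) ℕ.* 2))
      ≈⟨ *-cong (g-cong (≡.cong (ℕ._* 2) (≡.sym (ℕ.+-identityʳ n))))
           (∏<-cong′ (suc n) λ l → g-cong (≡.cong (ℕ._* 2) (≡.sym (ℕ.+-suc n l)))) ⟩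
    ∏< (suc (suc n)) (λ l → g ((n ℕ.+ l) ℕ.* 2))
      ≈⟨ trans (∏<-snoc (suc n) (λ l → g ((n ℕ.+ l) ℕ.* 2))) (*-congʳ (∏<-snoc n (λ l → g ((n ℕ.+ l) ℕ.* 2)))) ⟩
    G₂ n * g ((n ℕ.+ n) ℕ.* 2) * g ((n ℕ.+ suc n) ℕ.* 2)
      ≈⟨ *-cong (*-congˡ (g-cong (≡.cong (ℕ._* 2) n+n)))
           (g-cong (≡.cong (ℕ._* 2) (≡.trans (ℕ.+-suc n n) (≡.cong suc n+n)))) ⟩
    G₂ n * g (n ℕ.* 2 ℕ.* 2) * g (suc (suc (n ℕ.* 2 ℕ.* 2)))
      ∎
    where
    n+n : n ℕ.+ n ≡ n ℕ.* 2
    n+n = ≡.sym (≡.trans (ℕ.*-comm n 2) (≡.cong (n ℕ.+_) (ℕ.+-identityʳ n)))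

  G₃-suc : ∀ n → G₃ (suc n) * (g (n ℕ.* 2) * g (suc (n ℕ.* 2)))
    ≈ G₃ n * g (n ℕ.* 2 ℕ.+ n) * g (n ℕ.* 2 ℕ.+ suc n) * g (n ℕ.* 2 ℕ.+ suc (suc n))
  G₃-suc n = begin
    G₃ (suc n) * (g (n ℕ.* 2) * g (suc (n ℕ.* 2)))
      ≈⟨ solve 3 (λ h x y → h :* (x :* y) := x :* (y :* h)) refl _ _ _ ⟩
    g (n ℕ.* 2) * (g (suc (n ℕ.* 2)) * ∏< (suc n) (λ l → g (suc (suc (n ℕ.* 2 ℕ.+ l)))))
      ≈⟨ *-cong (g-cong (≡.sym (ℕ.+-identityʳ (n ℕ.* 2)))) (*-cong (g-cong (≡.sym (ℕ.+-comm (n ℕ.* 2) 1)))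
           (∏<-cong′ (suc n) λ l → g-cong (≡.sym (≡.trans (ℕ.+-suc (n ℕ.* 2) (suc l))
               (≡.cong suc (ℕ.+-suc (n ℕ.* 2) l)))))) ⟩
    ∏< (suc (suc (suc n))) (λ l → g (n ℕ.* 2 ℕ.+ l))
      ≈⟨ trans (∏<-snoc (suc (suc n)) f) (*-congʳ (trans (∏<-snoc (suc n) f) (*-congʳ (∏<-snoc n f)))) ⟩
    G₃ n * g (n ℕ.* 2 ℕ.+ n) * g (n ℕ.* 2 ℕ.+ suc n) * g (n ℕ.* 2 ℕ.+ suc (suc n))
      ∎
    where
    f : ℕ → Carrier
    f l = g (n ℕ.* 2 ℕ.+ l)

  ratio-step : ∀ n ρ → IsRatio n ρ → numerator (suc n) * denominator n ≈ denominator (suc n) * numerator n * ρ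
  -- The telescoping of `G₂` needs the additional factor g (2n), that of `G₃` the factor g (2n) g
  -- (2n + 1). Both are multiplied on and cancelled by regularity.
  ratio-step n ρ isRatio = regular-* (g-regular (n ℕ.* 2))
      (regular-* (g-regular (n ℕ.* 2)) (g-regular (suc (n ℕ.* 2)))) _ _ (begin
    a₀ * (a₀ * a₁) * (Tₙ (suc n) * G₁ (suc n) * G₂ (suc n) * (Fₙ n * G₄ n * G₃ n))
      ≈⟨ *-congˡ (*-congʳ (*-congʳ (*-cong (∏<-snoc n λ l → ι 2 ^ l * ι (l !)) (G₁-suc n)))) ⟩
    a₀ * (a₀ * a₁) * (Tₙ n * τ * (c₁ * P * G₁ n) * G₂ (suc n) * (Fₙ n * G₄ n * G₃ n))
      ≈⟨ solve 11 (λ a a′ t τ c p h x f k j → a :* (a :* a′) :* (t :* τ :* (c :* p :* h) :* x :* (f :* k :* j))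
           := (x :* a) :* (a :* a′ :* t :* τ :* c :* p :* h :* f :* k :* j)) refl
           a₀ a₁ (Tₙ n) τ c₁ P (G₁ n) (G₂ (suc n)) (Fₙ n) (G₄ n) (G₃ n) ⟩
    (G₂ (suc n) * a₀) * (a₀ * a₁ * Tₙ n * τ * c₁ * P * G₁ n * Fₙ n * G₄ n * G₃ n)
      ≈⟨ *-congʳ (G₂-suc n) ⟩
    (G₂ n * d₀ * d₂) * (a₀ * a₁ * Tₙ n * τ * c₁ * P * G₁ n * Fₙ n * G₄ n * G₃ n)
      ≈⟨ solve 13 (λ x d d′ a a′ t τ c p h f k j → (x :* d :* d′) :* (a :* a′ :* t :* τ :* c :* p :* h :* f :* k :* j)
           := (τ :* p :* a′ :* d′) :* (x :* d :* a :* t :* c :* h :* f :* k :* j)) refl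
           (G₂ n) d₀ d₂ a₀ a₁ (Tₙ n) τ c₁ P (G₁ n) (Fₙ n) (G₄ n) (G₃ n) ⟩
    (τ * P * a₁ * d₂) * (G₂ n * d₀ * a₀ * Tₙ n * c₁ * G₁ n * Fₙ n * G₄ n * G₃ n)
      ≈⟨ *-congʳ isRatio ⟨
    (ρ * (φ * c₀ * c₂)) * (G₂ n * d₀ * a₀ * Tₙ n * c₁ * G₁ n * Fₙ n * G₄ n * G₃ n)
      ≈⟨ solve 13 (λ r φ c c₂ x d a t c₁ h f k j → (r :* (φ :* c :* c₂)) :*
           (x :* d :* a :* t :* c₁ :* h :* f :* k :* j)
           := (j :* c :* c₁ :* c₂) :* (r :* φ :* x :* d :* a :* t :* h :* f :* k)) refl
           ρ φ c₀ c₂ (G₂ n) d₀ a₀ (Tₙ n) c₁ (G₁ n) (Fₙ n) (G₄ n) (G₃ n) ⟩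
    (G₃ n * c₀ * c₁ * c₂) * (ρ * φ * G₂ n * d₀ * a₀ * Tₙ n * G₁ n * Fₙ n * G₄ n)
      ≈⟨ *-congʳ (G₃-suc n) ⟨
    (G₃ (suc n) * (a₀ * a₁)) * (ρ * φ * G₂ n * d₀ * a₀ * Tₙ n * G₁ n * Fₙ n * G₄ n)
      ≈⟨ solve 11 (λ y a a′ r φ x d t h f k → (y :* (a :* a′)) :* (r :* φ :* x :* d :* a :* t :* h :* f :* k)
           := a :* (a :* a′) :* ((f :* φ) :* (k :* d) :* y :* (t :* h :* x) :* r)) refl
           (G₃ (suc n)) a₀ a₁ ρ φ (G₂ n) d₀ (Tₙ n) (G₁ n) (Fₙ n) (G₄ n) ⟩
    a₀ * (a₀ * a₁) * ((Fₙ n * φ) * (G₄ n * d₀) * G₃ (suc n) * numerator n * ρ)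
      ≈⟨ *-congˡ (*-congʳ (*-congʳ (*-congʳ (*-cong (∏<-snoc n λ l → ι (suc (l ℕ.* 2) !))
           (∏<-snoc n λ l → g (l ℕ.* 2 ℕ.* 2)))))) ⟨
    a₀ * (a₀ * a₁) * (denominator (suc n) * numerator n * ρ)
      ∎)
    where
    a₀ a₁ c₀ c₁ c₂ d₀ d₂ P τ φ : Carrier
    a₀ = g (n ℕ.* 2)
    a₁ = g (suc (n ℕ.* 2))
    c₀ = g (n ℕ.* 2 ℕ.+ n)
    c₁ = g (n ℕ.* 2 ℕ.+ suc n)
    c₂ = g (n ℕ.* 2 ℕ.+ suc (suc n))
    d₀ = g (n ℕ.* 2 ℕ.* 2)
    d₂ = g (suc (suc (n ℕ.* 2 ℕ.* 2)))
    P  = stepFactor n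
    τ  = ι 2 ^ n * ι (n !)
    φ  = ι (suc (n ℕ.* 2) !)

  numerator≈ : ∀ ρ → (∀ n → IsRatio n (ρ n)) → ∀ n → numerator n ≈ denominator n * ∏< n ρ
  numerator≈ ρ isRatio zero    = sym (*-identityʳ _)
  numerator≈ ρ isRatio (suc n) = denominator-regular n _ _ (begin
    denominator n * numerator (suc n)                          ≈⟨ *-comm _ _ ⟩
    numerator (suc n) * denominator n                          ≈⟨ ratio-step n (ρ n) (isRatio n) ⟩
    denominator (suc n) * numerator n * ρ n                    ≈⟨ *-congʳ (*-congˡ (numerator≈ ρ isRatio n)) ⟩
    denominator (suc n) * (denominator n * ∏< n ρ) * ρ
        n       ≈⟨ solve 4 (λ a b p r → a :* (b :* p) :* r := b :* (a :* (p :* r))) refl _ _ _ _ ⟩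
    denominator n * (denominator (suc n) * (∏< n ρ * ρ n))     ≈⟨ *-congˡ (*-congˡ (∏<-snoc n ρ)) ⟨
    denominator n * (denominator (suc n) * ∏< (suc n) ρ)       ∎)

  gamma-product : ∀ ρ → (∀ n → IsRatio n (ρ n)) → ∀ n d →
    Fₙ n * ∏< n (α n) * d ≈ ι 2 * (∏< n (β n) * ∏< n (λ t → ι 2 ^ t * ι (t !) * q n t)) →
    d ≈ ι 2 * ∏< n ρ
  gamma-product ρ isRatio n d e = denominator-regular n _ _ (begin
    denominator n * d                      ≈⟨ *-comm _ _ ⟩
    d * denominator n                      ≈⟨ evaluate n d e ⟩
    ι 2 * numerator n                      ≈⟨ *-congˡ (numerator≈ ρ isRatio n) ⟩
    ι 2 * (denominator n * ∏< n ρ)         ≈⟨ solve 3 (λ s a p → s :* (a :* p) := a :* (s :* p)) refl _ _ _ ⟩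
    denominator n * (ι 2 * ∏< n ρ)         ∎)

  -- Matches the shape of a Gamma factor with i = n + 1. `z1` and `zh` are meant to be the values of
  -- Γ at 1 and at (x + i) / 2: the functional equation determines neither, but each occurs once
  -- above and once below and cancels.
  isRatio : ∀ n {ρ N D z1 zh t i₁ i₂ i₄ j₂ j₃ j₃′ Q p} → ρ * D ≈ N →
    N ≡ p * i₁ * i₂ * i₄ * t → D ≡ j₂ * j₃ * j₃′ * zh →
    p ≈ ι 2 ^ n * ι 2 ^ n → i₁ ≈ ι (n !) * z1 → i₂ ≈ g (suc (n ℕ.* 2)) → i₄ ≈ g (suc (suc (n ℕ.* 2 ℕ.* 2))) →
    t ≈ Q * zh → j₂ ≈ ι (suc (n ℕ.* 2) !) * z1 → j₃ ≈ g (n ℕ.* 2 ℕ.+ suc (suc n)) → j₃′ ≈ g (n ℕ.* 2 ℕ.+ n) →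
    ι 2 ^ n * Q ≈ stepFactor n → Regular z1 → Regular zh → IsRatio n ρ
  isRatio n {ρ} {z1 = z1} {zh} {Q = Q} e ≡.refl ≡.refl p≈ i₁≈ i₂≈ i₄≈ t≈ j₂≈ j₃≈ j₃′≈ Q≈ reg reg′ = regular-*
      reg reg′ _ _ (begin
    z1 * zh * (ρ * (φ * c₀ * c₂))
      ≈⟨ solve 6 (λ z h r φ c d → z :* h :* (r :* (φ :* c :* d)) := r :* (φ :* z :* d :* c :* h)) refl z1 zh ρ φ
           c₀ c₂ ⟩
    ρ * (φ * z1 * c₂ * c₀ * zh)
      ≈⟨ *-congˡ (*-congʳ (*-cong (*-cong j₂≈ j₃≈) j₃′≈)) ⟨
    ρ * _
      ≈⟨ e ⟩
    _
      ≈⟨ *-cong (*-cong (*-cong (*-cong p≈ i₁≈) i₂≈) i₄≈) t≈ ⟩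
    ι 2 ^ n * ι 2 ^ n * (ι (n !) * z1) * a₁ * d₂ * (Q * zh)
      ≈⟨ solve 7 (λ p f z a d Q h → p :* p :* (f :* z) :* a :* d :* (Q :* h) := z :* h :*
           (p :* f :* (p :* Q) :* a :* d)) refl
           (ι 2 ^ n) (ι (n !)) z1 a₁ d₂ Q zh ⟩
    z1 * zh * (ι 2 ^ n * ι (n !) * (ι 2 ^ n * Q) * a₁ * d₂)
      ≈⟨ *-congˡ (*-congʳ (*-congʳ (*-congˡ Q≈))) ⟩
    z1 * zh * (ι 2 ^ n * ι (n !) * stepFactor n * a₁ * d₂)
      ∎)
    where
    φ a₁ c₀ c₂ d₂ : Carrier
    φ  = ι (suc (n ℕ.* 2) !)
    a₁ = g (suc (n ℕ.* 2))
    c₀ = g (n ℕ.* 2 ℕ.+ n)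
    c₂ = g (n ℕ.* 2 ℕ.+ suc (suc n))
    d₂ = g (suc (suc (n ℕ.* 2 ℕ.* 2)))

-- Passing to the fraction field

module FractionProperties {c ℓ} (R : CommutativeRing c ℓ) (domain : DiscreteDomain R)
  (inverses : InverseFactorials R) where
  open CommutativeRing R hiding (zero)
  open FractionField R domain
  open InverseFactorials inverses
  module F = CommutativeRing commutativeRing
  open RisingFactorials R inverses using (ι; rise; ι-+; ι-*; ∏<)
  open RingNotions R using (_^_)
  module RN = DeterminantEvaluation R
  open DeterminantEvaluation commutativeRing using (Regular; ∏<-cong′)
  open RingNotions commutativeRing using () renaming (ι to ιᶠ; _^_ to _^ᶠ_; ∏< to ∏ᶠ<; pochhammer to riseᶠ)
  open IntegerSolver R

  regular : ∀ {a} → ¬ a ≈ 0# → RN.Regular a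
  regular {a} a≉0 u v e = cancelʳ u v a a≉0 (trans (*-comm u a) (trans e (*-comm a v)))

  embed-cong : ∀ {a b} → a ≈ b → embed a ≈ᶠ embed b
  embed-cong e = mk≈ (*-congʳ e)

  embed-+ : ∀ a b → embed (a + b) ≈ᶠ embed a +ᶠ embed b
  embed-+ a b = mk≈ (solve 2 (λ a b → (a :+ b) :* (con (+ 1) :* con (+ 1))
    := (a :* con (+ 1) :+ b :* con (+ 1)) :* con (+ 1)) refl a b)

  embed-* : ∀ a b → embed (a * b) ≈ᶠ embed a *ᶠ embed b
  embed-* a b = mk≈ (solve 2 (λ a b → (a :* b) :* (con (+ 1) :* con (+ 1)) := (a :* b) :* con (+ 1)) refl a b)

  embed-ι : ∀ n → embed (ι n) ≈ᶠ ιᶠ n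
  embed-ι zero    = F.refl
  embed-ι (suc n) = F.trans (embed-+ 1# (ι n)) (F.+-cong {embed 1#} {embed 1#} {embed (ι n)} {ιᶠ n} F.refl
      (embed-ι n))

  embed-2^ : ∀ n → embed (ι 2 ^ n) ≈ᶠ ιᶠ 2 ^ᶠ n
  embed-2^ zero    = F.refl
  embed-2^ (suc n) = F.trans (embed-* (ι 2) (ι 2 ^ n))
    (F.*-cong {embed (ι 2)} {ιᶠ 2} {embed (ι 2 ^ n)} {ιᶠ 2 ^ᶠ n} (embed-ι 2) (embed-2^ n))

  embed-∏< : ∀ n f → embed (∏< n f) ≈ᶠ ∏ᶠ< n (λ i → embed (f i))
  embed-∏< zero    f = F.refl
  embed-∏< (suc n) f = F.trans (embed-* (f 0) (∏< n (f ∘ suc)))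
    (F.*-cong {embed (f 0)} {embed (f 0)} {embed (∏< n (f ∘ suc))} {∏ᶠ< n (λ i → embed (f (suc i)))} F.refl
        (embed-∏< n (f ∘ suc)))

  embed-rise : ∀ {a β} p → embed a ≈ᶠ β → embed (rise a p) ≈ᶠ riseᶠ β p
  embed-rise {a} {β} p e = F.trans (embed-∏< p λ k → a + ι k)
      (∏<-cong′ p {λ k → embed (a + ι k)} {λ k → β +ᶠ ιᶠ k} λ k →
    F.trans (embed-+ a (ι k)) (F.+-cong {embed a} {β} {embed (ι k)} {ιᶠ k} e (embed-ι k)))

  regularᶠ : ∀ f → ¬ f ≈ᶠ 0ᶠ → Regular f
  regularᶠ f f≉0 u v e = F.trans (F.sym (unit u)) (F.trans (F.*-congˡ {f ⁻¹} e) (unit v))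
    where
    unit : ∀ u → f ⁻¹ *ᶠ (f *ᶠ u) ≈ᶠ u
    unit u = F.trans (F.sym (F.*-assoc (f ⁻¹) f u)) (F.trans
      (F.*-congʳ {u} (F.trans (F.*-comm (f ⁻¹) f) (inverseʳ f f≉0))) (F.*-identityˡ u))

  /-*-cancel : ∀ f g → ¬ g ≈ᶠ 0ᶠ → (f /ᶠ g) *ᶠ g ≈ᶠ f
  /-*-cancel f g g≉0 = F.trans (F.*-assoc f (g ⁻¹) g) (F.trans
    (F.*-congˡ {f} (F.trans (F.*-comm (g ⁻¹) g) (inverseʳ g g≉0))) (F.*-identityʳ f))

  *ᶠ-≉0 : ∀ f g → ¬ f ≈ᶠ 0ᶠ → ¬ g ≈ᶠ 0ᶠ → ¬ f *ᶠ g ≈ᶠ 0ᶠ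
  *ᶠ-≉0 f g f≉0 g≉0 e = g≉0 (regularᶠ f f≉0 g 0ᶠ (F.trans e (F.sym (F.zeroʳ f))))

  inversesᶠ : InverseFactorials commutativeRing
  inversesᶠ = record
    { 1/_!  = λ n → embed (1/ n !)
    ; 1/!*! = λ n → F.trans (F.*-congˡ {embed (1/ n !)} (F.sym (embed-ι (n !))))
        (F.trans (F.sym (embed-* (1/ n !) (ι (n !)))) (embed-cong (1/!*! n)))
    }

-- The Gamma formula

-- The laws of `GammaFunction` over an arbitrary domain, so that the particular ring ℚ[x] enters
-- only at the end.
record FunctionalEquation {c ℓ} (R : CommutativeRing c ℓ) (domain : DiscreteDomain R) : Set (c ⊔ ℓ) where
  open CommutativeRing R
  open FractionField R domain using (Fraction; _≈ᶠ_; _*ᶠ_; 0ᶠ; embed)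
  field
    Γ            : Carrier → Fraction
    Γ-cong       : ∀ {z w} → z ≈ w → Γ z ≈ᶠ Γ w
    Γ-nonzero    : ∀ z → ¬ Γ z ≈ᶠ 0ᶠ
    Γ-functional : ∀ z → ¬ z ≈ 0# → Γ (z + 1#) ≈ᶠ embed z *ᶠ Γ z

-- Apart from positive integers, the functional equation is applied only at x + 1 + k and at (i + x)
-- / 2 + k. That these are never zero is what makes `x` an indeterminate for the present purpose.
record Indeterminate {c ℓ} (R : CommutativeRing c ℓ) : Set (c ⊔ ℓ) where
  open CommutativeRing R
  open RingNotions R using (ι)
  field
    x        : Carrier
    ½        : Carrier
    ½*2≈1    : ½ * ι 2 ≈ 1#
    x+1+ι≉0  : ∀ k → ¬ x + 1# + ι k ≈ 0#
    ½x+ι≉0   : ∀ i k → ¬ ½ * (ι i + x) + ι k ≈ 0#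

module GammaFormula {c ℓ} (R : CommutativeRing c ℓ) (domain : DiscreteDomain R) (inverses : InverseFactorials R)
  (indeterminate : Indeterminate R) (equation : FunctionalEquation R domain) where
  open CommutativeRing R hiding (zero)
  open DiscreteDomain domain
  open FractionField R domain
  open FunctionalEquation equation
  open Indeterminate indeterminate
  open FractionProperties R domain inverses
  open RisingFactorials R inverses
  open DeterminantEvaluation R using (∏<-cong′; ∏<-*)
  open DeterminantValue R inverses (x + 1#) using (α; β; q; factorial-quotient; ∏<-constant)
  open RingNotions R using (_^_)
  open RingNotions commutativeRing using () renaming (ι to ιᶠ; _^_ to _^ᶠ_; ∏< to ∏ᶠ<)
  open DeterminantEvaluation commutativeRing using () renaming (∏<-cong′ to ∏ᶠ<-cong)
  open import Algebra.Properties.Semiring.Exp F.semiring using () renaming (^-homo-* to ^ᶠ-+)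
  open IntegerSolver R

  b : Carrier
  b = x + 1#

  bᶠ : Fraction
  bᶠ = embed b

  embed-b+ι : ∀ k → embed (b + ι k) ≈ᶠ bᶠ +ᶠ ιᶠ k
  embed-b+ι k = F.trans (embed-+ b (ι k)) (F.+-congˡ {bᶠ} (embed-ι k))

  solution : RisingSolution commutativeRing bᶠ
  solution = record
    { g         = λ k → Γ (b + ι k)
    ; g-suc     = λ k → F.trans (Γ-cong (solve 2 (λ b k → b :+ (con (+ 1) :+ k) := b :+ k :+ con (+ 1)) refl b (ι k)))
        (F.trans (Γ-functional (b + ι k) (x+1+ι≉0 k)) (F.*-congʳ {Γ (b + ι k)} (embed-b+ι k)))
    ; g-regular = λ k → regularᶠ (Γ (b + ι k)) (Γ-nonzero (b + ι k))
    }

  module P = GammaProduct commutativeRing inversesᶠ bᶠ solution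
  module V = DeterminantValue commutativeRing inversesᶠ bᶠ

  Γ-rise : ∀ z p → (∀ k → ¬ z + ι k ≈ 0#) → Γ (z + ι p) ≈ᶠ embed (rise z p) *ᶠ Γ z
  Γ-rise z zero    z≉0 = F.trans (Γ-cong (+-identityʳ z)) (F.sym (F.*-identityˡ (Γ z)))
  Γ-rise z (suc p) z≉0 = begin
    Γ (z + ι (suc p))                              ≈⟨ Γ-cong
        (solve 2 (λ b k → b :+ (con (+ 1) :+ k) := b :+ k :+ con (+ 1)) refl z (ι p)) ⟩
    Γ (z + ι p + 1#)                               ≈⟨ Γ-functional (z + ι p) (z≉0 p) ⟩
    embed (z + ι p) *ᶠ Γ (z + ι p)                 ≈⟨ F.*-congˡ {embed (z + ι p)} (Γ-rise z p z≉0) ⟩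
    embed (z + ι p) *ᶠ (embed (rise z p) *ᶠ Γ z)   ≈⟨ F.*-assoc (embed (z + ι p)) (embed (rise z p)) (Γ z) ⟨
    embed (z + ι p) *ᶠ embed (rise z p) *ᶠ Γ z     ≈⟨ F.*-congʳ {Γ z} (F.trans (F.sym (embed-* (z + ι p) (rise z p)))
                                                        (embed-cong (trans (*-comm _ _) (sym (rise-snoc z p))))) ⟩
    embed (rise z (suc p)) *ᶠ Γ z                  ∎
    where open SetoidReasoning F.setoid

  ι-suc≉0 : ∀ m → ¬ ι (suc m) ≈ 0#
  ι-suc≉0 m e = 1≉0 (ι-suc-regular m 1# 0# (trans (*-congʳ e) (trans (zeroˡ 1#) (sym (zeroʳ _)))))

  Γ-factorial : ∀ m → Γ (ι (suc m)) ≈ᶠ ιᶠ (m !) *ᶠ Γ (ι 1)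
  Γ-factorial m = begin
    Γ (ι (suc m))                       ≈⟨ Γ-cong (+-congʳ (sym (+-identityʳ 1#))) ⟩
    Γ (ι 1 + ι m)                       ≈⟨ Γ-rise (ι 1) m (λ k e → ι-suc≉0 k (trans (sym (1+ k)) e)) ⟩
    embed (rise (ι 1) m) *ᶠ Γ (ι 1)     ≈⟨ F.*-congʳ {Γ (ι 1)} (F.trans (embed-cong rise≈) (embed-ι (m !))) ⟩
    ιᶠ (m !) *ᶠ Γ (ι 1)                 ∎
    where
    open SetoidReasoning F.setoid
    1+ : ∀ k → ι 1 + ι k ≈ ι (suc k)
    1+ k = +-congʳ (+-identityʳ 1#)
    rise≈ : rise (ι 1) m ≈ ι (m !)
    rise≈ = trans (∏<-cong′ m 1+) (trans (sym (factorial-quotient 0 m)) (trans (*-congˡ 1/0!) (*-identityʳ _)))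

  factor : ℕ → Fraction
  factor i =
      (ιᶠ 2 ^ᶠ (2 ℕ.* i ∸ 2) *ᶠ Γ (ι i) *ᶠ Γ (ι (2 ℕ.* i) + x)
        *ᶠ Γ (ι (4 ℕ.* i) + x - 1#) *ᶠ Γ (½ * (ι (3 ℕ.* i) + x - ι 2)))
    /ᶠ (Γ (ι (2 ℕ.* i)) *ᶠ Γ (ι (3 ℕ.* i) + x)
        *ᶠ Γ (ι (3 ℕ.* i) + x - ι 2) *ᶠ Γ (½ * (ι i + x)))

  factor-isRatio : ∀ n → P.IsRatio n (factor (suc n))
  factor-isRatio n = P.isRatio n {factor (suc n)} {z1 = Γ (ι 1)} {Γ w} {Q = embed (rise w n)}
    (/-*-cancel _ _ denominator≉0) ≡.refl ≡.refl
    (F.trans (F.reflexive (≡.cong (ιᶠ 2 ^ᶠ_) (≡.cong (_∸ 2) 2*suc-n≡))) (^ᶠ-+ (ιᶠ 2) n n))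
    (Γ-factorial n)
    (Γ-cong (trans (+-congʳ (ι-* 2 (suc n))) (trans
      (solve 2 (λ x n → con (+ 2) :* (con (+ 1) :+ n) :+ x := x :+ con (+ 1) :+ (con (+ 1) :+ n :* con (+ 2)))
          refl x (ι n))
      (+-congˡ (+-congˡ (sym (ι-* n 2)))))))
    (Γ-cong (trans (+-congʳ (+-congʳ (ι-* 4 (suc n)))) (trans
      (solve 2 (λ x n → con (+ 4) :* (con (+ 1) :+ n) :+ x :- con (+ 1)
        := x :+ con (+ 1) :+ (con (+ 1) :+ (con (+ 1) :+ n :* con (+ 2) :* con (+ 2)))) refl x (ι n))
      (+-congˡ (+-congˡ (+-congˡ (sym (trans (ι-* (n ℕ.* 2) 2) (*-congʳ (ι-* n 2))))))))))
    -- With i = n + 1 the half arguments (3i + x - 2) / 2 and (i + x) / 2 differ by i - 1 = n, so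
    -- their Gamma values differ by a rising factorial of length n.
    (F.trans (Γ-cong half) (Γ-rise w n (½x+ι≉0 (suc n))))
    (F.trans (F.reflexive (≡.cong (λ k → Γ (ι k)) 2*suc-n≡′)) (Γ-factorial (suc (n ℕ.* 2))))
    (Γ-cong (trans (+-congʳ (ι-* 3 (suc n))) (trans
      (solve 2 (λ x n → con (+ 3) :* (con (+ 1) :+ n) :+ x
        := x :+ con (+ 1) :+ (n :* con (+ 2) :+ (con (+ 1) :+ (con (+ 1) :+ n)))) refl x (ι n))
      (+-congˡ (sym (trans (ι-+ (n ℕ.* 2) (suc (suc n))) (+-congʳ (ι-* n 2))))))))
    (Γ-cong (trans (+-congʳ (+-congʳ (ι-* 3 (suc n)))) (trans
      (solve 2 (λ x n → con (+ 3) :* (con (+ 1) :+ n) :+ x :- con (+ 2) := x :+ con (+ 1) :+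
          (n :* con (+ 2) :+ n)) refl x (ι n))
      (+-congˡ (sym (trans (ι-+ (n ℕ.* 2) n) (+-congʳ (ι-* n 2))))))))
    step
    (regularᶠ (Γ (ι 1)) (Γ-nonzero (ι 1))) (regularᶠ (Γ w) (Γ-nonzero w))
    where
    w : Carrier
    w = ½ * (ι (suc n) + x)
    denominator≉0 : ¬ Γ (ι (2 ℕ.* suc n)) *ᶠ Γ (ι (3 ℕ.* suc n) + x) *ᶠ Γ (ι (3 ℕ.* suc n) + x - ι 2) *ᶠ Γ w ≈ᶠ 0ᶠ
    denominator≉0 = *ᶠ-≉0 (d₁ *ᶠ d₂ *ᶠ d₃) (Γ w) (*ᶠ-≉0 (d₁ *ᶠ d₂) d₃
      (*ᶠ-≉0 d₁ d₂ (Γ-nonzero _) (Γ-nonzero _)) (Γ-nonzero _)) (Γ-nonzero w)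
      where
      d₁ d₂ d₃ : Fraction
      d₁ = Γ (ι (2 ℕ.* suc n))
      d₂ = Γ (ι (3 ℕ.* suc n) + x)
      d₃ = Γ (ι (3 ℕ.* suc n) + x - ι 2)
    2*suc-n≡′ : 2 ℕ.* suc n ≡ suc (suc (n ℕ.* 2))
    2*suc-n≡′ = ℕ.*-comm 2 (suc n)
    2*suc-n≡ : 2 ℕ.* suc n ≡ suc (suc (n ℕ.+ n))
    2*suc-n≡ = ≡.trans 2*suc-n≡′ (≡.cong (λ k → suc (suc k))
        (≡.trans (ℕ.*-comm n 2) (≡.cong (n ℕ.+_) (ℕ.+-identityʳ n))))
    half : ½ * (ι (3 ℕ.* suc n) + x - ι 2) ≈ w + ι n
    half = trans (*-congˡ (+-congʳ (+-congʳ (ι-* 3 (suc n))))) (trans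
      (solve 3 (λ h x n → h :* (con (+ 3) :* (con (+ 1) :+ n) :+ x :- con (+ 2)) := h :* (con (+ 1) :+ n :+ x)
          :+ h :* con (+ 2) :* n) refl ½ x (ι n))
      (+-congˡ (trans (*-congʳ ½*2≈1) (*-identityˡ (ι n)))))
    -- One half of 2^(2i-2) = 2^n 2^n is spread over the n factors of the rising factorial: 2 ((n +
    -- 1 + x) / 2 + l) = b + n + 2l.
    step : ιᶠ 2 ^ᶠ n *ᶠ embed (rise w n) ≈ᶠ P.stepFactor n
    step = F.trans (F.*-congʳ {embed (rise w n)} (F.sym (embed-2^ n))) (F.trans
      (F.sym (embed-* (ι 2 ^ n) (rise w n))) (F.trans (embed-cong doubled)
      (F.trans (embed-∏< n λ l → b + ι (n ℕ.+ l ℕ.* 2))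
          (∏ᶠ<-cong n {λ l → embed (b + ι (n ℕ.+ l ℕ.* 2))} {λ l → bᶠ +ᶠ ιᶠ (n ℕ.+ l ℕ.* 2)} λ l → embed-b+ι
          (n ℕ.+ l ℕ.* 2)))))
      where
      doubled : ι 2 ^ n * rise w n ≈ ∏< n λ l → b + ι (n ℕ.+ l ℕ.* 2)
      doubled = trans (*-congʳ (sym (∏<-constant n (ι 2)))) (trans (sym (∏<-* n (λ _ → ι 2) (λ l → w + ι l)))
        (∏<-cong′ n λ l → trans
          (solve 4 (λ h x n l → con (+ 2) :* (h :* (con (+ 1) :+ n :+ x) :+ l)
            := (h :* con (+ 2)) :* (con (+ 1) :+ n :+ x) :+ l :* con (+ 2)) refl ½ x (ι n) (ι l))
          (trans (+-congʳ (trans (*-congʳ ½*2≈1) (*-identityˡ _))) (trans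
            (solve 3 (λ x n l → con (+ 1) :+ n :+ x :+ l := x :+ con (+ 1) :+ (n :+ l)) refl x (ι n) (ι l * ι 2))
            (+-congˡ (sym (trans (ι-+ n (l ℕ.* 2)) (+-congˡ (ι-* l 2)))))))))

  gammaFormula≈ : ∀ n d →
    ∏< n (λ r → ι (suc (r ℕ.* 2) !)) * ∏< n (α n) * d ≈ ι 2 * (∏< n (β n) * ∏< n (λ t → ι 2 ^ t * ι (t !) * q n t)) →
    embed d ≈ᶠ ιᶠ 2 *ᶠ ∏ᶠ< n (λ k → factor (suc k))
  gammaFormula≈ n d e = P.gamma-product (λ k → factor (suc k)) factor-isRatio n (embed d) (begin
    P.Fₙ n *ᶠ ∏ᶠ< n (V.α n) *ᶠ embed d
      ≈⟨ F.*-congʳ {embed d} (F.*-cong {embed f} {P.Fₙ n} {embed (∏< n (α n))} {∏ᶠ< n (V.α n)}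
           (embed-∏ n (λ r → ι (suc (r ℕ.* 2) !)) (λ r → ιᶠ (suc (r ℕ.* 2) !)) λ r → embed-ι (suc (r ℕ.* 2) !))
               (embed-∏ n (α n) (V.α n) embed-α)) ⟨
    embed f *ᶠ embed (∏< n (α n)) *ᶠ embed d
      ≈⟨ F.trans (embed-* (f * ∏< n (α n)) d) (F.*-congʳ {embed d} (embed-* f (∏< n (α n)))) ⟨
    embed (f * ∏< n (α n) * d)
      ≈⟨ embed-cong e ⟩
    embed (ι 2 * (∏< n (β n) * t))
      ≈⟨ F.trans (embed-* (ι 2) (∏< n (β n) * t)) (F.*-congˡ {embed (ι 2)} (embed-* (∏< n (β n)) t)) ⟩
    embed (ι 2) *ᶠ (embed (∏< n (β n)) *ᶠ embed t)
      ≈⟨ F.*-cong {embed (ι 2)} {ιᶠ 2} {embed (∏< n (β n)) *ᶠ embed t} {∏ᶠ< n (V.β n) *ᶠ tᶠ} (embed-ι 2)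
           (F.*-cong {embed (∏< n (β n))} {∏ᶠ< n (V.β n)} {embed t} {tᶠ} (embed-∏ n (β n) (V.β n) embed-β)
             (embed-∏ n (λ t → ι 2 ^ t * ι (t !) * q n t) (λ t → ιᶠ 2 ^ᶠ t *ᶠ ιᶠ (t !) *ᶠ V.q n t) embed-t)) ⟩
    ιᶠ 2 *ᶠ (∏ᶠ< n (V.β n) *ᶠ tᶠ)
      ∎)
    where
    open SetoidReasoning F.setoid
    f t : Carrier
    f = ∏< n λ r → ι (suc (r ℕ.* 2) !)
    t = ∏< n λ t → ι 2 ^ t * ι (t !) * q n t
    tᶠ : Fraction
    tᶠ = ∏ᶠ< n λ t → ιᶠ 2 ^ᶠ t *ᶠ ιᶠ (t !) *ᶠ V.q n t
    embed-∏ : ∀ n f g → (∀ i → embed (f i) ≈ᶠ g i) → embed (∏< n f) ≈ᶠ ∏ᶠ< n g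
    embed-∏ n f g e = F.trans (embed-∏< n f) (∏ᶠ<-cong n {λ i → embed (f i)} {g} e)
    embed-b+ι+ι : ∀ j k → embed (b + ι j + ι k) ≈ᶠ bᶠ +ᶠ ιᶠ j +ᶠ ιᶠ k
    embed-b+ι+ι j k = F.trans (embed-+ (b + ι j) (ι k))
      (F.+-cong {embed (b + ι j)} {bᶠ +ᶠ ιᶠ j} {embed (ι k)} {ιᶠ k} (embed-b+ι j) (embed-ι k))
    embed-α : ∀ l → embed (α n l) ≈ᶠ V.α n l
    embed-α l = embed-rise (l ℕ.* 2 ∸ n) (embed-b+ι+ι n (l ℕ.* 2))
    embed-β : ∀ l → embed (β n l) ≈ᶠ V.β n l
    embed-β l = embed-rise (n ∸ l ℕ.* 2) (embed-b+ι (l ℕ.* 2 ℕ.+ l ℕ.* 2))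
    embed-q : ∀ t → embed (q n t) ≈ᶠ V.q n t
    embed-q t = embed-rise t (F.trans (embed-+ (b + ι n + ι n) (ι t))
      (F.+-cong {embed (b + ι n + ι n)} {bᶠ +ᶠ ιᶠ n +ᶠ ιᶠ n} {embed (ι t)} {ιᶠ t} (embed-b+ι+ι n n) (embed-ι t)))
    embed-t : ∀ t → embed (ι 2 ^ t * ι (t !) * q n t) ≈ᶠ ιᶠ 2 ^ᶠ t *ᶠ ιᶠ (t !) *ᶠ V.q n t
    embed-t t = F.trans (embed-* (ι 2 ^ t * ι (t !)) (q n t))
        (F.*-cong {embed (ι 2 ^ t * ι (t !))} {ιᶠ 2 ^ᶠ t *ᶠ ιᶠ (t !)} {embed (q n t)} {V.q n t}
      (F.trans (embed-* (ι 2 ^ t) (ι (t !))) (F.*-cong {embed (ι 2 ^ t)} {ιᶠ 2 ^ᶠ t} {embed (ι (t !))}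
          {ιᶠ (t !)} (embed-2^ t) (embed-ι (t !)))) (embed-q t))

-- The instance ℚ[x]

open import Defs

fromℕ : ℕ → ℚ
fromℕ n = + n ℚ./ 1

fromℕ-suc : ∀ n → 1ℚ ℚ.+ fromℕ n ≡ fromℕ (suc n)
fromℕ-suc n = ℚ.toℚᵘ-injective (begin
  ℚ.toℚᵘ (1ℚ ℚ.+ fromℕ n)              ≈⟨ ℚ.toℚᵘ-homo-+ 1ℚ (fromℕ n) ⟩
  ℚᵘ.1ℚᵘ ℚᵘ.+ ℚ.toℚᵘ (fromℕ n)         ≈⟨ ℚᵘ.+-congʳ ℚᵘ.1ℚᵘ (ℚ.toℚᵘ-fromℚᵘ (ℚᵘ.mkℚᵘ (+ n) 0)) ⟩
  ℚᵘ.1ℚᵘ ℚᵘ.+ ℚᵘ.mkℚᵘ (+ n) 0          ≈⟨ ℚᵘ.*≡* (≡.cong (λ i → (+ 1 ℤ.+ i) ℤ.* + 1) (ℤ.*-identityʳ (+ n))) ⟩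
  ℚᵘ.mkℚᵘ (+ suc n) 0                  ≈⟨ ℚ.toℚᵘ-fromℚᵘ (ℚᵘ.mkℚᵘ (+ suc n) 0) ⟨
  ℚ.toℚᵘ (fromℕ (suc n))               ∎)
  where open SetoidReasoning ℚᵘ.≃-setoid

1/d*d≡1 : ∀ d .{{_ : NonZero d}} → + 1 ℚ./ d ℚ.* fromℕ d ≡ 1ℚ
1/d*d≡1 zero {{d≢0}} = ⊥-elim (ℕ.≢-nonZero⁻¹ 0 {{d≢0}} ≡.refl)
1/d*d≡1 d@(suc d-1)  = ℚ.toℚᵘ-injective (begin
  ℚ.toℚᵘ (+ 1 ℚ./ d ℚ.* fromℕ d)                ≈⟨ ℚ.toℚᵘ-homo-* (+ 1 ℚ./ d) (fromℕ d) ⟩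
  ℚ.toℚᵘ (+ 1 ℚ./ d) ℚᵘ.* ℚ.toℚᵘ (fromℕ d)      ≈⟨ ℚᵘ.*-cong (ℚ.toℚᵘ-fromℚᵘ (ℚᵘ.mkℚᵘ (+ 1) d-1))
      (ℚ.toℚᵘ-fromℚᵘ (ℚᵘ.mkℚᵘ (+ d) 0)) ⟩
  ℚᵘ.mkℚᵘ (+ 1) d-1 ℚᵘ.* ℚᵘ.mkℚᵘ (+ d) 0        ≈⟨ ℚᵘ.*≡*
      (≡.trans (ℤ.*-identityʳ _) (≡.cong (λ k → + 1 ℤ.* + k) (≡.sym (ℕ.*-identityʳ d)))) ⟩
  ℚᵘ.1ℚᵘ                                        ∎)
  where open SetoidReasoning ℚᵘ.≃-setoid

module ℚX = CommutativeRing ℚ[x]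

ι≈const : ∀ n → ι n ≈ const (fromℕ n)
ι≈const zero    = Polynomial.mk≈ λ { zero → ≡.refl ; (suc k) → ≡.refl }
ι≈const (suc n) = ℚX.trans (ℚX.+-congˡ {1#} (ι≈const n)) (Polynomial.∷-cong (fromℕ-suc n) Polynomial.refl)

const-* : ∀ p q → const p * const q ≈ const (p ℚ.* q)
const-* p q = Polynomial.∷-cong (ℚ.+-identityʳ (p ℚ.* q)) Polynomial.refl

const-cong : ∀ {p q} → p ≡ q → const p ≈ const q
const-cong e = Polynomial.∷-cong e Polynomial.refl

inverses : InverseFactorials ℚ[x]
inverses = record
  { 1/_!  = λ p → const (1/! p)
  ; 1/!*! = λ p → ℚX.trans (ℚX.*-congˡ {const (1/! p)} (ι≈const (p !)))
      (ℚX.trans (const-* (1/! p) (fromℕ (p !))) (const-cong (1/d*d≡1 (p !) {{p ℕ.!≢0}})))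
  }

ι-linear : ∀ n → coeff (ι n) 1 ≡ 0ℚ
ι-linear n = Polynomial.coeff-≡ (ι≈const n) 1

-- Adding an integer leaves the coefficient of x unchanged, so this one coefficient settles the
-- matter for all k.
linear≉0 : ∀ p q → coeff p 1 ≡ q → q ≢ 0ℚ → ∀ k → ¬ p + ι k ≈ 0#
linear≉0 p q eq q≢0 k e = q≢0 (≡.trans (≡.sym (≡.trans (Polynomial.coeff-+ p (ι k) 1)
  (≡.trans (≡.cong₂ ℚ._+_ eq (ι-linear k)) (ℚ.+-identityʳ q)))) (Polynomial.coeff-≡ e 1))

½*[ι+X]-linear : ∀ i → coeff (const ℚ.½ * (ι i + X)) 1 ≡ ℚ.½
½*[ι+X]-linear i = ≡.trans (Polynomial.coeff-≡ (ℚX.*-congˡ {const ℚ.½} (ℚX.+-congʳ {X} (ι≈const i))) 1) ≡.refl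

indeterminate : Indeterminate ℚ[x]
indeterminate = record
  { x       = X
  ; ½       = const ℚ.½
  ; ½*2≈1   = ℚX.trans (ℚX.*-congˡ {const ℚ.½} (ι≈const 2)) (const-* ℚ.½ (fromℕ 2))
  ; x+1+ι≉0 = linear≉0 (X + 1#) 1ℚ ≡.refl λ ()
  ; ½x+ι≉0  = λ i → linear≉0 (const ℚ.½ * (ι i + X)) ℚ.½ (½*[ι+X]-linear i) λ ()
  }

b+ι-regular : ∀ k → DeterminantEvaluation.Regular ℚ[x] (X + 1# + ι k)
b+ι-regular k = FractionProperties.regular ℚ[x] ℚ[x]-discreteDomain inverses (linear≉0 (X + 1#) 1ℚ ≡.refl (λ ()) k)

functionalEquation : GammaFunction → FunctionalEquation ℚ[x] ℚ[x]-discreteDomain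
functionalEquation G = record
  { Γ = Γ ; Γ-cong = Γ-cong ; Γ-nonzero = Γ-nonzero ; Γ-functional = Γ-functional }
  where open GammaFunction G

theorem6 : (n : ℕ) → .{{_ : NonZero n}} →
    (D₂ n ≈ productFormula n) ×
    ((Γ : GammaFunction) → embed (D₂ n) ≈ᶠ gammaFormula Γ n)
theorem6 zero {{n≢0}} = ⊥-elim (ℕ.≢-nonZero⁻¹ 0 {{n≢0}} ≡.refl)
theorem6 (suc m) =
    ProductFormula.det-productFormula ℚ[x] inverses X m b+ι-regular
  , λ Γ → GammaFormula.gammaFormula≈ ℚ[x] ℚ[x]-discreteDomain inverses indeterminate (functionalEquation Γ)
      (suc m) (D₂ (suc m))
      (ProductFormula.det-entryₓ ℚ[x] inverses X b+ι-regular m)
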